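{- Let $\Phi=(A;\{E_i\}_{i=0}^d;A^*;\{E^*_i\}_{i=0}^d)$ be a tridiagonal system on $V$ with diameter $d\geq 1$ that has $q$-Serre type, and regard $V$ as a $U^+_q$-module on which $W_0$ acts as $A$ and $W_1$ acts as $A^*$. Let $\{\mathcal V_i\}_{i=0}^d$ be one of the six decompositions $[0,D]$, $[0^*,D^*]$, $[0^*,0]$, $[0^*,D]$, $[D^*,0]$, $[D^*,D]$ of $V$ (with $\mathcal V_{ -1}=\mathcal V_{d+1}=0$). Then for all $k\in\mathbb N$ and $0\leq i\leq d$: (a) for $[0,D]$: $W_{ -k}\mathcal V_i\subseteq \mathcal V_i$ and $W_{k+1}\mathcal V_i\subseteq \mathcal V_{i-1}+\mathcal V_i+\mathcal V_{i+1}$; (b) for $[0^*,D^*]$: $W_{ -k}\mathcal V_i\subseteq \mathcal V_{i-1}+\mathcal V_i+\mathcal V_{i+1}$ and $W_{k+1}\mathcal V_i\subseteq \mathcal V_i$; (c) for each of $[0^*,0]$, $[0^*,D]$, $[D^*,0]$, $[D^*,D]$: $W_{ -k}\mathcal V_i\subseteq \mathcal V_i+\mathcal V_{i+1}$ and $W_{k+1}\mathcal V_i\subseteq \mathcal V_{i-1}+\mathcal V_i$.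
   Context: $\mathbb F$ is a field, $V$ a nonzero finite-dimensional $\mathbb F$-vector space. A tridiagonal (TD) pair on $V$ is an ordered pair $A,A^*\in\mathrm{End}(V)$ such that: (i) each of $A,A^*$ is diagonalizable; (ii) there is an ordering $\{V_i\}_{i=0}^d$ of the eigenspaces of $A$ with $A^*V_i\subseteq V_{i-1}+V_i+V_{i+1}$ ($V_{ -1}=V_{d+1}=0$); (iii) there is an ordering $\{V^*_i\}_{i=0}^\delta$ of the eigenspaces of $A^*$ with $AV^*_i\subseteq V^*_{i-1}+V^*_i+V^*_{i+1}$; (iv) there is no subspace $W\neq 0,V$ with $AW\subseteq W$, $A^*W\subseteq W$. Such orderings are called standard. A TD system on $V$ is a sequence $(A;\{E_i\}_{i=0}^d;A^*;\{E^*_i\}_{i=0}^\delta)$ where $A,A^*$ is a TD pair, $\{E_i\}$ are the primitive idempotents of $A$ in a standard ordering and $\{E^*_i\}$ those of $A^*$ in a standard ordering; one always has $d=\delta$ (the diameter). Let $\theta_i$ (resp. $\theta^*_i$) be the eigenvalue of $A$ for $E_i$ (resp. of $A^*$ for $E^*_i$). Fix a nonzero $q$ in the algebraic closure of $\mathbb F$, not a root of unity, with $b=q^2\in\mathbb F$. $\Phi$ has $q$-Serre type if $\theta_i=b\theta_{i-1}$ and $\theta^*_i=b^{ -1}\theta^*_{i-1}$ for $1\leq i\leq d$. $U^+_q$ is the $\mathbb F$-algebra with generators $W_0,W_1$ and relations $[W_0,[W_0,[W_0,W_1]_b]_{b^{ -1}}]=0$, $[W_1,[W_1,[W_1,W_0]_b]_{b^{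 -1}}]=0$, where $[X,Y]=XY-YX$ and $[X,Y]_b=bXY-YX$. When $\Phi$ has $q$-Serre type, $A,A^*$ satisfy these relations, so $V$ is a $U^+_q$-module with $W_0\mapsto A$, $W_1\mapsto A^*$. The alternating elements $W_{ -k},W_{k+1},G_{k+1},\tilde G_{k+1}$ ($k\in\mathbb N$) of $U^+_q$ are defined recursively, in the order $W_0,W_1,G_1,\tilde G_1,W_{ -1},W_2,G_2,\tilde G_2,W_{ -2},W_3,\dots$, with $G_0=\tilde G_0=1$, by: for $n\geq1$, $G_n=\frac{\sum_{k=0}^{n-1}W_{ -k}W_{n-k}b^{ -k}-\sum_{k=1}^{n-1}G_k\tilde G_{n-k}b^{ -k}}{1+b^{ -n}}+\frac{[W_n,W_0]}{(1+b^{ -n})(1-b^{ -1})}$, $\tilde G_n=G_n+\frac{[W_0,W_n]}{1-b^{ -1}}$, $W_{ -n}=\frac{[W_0,G_n]_b}{b-1}$, $W_{n+1}=\frac{[G_n,W_1]_b}{b-1}$. The six decompositions of $V$ (each a sequence $\{\mathcal V_i\}_{i=0}^d$ of subspaces with direct sum $V$) have $i$-th components: $[0,D]$: $E_iV$; $[0^*,D^*]$: $E^*_iV$; $[0^*,0]$: $(E^*_0V+\cdots+E^*_iV)\cap(E_0V+\cdots+E_{d-i}V)$; $[0^*,D]$: $(E^*_0V+\cdots+E^*_iV)\cap(E_iV+\cdots+E_dV)$; $[D^*,0]$: $(E^*_{d-i}V+\cdots+E^*_dV)\cap(E_0V+\cdots+E_{d-i}V)$; $[D^*,D]$: $(E^*_{d-i}V+\cdots+E^*_dV)\cap(E_iV+\cdots+E_dV)$.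 -}

module Defs where

open import Level using (0ℓ)
open import Algebra.Bundles using (CommutativeRing; Ring)
open import Algebra.Module.Bundles using (LeftModule)
open import Data.Nat using (ℕ; zero; suc; _≤_; _<_; _∸_; _<?_)
open import Data.Fin using (Fin; toℕ; fromℕ<; inject₁; opposite)
import Data.Fin as Fin
open import Data.Product using (Σ; ∃; _×_; _,_)
open import Data.Unit using (⊤)
open import Relation.Nullary using (¬_; yes; no)
open import Relation.Binary.PropositionalEquality using (_≡_) renaming (sym to ≡-sym)
import Data.Nat

record Field : Set₁ where
  field
    commutativeRing : CommutativeRing 0ℓ 0ℓ
  open CommutativeRing commutativeRing public
  field
    inv       : Carrier → Carrier
    1≉0       : ¬ (1# ≈ 0#)
    inverseʳ  : ∀ x → ¬ (x ≈ 0#) → (x * inv x) ≈ 1#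

module Setup (F : Field) (V : LeftModule (Field.ring F) 0ℓ 0ℓ) where
  open Field F
  open LeftModule V

  Vec : Set
  Vec = Carrierᴹ

  pow : Carrier → ℕ → Carrier
  pow x zero    = 1#
  pow x (suc n) = x * pow x n

  vsum : ∀ {n} → (Fin n → Vec) → Vec
  vsum {zero}  f = 0ᴹ
  vsum {suc n} f = f Fin.zero +ᴹ vsum (λ j → f (Fin.suc j))

  IsBasis : ∀ {n} → (Fin n → Vec) → Set
  IsBasis {n} e =
    (∀ v → ∃ λ (c : Fin n → Carrier) → v ≈ᴹ vsum (λ j → c j *ₗ e j)) ×
    (∀ (c : Fin n → Carrier) → vsum (λ j → c j *ₗ e j) ≈ᴹ 0ᴹ → ∀ j → c j ≈ 0#)

  FinDimNonzero : Set
  FinDimNonzero = Σ ℕ λ n → 1 ≤ n × Σ (Fin n → Vec) IsBasis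

  record End : Set where
    field
      app   : Vec → Vec
      cong  : ∀ {u v} → u ≈ᴹ v → app u ≈ᴹ app v
      +-hom : ∀ u v → app (u +ᴹ v) ≈ᴹ (app u +ᴹ app v)
      *-hom : ∀ c v → app (c *ₗ v) ≈ᴹ (c *ₗ app v)
  open End public

  Sub : Set₁
  Sub = Vec → Set

  IsSubspace : Sub → Set
  IsSubspace W =
    (∀ {u v} → u ≈ᴹ v → W u → W v) × W 0ᴹ ×
    (∀ {u v} → W u → W v → W (u +ᴹ v)) × (∀ c {v} → W v → W (c *ₗ v))

  _⊆_ : Sub → Sub → Set
  P ⊆ Q = ∀ v → P v → Q v

  0ₛ : Sub
  0ₛ v = v ≈ᴹ 0ᴹ

  Vₛ : Sub
  Vₛ v = ⊤

  _+ₛ_ : Sub → Sub → Sub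
  (P +ₛ Q) v = ∃ λ p → ∃ λ q → P p × Q q × v ≈ᴹ (p +ᴹ q)

  _∩ₛ_ : Sub → Sub → Sub
  (P ∩ₛ Q) v = P v × Q v

  MapsInto : (Vec → Vec) → Sub → Sub → Set
  MapsInto f W Z = ∀ v → W v → Z (f v)

  RangeSum : ∀ {d} → (Fin (suc d) → Sub) → ℕ → ℕ → Sub
  RangeSum {d} S lo hi v =
    ∃ λ (f : Fin (suc d) → Vec) →
      (∀ j → lo ≤ toℕ j → toℕ j ≤ hi → S j (f j)) ×
      (∀ j → ¬ (lo ≤ toℕ j × toℕ j ≤ hi) → f j ≈ᴹ 0ᴹ) ×
      v ≈ᴹ vsum f

  IsDirectSum : ∀ {d} → (Fin (suc d) → Sub) → Set
  IsDirectSum {d} S =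
    (∀ i → IsSubspace (S i)) ×
    (∀ v → ∃ λ (f : Fin (suc d) → Vec) → (∀ i → S i (f i)) × v ≈ᴹ vsum f) ×
    (∀ (f : Fin (suc d) → Vec) → (∀ i → S i (f i)) → vsum f ≈ᴹ 0ᴹ →
       ∀ i → f i ≈ᴹ 0ᴹ)

  ext : ∀ {d} → (Fin (suc d) → Sub) → ℕ → Sub
  ext {d} S n with n <? suc d
  ... | yes p = S (fromℕ< p)
  ... | no  _ = 0ₛ

  Prev : ∀ {d} → (Fin (suc d) → Sub) → Fin (suc d) → Sub
  Prev S i with toℕ i
  ... | zero  = 0ₛ
  ... | suc m = ext S m

  Next : ∀ {d} → (Fin (suc d) → Sub) → Fin (suc d) → Sub
  Next S i = ext S (suc (toℕ i))

  Eig : End → Carrier → Sub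
  Eig A θ v = app A v ≈ᴹ (θ *ₗ v)

  EigenOrdering : ∀ {d} → End → (Fin (suc d) → Carrier) → Set
  EigenOrdering A θ =
    (∀ i j → θ i ≈ θ j → i ≡ j) ×
    (∀ i → ∃ λ v → Eig A (θ i) v × ¬ (v ≈ᴹ 0ᴹ)) ×
    IsDirectSum (λ i → Eig A (θ i))

  -- tridiagonal systems; E_i V = Eig A (θ i), E*_i V = Eig A* (θ* i)

  record TDSystem (d : ℕ) : Set₁ where
    field
      A     : End
      θ     : Fin (suc d) → Carrier
      As    : End
      θs    : Fin (suc d) → Carrier
      ordA  : EigenOrdering A θ
      ordAs : EigenOrdering As θs
      tridiagA : ∀ i → MapsInto (app As) (Eig A (θ i))
                   ((Prev (λ j → Eig A (θ j)) i +ₛ Eig A (θ i)) +ₛ Next (λ j → Eig A (θ j)) i)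
      tridiagAs : ∀ i → MapsInto (app A) (Eig As (θs i))
                   ((Prev (λ j → Eig As (θs j)) i +ₛ Eig As (θs i)) +ₛ Next (λ j → Eig As (θs j)) i)
      irreducible : ¬ (Σ Sub λ W → IsSubspace W × MapsInto (app A) W W × MapsInto (app As) W W ×
                          ¬ (W ⊆ 0ₛ) × ¬ (Vₛ ⊆ W))

    EV : Fin (suc d) → Sub
    EV i = Eig A (θ i)

    EsV : Fin (suc d) → Sub
    EsV i = Eig As (θs i)

    dec0D dec0sDs dec0s0 dec0sD decDs0 decDsD : Fin (suc d) → Sub
    dec0D   i = EV i
    dec0sDs i = EsV i
    dec0s0  i = RangeSum EsV 0 (toℕ i) ∩ₛ RangeSum EV 0 (d ∸ toℕ i)
    dec0sD  i = RangeSum EsV 0 (toℕ i) ∩ₛ RangeSum EV (toℕ i) d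
    decDs0  i = RangeSum EsV (d ∸ toℕ i) d ∩ₛ RangeSum EV 0 (d ∸ toℕ i)
    decDsD  i = RangeSum EsV (d ∸ toℕ i) d ∩ₛ RangeSum EV (toℕ i) d

  -- q-Serre type, phrased through b = q²
  SerreType : ∀ {d} → Carrier → TDSystem d → Set
  SerreType b Φ =
    (∀ i → θ (Fin.suc i) ≈ (b * θ (inject₁ i))) ×
    (∀ i → θs (Fin.suc i) ≈ (inv b * θs (inject₁ i)))
    where open TDSystem Φ

  Op : Set
  Op = Vec → Vec

  _⊕_ : Op → Op → Op
  (f ⊕ g) v = f v +ᴹ g v

  _⊖_ : Op → Op → Op
  (f ⊖ g) v = f v +ᴹ (-ᴹ g v)

  _⊙_ : Carrier → Op → Op
  (c ⊙ f) v = c *ₗ f v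

  _∘ₒ_ : Op → Op → Op
  (f ∘ₒ g) v = f (g v)

  idₒ 0ₒ : Op
  idₒ v = v
  0ₒ v = 0ᴹ

  comm : Op → Op → Op
  comm X Y = (X ∘ₒ Y) ⊖ (Y ∘ₒ X)

  qcomm : Carrier → Op → Op → Op
  qcomm b X Y = (b ⊙ (X ∘ₒ Y)) ⊖ (Y ∘ₒ X)

  opsum : ∀ {n} → (Fin n → Op) → Op
  opsum {zero}  f = 0ₒ
  opsum {suc n} f = f Fin.zero ⊕ opsum (λ j → f (Fin.suc j))

  -- the j-th entry records (W_{-j}, W_{j+1}, G_j, G̃_j)
  record Alt : Set where
    constructor alt
    field
      Wneg Wpos G Gt : Op

  module Alternating (b : Carrier) (W0 W1 : Op) where
    bi : Carrier
    bi = inv b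

    step : (n : ℕ) → (Fin (suc n) → Alt) → Alt
    step n h = alt Wneg' Wpos' Gm Gtm
      where
        m : ℕ
        m = suc n
        c : Carrier
        c = 1# + pow bi m
        Wm : Op
        Wm = Alt.Wpos (h (Fin.fromℕ n))
        -- Σ_{k=0}^{n} W_{-k} W_{m-k} b^{-k}
        s1 : Op
        s1 = opsum (λ (k : Fin (suc n)) →
               pow bi (toℕ k) ⊙ (Alt.Wneg (h k) ∘ₒ Alt.Wpos (h (opposite k))))
        -- Σ_{k=1}^{n} G_k G̃_{m-k} b^{-k}   (k = j+1)
        s2 : Op
        s2 = opsum (λ (j : Fin n) →
               pow bi (suc (toℕ j)) ⊙ (Alt.G (h (Fin.suc j)) ∘ₒ Alt.Gt (h (opposite (inject₁ j)))))
        Gm : Op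
        Gm = (inv c ⊙ (s1 ⊖ s2)) ⊕ (inv (c * (1# - bi)) ⊙ comm Wm W0)
        Gtm : Op
        Gtm = Gm ⊕ (inv (1# - bi) ⊙ comm W0 Wm)
        Wneg' : Op
        Wneg' = inv (b - 1#) ⊙ qcomm b W0 Gm
        Wpos' : Op
        Wpos' = inv (b - 1#) ⊙ qcomm b Gm W1

    table : (n : ℕ) → Fin (suc n) → Alt
    table zero    _ = alt W0 W1 idₒ idₒ
    table (suc n) j with Fin.toℕ j Data.Nat.≟ suc n
    ... | yes _ = step n (table n)
    ... | no  p = table n (Fin.lower₁ j (λ e → p (≡-sym e)))

    entry : ℕ → Alt
    entry n = table n (Fin.fromℕ n)

    Wminus Wplus : ℕ → Op
    Wminus k = Alt.Wneg (entry k)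
    Wplus  k = Alt.Wpos (entry k)

{-# OPTIONS --safe #-}
module Submission where

-- Put G(t) = Σ Gₙtⁿ, G̃(t) = Σ G̃ₙtⁿ, W⁻(t) = Σ W₋ₙtⁿ and W⁺(t) = Σ Wₙ₊₁tⁿ. The recursion amounts to
--   (b − 1) W⁻ = [W₀, G]_b,  (b − 1) W⁺ = [G, W₁]_b,  t [W₀, W⁺] = (1 − b⁻¹)(G̃ − G),
--   G(t/b) G̃(t) − t W⁻(t/b) W⁺(t) = 1.
-- By induction on n the coefficients of degree n also satisfy the relations
--   (b − 1) W⁻ = [G̃, W₀]_b,  (b − 1) W⁺ = [W₁, G̃]_b,  t [W⁻, W₁] = (1 − b⁻¹)(G̃ − G),
--   G̃(t/b) G(t) − t W⁺(t/b) W⁻(t) = 1,  G(t/b) W⁻(t) = W⁻(t/b) G(t),  G̃(t/b) W⁺(t) = W⁺(t/b) G̃(t),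
-- and [W₀, W⁻] = 0 = [W₁, W⁺]: commuting W₀ and W₁ past the quadratic expressions expresses their
-- coefficients through the defects of the relations in the top degree, with factors 1 ± b⁻ᵐ, which are
-- nonzero as b is not a root of unity; the q-Serre relations are needed only for n = 1.
-- Hence W₋ₖ commutes with A, while [A, Wₖ₊₁] is a multiple of G̃ − G, whose blocks between eigenspaces
-- of A vanish off the three central diagonals; likewise for A*. This is (a) and (b).
--
-- For (c), Uᵢ = (E*₀V + ⋯ + E*ᵢV) ∩ (E₀V + ⋯ + E_{d−i}V) is sent by W₋ₖ into
-- (E*₀V + ⋯ + E*ᵢ₊₁V) ∩ (E₀V + ⋯ + E_{d−i}V), which is Uᵢ + Uᵢ₊₁ because E*₀V + ⋯ + E*ᵢV and
-- E₀V + ⋯ + E_{d−i−1}V span V. Irreducibility only refutes that a certain endomorphism is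
-- noninjective, and equality in the field is not decidable; but then its determinant is nonzero,
-- hence invertible, so the endomorphism is surjective and the splitting can be computed.

open import Defs
open import Level using (0ℓ)
open import Algebra.Bundles using (AbelianGroup; Ring)
open import Algebra.Module.Bundles using (LeftModule)
import Algebra.Properties.AbelianGroup as AbelianGroupProperties
import Algebra.Properties.CommutativeSemigroup as CommutativeSemigroupProperties
import Algebra.Properties.Ring as RingProperties
open import Data.Bool using (Bool; true; false; not; if_then_else_)
import Data.Bool as Bool
open import Data.Empty using (⊥; ⊥-elim)
open import Data.Fin using (Fin; zero; suc; toℕ; fromℕ; inject₁; opposite)
import Data.Fin as Fin
import Data.Fin.Properties as Fin
open import Data.List using (List; []; _∷_; _++_; map; length; tabulate)
import Data.List.Properties as List
open import Data.Maybe using (Maybe; just; nothing)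
open import Data.Nat using (ℕ; zero; suc; _∸_; _≤_; _<_; z≤n; s≤s)
import Data.Nat as ℕ
import Data.Nat.Properties as ℕ
open import Data.Product using (Σ; ∃; _×_; _,_; proj₁; proj₂)
import Data.Product.Properties as Product
open import Data.Sum using (_⊎_; inj₁; inj₂)
open import Data.Unit using (⊤; tt)
open import Data.Vec using () renaming (Vec to Vector; [] to []ᵛ; _∷_ to _∷ᵛ_; map to mapᵛ)
import Data.Vec as Vec
open import Data.Vec.N-ary using (N-ary; _$ⁿ_)
open import Relation.Binary using (tri<; tri≈; tri>)
open import Relation.Binary.PropositionalEquality as ≡ using (_≡_)
import Relation.Binary.Reasoning.Setoid as SetoidReasoning
open import Relation.Nullary using (¬_; Dec; yes; no; does)
open import Relation.Nullary.Decidable using (_×-dec_)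

-- Let `L` and `R` be left and right multiplication by a generator `x`. Bracketing `x` with a known
-- relation removes all lower defects and keeps the highest one from the two ends of the
-- convolution, with weights that differ by a power of b: this is the origin of the factors 1 ± b⁻ᵐ.
-- Both orders of the determinant are carried along because each yields an equation in the same
-- three quantities, a minor and two defects. [x, G]_b and [G̃, x]_b are multiples of W⁻, which
-- commutes with x = W₀, so (L - R)(L - bR)(L - b⁻¹R) kills G and G̃. This cubic multiplies the
-- block from EᵢV to EⱼV by (θⱼ - θᵢ)(θⱼ - bθᵢ)(θⱼ - b⁻¹θᵢ), zero exactly when i and j differ by at
-- most 1: hence the vanishing blocks and, conversely, the q-Serre relations themselves. For the
-- spanning in (c), the sum over i + j = r of (E*₀V + ⋯ + E*ᵢV) ∩ (E₀V + ⋯ + EⱼV) is invariant, so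
-- it cannot be nonzero for r < d. Applied to two orderings and to both reversed, this replaces a
-- dimension count.

record CentralUnit (R : Ring 0ℓ 0ℓ) : Set where
  open Ring R
  field
    b c       : Carrier
    b-central : ∀ z → b * z ≈ z * b
    c-central : ∀ z → c * z ≈ z * c
    bc≈1      : b * c ≈ 1#

-- Decides identities of noncommutative polynomials over ℤ[b,b⁻¹] by expanding
-- both sides to signed words and cancelling words of opposite sign.
module LaurentSolver (R : Ring 0ℓ 0ℓ) (unit : CentralUnit R) where
  open Ring R
  open CentralUnit unit

  open RingProperties R using (-‿distribˡ-*; -‿distribʳ-*; -0#≈0#; -‿+-comm; -‿involutive)
  open SetoidReasoning setoid

  infixl 6 _:+_ _:-_
  infixl 7 _:*_
  infix  8 :-_
  infix  4 _:=_

  data Expr (n : ℕ) : Set where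
    var         : Fin n → Expr n
    :b :c :0 :1 : Expr n
    _:+_ _:*_   : Expr n → Expr n → Expr n
    :-_         : Expr n → Expr n

  _:-_ : ∀ {n} → Expr n → Expr n → Expr n
  e :- f = e :+ (:- f)

  _:=_ : ∀ {n} → Expr n → Expr n → Expr n × Expr n
  _:=_ = _,_

  ⟦_⟧ : ∀ {n} → Expr n → Vector Carrier n → Carrier
  ⟦ var i ⟧  ρ = Vec.lookup ρ i
  ⟦ :b ⟧     ρ = b
  ⟦ :c ⟧     ρ = c
  ⟦ :0 ⟧     ρ = 0#
  ⟦ :1 ⟧     ρ = 1#
  ⟦ e :+ f ⟧ ρ = ⟦ e ⟧ ρ + ⟦ f ⟧ ρ
  ⟦ e :* f ⟧ ρ = ⟦ e ⟧ ρ * ⟦ f ⟧ ρ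
  ⟦ :- e ⟧   ρ = - ⟦ e ⟧ ρ

  pow : Carrier → ℕ → Carrier
  pow x zero    = 1#
  pow x (suc n) = x * pow x n

  Exponent : Set
  Exponent = ℕ × ℕ

  -- (i , j) stands for bⁱ cʲ; canonical exponents have i = 0 or j = 0.
  cancel : ℕ → ℕ → Exponent
  cancel (suc i) (suc j) = cancel i j
  cancel i       j       = i , j

  Term : ℕ → Set
  Term n = Bool × Exponent × List (Fin n)

  Poly : ℕ → Set
  Poly n = List (Term n)

  _·ₜ_ : ∀ {n} → Term n → Term n → Term n
  (s , (i , j) , w) ·ₜ (s′ , (i′ , j′) , w′) =
    (if s then s′ else not s′) , cancel (i ℕ.+ i′) (j ℕ.+ j′) , w ++ w′

  negₜ : ∀ {n} → Term n → Term n
  negₜ (s , m) = not s , m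

  _·ₚ_ : ∀ {n} → Poly n → Poly n → Poly n
  []      ·ₚ q = []
  (t ∷ p) ·ₚ q = map (t ·ₜ_) q ++ (p ·ₚ q)

  expand : ∀ {n} → Expr n → Poly n
  expand (var i)  = (true , (0 , 0) , i ∷ []) ∷ []
  expand :b       = (true , (1 , 0) , []) ∷ []
  expand :c       = (true , (0 , 1) , []) ∷ []
  expand :0       = []
  expand :1       = (true , (0 , 0) , []) ∷ []
  expand (e :+ f) = expand e ++ expand f
  expand (e :* f) = expand e ·ₚ expand f
  expand (:- e)   = map negₜ (expand e)

  _≟ₜ_ : ∀ {n} (t u : Term n) → Dec (t ≡ u)
  _≟ₜ_ = Product.≡-dec Bool._≟_
    (Product.≡-dec (Product.≡-dec ℕ._≟_ ℕ._≟_) (List.≡-dec Fin._≟_))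

  remove : ∀ {n} → Term n → Poly n → Maybe (Poly n)
  remove t [] = nothing
  remove t (u ∷ p) with t ≟ₜ u
  ... | yes _ = just p
  ... | no _ with remove t p
  ...   | just p′ = just (u ∷ p′)
  ...   | nothing = nothing

  -- The number bounds the length of the polynomial.
  isZero : ∀ {n} → ℕ → Poly n → Bool
  isZero _       []      = true
  isZero zero    (t ∷ p) = false
  isZero (suc k) (t ∷ p) with remove (negₜ t) p
  ... | just p′ = isZero k p′
  ... | nothing = false

  ⟦_⟧ₑ : Exponent → Carrier
  ⟦ i , j ⟧ₑ = pow b i * pow c j

  ⟦_⟧ʷ : ∀ {n} → List (Fin n) → Vector Carrier n → Carrier
  ⟦ [] ⟧ʷ    ρ = 1#
  ⟦ i ∷ w ⟧ʷ ρ = Vec.lookup ρ i * ⟦ w ⟧ʷ ρ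

  sign : Bool → Carrier → Carrier
  sign true  x = x
  sign false x = - x

  ⟦_⟧ₜ : ∀ {n} → Term n → Vector Carrier n → Carrier
  ⟦ s , m , w ⟧ₜ ρ = sign s (⟦ m ⟧ₑ * ⟦ w ⟧ʷ ρ)

  ⟦_⟧ₚ : ∀ {n} → Poly n → Vector Carrier n → Carrier
  ⟦ [] ⟧ₚ    ρ = 0#
  ⟦ t ∷ p ⟧ₚ ρ = ⟦ t ⟧ₜ ρ + ⟦ p ⟧ₚ ρ

  pow-central : ∀ {x} → (∀ z → x * z ≈ z * x) → ∀ n z → pow x n * z ≈ z * pow x n
  pow-central x-central zero    z = trans (*-identityˡ z) (sym (*-identityʳ z))
  pow-central {x} x-central (suc n) z = begin
    x * pow x n * z     ≈⟨ *-assoc _ _ _ ⟩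
    x * (pow x n * z)   ≈⟨ *-congˡ (pow-central x-central n z) ⟩
    x * (z * pow x n)   ≈⟨ *-assoc _ _ _ ⟨
    x * z * pow x n     ≈⟨ *-congʳ (x-central z) ⟩
    z * x * pow x n     ≈⟨ *-assoc _ _ _ ⟩
    z * (x * pow x n)   ∎

  pow-+ : ∀ x m n → pow x (m ℕ.+ n) ≈ pow x m * pow x n
  pow-+ x zero    n = sym (*-identityˡ _)
  pow-+ x (suc m) n = trans (*-congˡ (pow-+ x m n)) (sym (*-assoc _ _ _))

  middle-swap : ∀ {u v w z} → v * w ≈ w * v → (u * v) * (w * z) ≈ (u * w) * (v * z)
  middle-swap {u} {v} {w} {z} vw≈wv = begin
    (u * v) * (w * z)   ≈⟨ *-assoc _ _ _ ⟩
    u * (v * (w * z))   ≈⟨ *-congˡ (*-assoc _ _ _) ⟨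
    u * (v * w * z)     ≈⟨ *-congˡ (*-congʳ vw≈wv) ⟩
    u * (w * v * z)     ≈⟨ *-congˡ (*-assoc _ _ _) ⟩
    u * (w * (v * z))   ≈⟨ *-assoc _ _ _ ⟨
    (u * w) * (v * z)   ∎

  cancel-correct : ∀ i j → ⟦ cancel i j ⟧ₑ ≈ pow b i * pow c j
  cancel-correct zero    j       = refl
  cancel-correct (suc i) zero    = refl
  cancel-correct (suc i) (suc j) = begin
    ⟦ cancel i j ⟧ₑ                       ≈⟨ cancel-correct i j ⟩
    pow b i * pow c j                     ≈⟨ *-identityˡ _ ⟨
    1# * (pow b i * pow c j)              ≈⟨ *-congʳ bc≈1 ⟨
    (b * c) * (pow b i * pow c j)         ≈⟨ middle-swap (c-central _) ⟩
    (b * pow b i) * (c * pow c j)         ∎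

  exponent-correct : ∀ i j i′ j′ →
    ⟦ cancel (i ℕ.+ i′) (j ℕ.+ j′) ⟧ₑ ≈ ⟦ i , j ⟧ₑ * ⟦ i′ , j′ ⟧ₑ
  exponent-correct i j i′ j′ = begin
    ⟦ cancel (i ℕ.+ i′) (j ℕ.+ j′) ⟧ₑ             ≈⟨ cancel-correct (i ℕ.+ i′) (j ℕ.+ j′) ⟩
    pow b (i ℕ.+ i′) * pow c (j ℕ.+ j′)           ≈⟨ *-cong (pow-+ b i i′) (pow-+ c j j′) ⟩
    (pow b i * pow b i′) * (pow c j * pow c j′)   ≈⟨ middle-swap (pow-central b-central i′ _) ⟩
    ⟦ i , j ⟧ₑ * ⟦ i′ , j′ ⟧ₑ                     ∎

  exponent-central : ∀ i j z → ⟦ i , j ⟧ₑ * z ≈ z * ⟦ i , j ⟧ₑ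
  exponent-central i j z = begin
    pow b i * pow c j * z     ≈⟨ *-assoc _ _ _ ⟩
    pow b i * (pow c j * z)   ≈⟨ *-congˡ (pow-central c-central j z) ⟩
    pow b i * (z * pow c j)   ≈⟨ *-assoc _ _ _ ⟨
    pow b i * z * pow c j     ≈⟨ *-congʳ (pow-central b-central i z) ⟩
    z * pow b i * pow c j     ≈⟨ *-assoc _ _ _ ⟩
    z * (pow b i * pow c j)   ∎

  module _ {n} (ρ : Vector Carrier n) where

    word-correct : ∀ w w′ → ⟦ w ++ w′ ⟧ʷ ρ ≈ ⟦ w ⟧ʷ ρ * ⟦ w′ ⟧ʷ ρ
    word-correct []      w′ = sym (*-identityˡ _)
    word-correct (i ∷ w) w′ = trans (*-congˡ (word-correct w w′)) (sym (*-assoc _ _ _))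

    sign-* : ∀ s s′ {x y z} → x ≈ y * z → sign (if s then s′ else not s′) x ≈ sign s y * sign s′ z
    sign-* true  true  eq = eq
    sign-* true  false eq = trans (-‿cong eq) (-‿distribʳ-* _ _)
    sign-* false true  eq = trans (-‿cong eq) (-‿distribˡ-* _ _)
    sign-* false false {x} {y} {z} eq = begin
      x                 ≈⟨ eq ⟩
      y * z             ≈⟨ -‿involutive _ ⟨
      - - (y * z)       ≈⟨ -‿cong (-‿distribʳ-* _ _) ⟩
      - (y * - z)       ≈⟨ -‿distribˡ-* _ _ ⟩
      (- y) * (- z)     ∎

    ·ₜ-correct : ∀ t u → ⟦ t ·ₜ u ⟧ₜ ρ ≈ ⟦ t ⟧ₜ ρ * ⟦ u ⟧ₜ ρ
    ·ₜ-correct (s , (i , j) , w) (s′ , (i′ , j′) , w′) = sign-* s s′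
      (trans (*-cong (exponent-correct i j i′ j′) (word-correct w w′))
             (middle-swap (exponent-central i′ j′ _)))

    negₜ-correct : ∀ t → ⟦ negₜ t ⟧ₜ ρ ≈ - ⟦ t ⟧ₜ ρ
    negₜ-correct (true  , _) = refl
    negₜ-correct (false , _) = sym (-‿involutive _)

    ++-correct : ∀ p q → ⟦ p ++ q ⟧ₚ ρ ≈ ⟦ p ⟧ₚ ρ + ⟦ q ⟧ₚ ρ
    ++-correct []      q = sym (+-identityˡ _)
    ++-correct (t ∷ p) q = trans (+-congˡ (++-correct p q)) (sym (+-assoc _ _ _))

    scale-correct : ∀ t q → ⟦ map (t ·ₜ_) q ⟧ₚ ρ ≈ ⟦ t ⟧ₜ ρ * ⟦ q ⟧ₚ ρ
    scale-correct t []      = sym (zeroʳ _)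
    scale-correct t (u ∷ q) =
      trans (+-cong (·ₜ-correct t u) (scale-correct t q)) (sym (distribˡ _ _ _))

    ·ₚ-correct : ∀ p q → ⟦ p ·ₚ q ⟧ₚ ρ ≈ ⟦ p ⟧ₚ ρ * ⟦ q ⟧ₚ ρ
    ·ₚ-correct []      q = sym (zeroˡ _)
    ·ₚ-correct (t ∷ p) q = begin
      ⟦ map (t ·ₜ_) q ++ (p ·ₚ q) ⟧ₚ ρ               ≈⟨ ++-correct (map (t ·ₜ_) q) (p ·ₚ q) ⟩
      ⟦ map (t ·ₜ_) q ⟧ₚ ρ + ⟦ p ·ₚ q ⟧ₚ ρ           ≈⟨ +-cong (scale-correct t q) (·ₚ-correct p q) ⟩
      ⟦ t ⟧ₜ ρ * ⟦ q ⟧ₚ ρ + ⟦ p ⟧ₚ ρ * ⟦ q ⟧ₚ ρ      ≈⟨ distribʳ _ _ _ ⟨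
      (⟦ t ⟧ₜ ρ + ⟦ p ⟧ₚ ρ) * ⟦ q ⟧ₚ ρ               ∎

    neg-correct : ∀ p → ⟦ map negₜ p ⟧ₚ ρ ≈ - ⟦ p ⟧ₚ ρ
    neg-correct []      = sym -0#≈0#
    neg-correct (t ∷ p) = trans (+-cong (negₜ-correct t) (neg-correct p)) (-‿+-comm _ _)

    unit-term : ∀ {x} → 1# * 1# * (x * 1#) ≈ x
    unit-term = trans (*-cong (*-identityˡ _) (*-identityʳ _)) (*-identityˡ _)

    expand-correct : ∀ e → ⟦ expand e ⟧ₚ ρ ≈ ⟦ e ⟧ ρ
    expand-correct (var i)  = trans (+-identityʳ _) unit-term
    expand-correct :b       = trans (+-identityʳ _) (trans (*-identityʳ _) (trans (*-identityʳ _) (*-identityʳ _)))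
    expand-correct :c       = trans (+-identityʳ _) (trans (*-identityʳ _) (trans (*-identityˡ _) (*-identityʳ _)))
    expand-correct :0       = refl
    expand-correct :1       = trans (+-identityʳ _) (trans (*-identityʳ _) (*-identityʳ _))
    expand-correct (e :+ f) = trans (++-correct (expand e) (expand f)) (+-cong (expand-correct e) (expand-correct f))
    expand-correct (e :* f) = trans (·ₚ-correct (expand e) (expand f)) (*-cong (expand-correct e) (expand-correct f))
    expand-correct (:- e)   = trans (neg-correct (expand e)) (-‿cong (expand-correct e))

    remove-correct : ∀ t p {p′} → remove t p ≡ just p′ → ⟦ p ⟧ₚ ρ ≈ ⟦ t ⟧ₜ ρ + ⟦ p′ ⟧ₚ ρ
    remove-correct t (u ∷ p) eq with t ≟ₜ u
    remove-correct t (u ∷ p) ≡.refl | yes ≡.refl = refl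
    ... | no _ with remove t p in eq′
    remove-correct t (u ∷ p) ≡.refl | no _ | just p′ = begin
      ⟦ u ⟧ₜ ρ + ⟦ p ⟧ₚ ρ                  ≈⟨ +-congˡ (remove-correct t p eq′) ⟩
      ⟦ u ⟧ₜ ρ + (⟦ t ⟧ₜ ρ + ⟦ p′ ⟧ₚ ρ)    ≈⟨ +-assoc _ _ _ ⟨
      ⟦ u ⟧ₜ ρ + ⟦ t ⟧ₜ ρ + ⟦ p′ ⟧ₚ ρ      ≈⟨ +-congʳ (+-comm _ _) ⟩
      ⟦ t ⟧ₜ ρ + ⟦ u ⟧ₜ ρ + ⟦ p′ ⟧ₚ ρ      ≈⟨ +-assoc _ _ _ ⟩
      ⟦ t ⟧ₜ ρ + (⟦ u ⟧ₜ ρ + ⟦ p′ ⟧ₚ ρ)    ∎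

    isZero-correct : ∀ k p → isZero k p ≡ true → ⟦ p ⟧ₚ ρ ≈ 0#
    isZero-correct _       []      _ = refl
    isZero-correct (suc k) (t ∷ p) h with remove (negₜ t) p in eq
    ... | just p′ = begin
      ⟦ t ⟧ₜ ρ + ⟦ p ⟧ₚ ρ                        ≈⟨ +-congˡ (remove-correct (negₜ t) p eq) ⟩
      ⟦ t ⟧ₜ ρ + (⟦ negₜ t ⟧ₜ ρ + ⟦ p′ ⟧ₚ ρ)     ≈⟨ +-assoc _ _ _ ⟨
      ⟦ t ⟧ₜ ρ + ⟦ negₜ t ⟧ₜ ρ + ⟦ p′ ⟧ₚ ρ       ≈⟨ +-cong (trans (+-congˡ (negₜ-correct t)) (-‿inverseʳ _)) (isZero-correct k p′ h) ⟩
      0# + 0#                                    ≈⟨ +-identityˡ _ ⟩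
      0#                                         ∎

  difference : ∀ {n} → Expr n × Expr n → Poly n
  difference (e , f) = expand (e :- f)

  -- The hypothesis is a closed computation, so each call ends in `≡.refl`. The test is sound only
  -- in one direction, which suffices.
  solve : ∀ n (f : N-ary n (Expr n) (Expr n × Expr n)) (ρ : Vector Carrier n) →
    let eqn = f $ⁿ mapᵛ var (Vec.allFin n)
        p   = difference eqn
    in isZero (length p) p ≡ true →
       ⟦ proj₁ eqn ⟧ ρ ≈ ⟦ proj₂ eqn ⟧ ρ
  solve n f ρ h = begin
    ⟦ e ⟧ ρ                          ≈⟨ +-identityʳ _ ⟨
    ⟦ e ⟧ ρ + 0#                     ≈⟨ +-congˡ (-‿inverseˡ _) ⟨
    ⟦ e ⟧ ρ + (- ⟦ g ⟧ ρ + ⟦ g ⟧ ρ)  ≈⟨ +-assoc _ _ _ ⟨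
    ⟦ e ⟧ ρ + - ⟦ g ⟧ ρ + ⟦ g ⟧ ρ    ≈⟨ +-congʳ (trans (sym (expand-correct ρ (e :- g)))
                                          (isZero-correct ρ (length p) p h)) ⟩
    0# + ⟦ g ⟧ ρ                     ≈⟨ +-identityˡ _ ⟩
    ⟦ g ⟧ ρ                          ∎
    where
    e = proj₁ (f $ⁿ mapᵛ var (Vec.allFin n))
    g = proj₂ (f $ⁿ mapᵛ var (Vec.allFin n))
    p = difference (f $ⁿ mapᵛ var (Vec.allFin n))

-- Relations between the alternating elements in a ring with a central unit

module AlternatingRelations (R : Ring 0ℓ 0ℓ) (unit : CentralUnit R) where
  open Ring R
  open CentralUnit unit

  open RingProperties R using (-0#≈0#)
  open SetoidReasoning setoid
  open LaurentSolver R unit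

  -- conv t n = Σ cᵏ t k j over k + j + 1 = n.
  conv : (ℕ → ℕ → Carrier) → ℕ → Carrier
  conv t zero    = 0#
  conv t (suc n) = t 0 n + c * conv (λ k → t (suc k)) n

  conv-cong : ∀ {t u} n → (∀ k j → t k j ≈ u k j) → conv t n ≈ conv u n
  conv-cong zero    h = refl
  conv-cong (suc n) h = +-cong (h 0 n) (*-congˡ (conv-cong n (λ k → h (suc k))))

  conv-0 : ∀ n → conv (λ _ _ → 0#) n ≈ 0#
  conv-0 zero    = refl
  conv-0 (suc n) = trans (+-identityˡ _) (trans (*-congˡ (conv-0 n)) (zeroʳ c))

  conv-linear : ∀ a t u n → conv (λ k j → a * t k j + u k j) n ≈ a * conv t n + conv u n
  conv-linear a t u zero    = sym (trans (+-congʳ (zeroʳ a)) (+-identityˡ _))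
  conv-linear a t u (suc n) = begin
    a * t 0 n + u 0 n + c * conv (λ k j → a * t (suc k) j + u (suc k) j) n
      ≈⟨ +-congˡ (*-congˡ (conv-linear a (λ k → t (suc k)) (λ k → u (suc k)) n)) ⟩
    a * t 0 n + u 0 n + c * (a * T + U)
      ≈⟨ solve 5 (λ a t u T U → a :* t :+ u :+ :c :* (a :* T :+ U) := a :* (t :+ :c :* T) :+ (u :+ :c :* U))
           (a ∷ᵛ t 0 n ∷ᵛ u 0 n ∷ᵛ T ∷ᵛ U ∷ᵛ []ᵛ) ≡.refl ⟩
    a * (t 0 n + c * T) + (u 0 n + c * U) ∎
    where
    T = conv (λ k → t (suc k)) n
    U = conv (λ k → u (suc k)) n

  Combination : Set
  Combination = List (Carrier × (ℕ → ℕ → Carrier))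

  terms : Combination → ℕ → ℕ → Carrier
  terms []            k j = 0#
  terms ((a , t) ∷ l) k j = a * t k j + terms l k j

  convs : Combination → ℕ → Carrier
  convs []            n = 0#
  convs ((a , t) ∷ l) n = a * conv t n + convs l n

  conv-terms : ∀ l n → conv (terms l) n ≈ convs l n
  conv-terms []            n = conv-0 n
  conv-terms ((a , t) ∷ l) n = trans (conv-linear a t (terms l) n) (+-congˡ (conv-terms l n))

  -- Reduces an identity between whole convolutions to one identity between their terms in `k` and
  -- `j`, which the solver can check. Afterwards the convolutions in `l` serve as plain variables.
  conv-by : ∀ l {t} n → (∀ k j → t k j ≈ terms l k j) → conv t n ≈ convs l n
  conv-by l n h = trans (conv-cong n h) (conv-terms l n)

  -- The weights are central, so a bracket acts term by term. The pairs (1, -1), (1, -b) and (b, -1)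
  -- for `u`, `v` give the commutator and the two q-commutators in use.
  conv-bracket : ∀ u v x t n →
    u * (x * conv t n) + v * (conv t n * x) ≈ conv (λ k j → u * (x * t k j) + v * (t k j * x)) n
  conv-bracket u v x t zero    =
    solve 3 (λ u v x → u :* (x :* :0) :+ v :* (:0 :* x) := :0) (u ∷ᵛ v ∷ᵛ x ∷ᵛ []ᵛ) ≡.refl
  conv-bracket u v x t (suc n) = begin
    u * (x * (t 0 n + c * T)) + v * ((t 0 n + c * T) * x)
      ≈⟨ solve 5 (λ u v x t T → u :* (x :* (t :+ :c :* T)) :+ v :* ((t :+ :c :* T) :* x)
                  := u :* (x :* t) :+ v :* (t :* x) :+ :c :* (u :* (x :* T) :+ v :* (T :* x)))
           (u ∷ᵛ v ∷ᵛ x ∷ᵛ t 0 n ∷ᵛ T ∷ᵛ []ᵛ) ≡.refl ⟩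
    u * (x * t 0 n) + v * (t 0 n * x) + c * (u * (x * T) + v * (T * x))
      ≈⟨ +-congˡ (*-congˡ (conv-bracket u v x (λ k → t (suc k)) n)) ⟩
    _ ∎
    where T = conv (λ k → t (suc k)) n

  -- By definition `conv` splits off its end k = 0, with weight 1; this splits off the end j = 0,
  -- with weight cⁿ.
  conv-last : ∀ t n → conv t (suc n) ≈ conv (λ k j → t k (suc j)) n + pow c n * t n 0
  conv-last t zero    =
    solve 1 (λ t → t :+ :c :* :0 := :0 :+ :1 :* t) (t 0 0 ∷ᵛ []ᵛ) ≡.refl
  conv-last t (suc n) = begin
    t 0 (suc n) + c * conv (λ k → t (suc k)) (suc n)
      ≈⟨ +-congˡ (*-congˡ (conv-last (λ k → t (suc k)) n)) ⟩
    t 0 (suc n) + c * (T + pow c n * t (suc n) 0)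
      ≈⟨ solve 4 (λ s T e t → s :+ :c :* (T :+ e :* t) := s :+ :c :* T :+ :c :* e :* t)
           (t 0 (suc n) ∷ᵛ T ∷ᵛ pow c n ∷ᵛ t (suc n) 0 ∷ᵛ []ᵛ) ≡.refl ⟩
    t 0 (suc n) + c * T + c * pow c n * t (suc n) 0 ∎
    where T = conv (λ k j → t (suc k) (suc j)) n

  conv-first≈0 : ∀ t n → (∀ k j → k < n → t k j ≈ 0#) → conv t n ≈ 0#
  conv-first≈0 t zero    h = refl
  conv-first≈0 t (suc n) h = trans (+-cong (h 0 n (s≤s z≤n))
    (trans (*-congˡ (conv-first≈0 _ n (λ k j k<n → h (suc k) j (s≤s k<n)))) (zeroʳ c))) (+-identityˡ _)

  conv-second≈0 : ∀ t n → (∀ k j → j < n → t k j ≈ 0#) → conv t n ≈ 0#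
  conv-second≈0 t zero    h = refl
  conv-second≈0 t (suc n) h = trans (+-cong (h 0 n ℕ.≤-refl)
    (trans (*-congˡ (conv-second≈0 _ n (λ k j j<n → h (suc k) j (ℕ.m<n⇒m<1+n j<n)))) (zeroʳ c))) (+-identityˡ _)

  infixl 7 _⋆_
  _⋆_ : (ℕ → Carrier) → (ℕ → Carrier) → ℕ → Carrier
  f ⋆ g = conv (λ k j → f k * g j)

  shift : (ℕ → Carrier) → ℕ → Carrier
  shift f k = f (suc k)

  ⋆-last : ∀ f g n → (f ⋆ g) (suc n) ≈ (f ⋆ shift g) n + pow c n * (f n * g 0)
  ⋆-last f g n = conv-last (λ k j → f k * g j) n

  ⋆-0ˡ : ∀ f g n → (∀ k → k < n → f k ≈ 0#) → (f ⋆ g) n ≈ 0#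
  ⋆-0ˡ f g n h = conv-first≈0 _ n (λ k j k<n → trans (*-congʳ (h k k<n)) (zeroˡ _))

  ⋆-0ʳ : ∀ f g n → (∀ j → j < n → g j ≈ 0#) → (f ⋆ g) n ≈ 0#
  ⋆-0ʳ f g n h = conv-second≈0 _ n (λ k j j<n → trans (*-congˡ (h j j<n)) (zeroʳ _))

  -- Here `f` will be a defect that vanishes below degree `n`, so only its top value survives. On
  -- the left it has weight cⁿ, on the right (`⋆-topʳ`) weight 1.
  ⋆-topˡ : ∀ f g n → g 0 ≈ 1# → (∀ k → k < n → f k ≈ 0#) → (f ⋆ g) (suc n) ≈ pow c n * f n
  ⋆-topˡ f g n g₀ h = trans (⋆-last f g n)
    (trans (+-cong (⋆-0ˡ f (shift g) n h) (*-congˡ (trans (*-congˡ g₀) (*-identityʳ _)))) (+-identityˡ _))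

  ⋆-topʳ : ∀ f g n → f 0 ≈ 1# → (∀ j → j < n → g j ≈ 0#) → (f ⋆ g) (suc n) ≈ g n
  ⋆-topʳ f g n f₀ h = trans
    (+-cong (trans (*-congʳ f₀) (*-identityˡ _)) (trans (*-congˡ (⋆-0ʳ (shift f) g n h)) (zeroʳ c))) (+-identityʳ _)

  zero-difference : ∀ {u v} → u - v ≈ 0# → u ≈ v
  zero-difference {u} {v} h = begin
    u           ≈⟨ solve 2 (λ u v → u := u :- v :+ v) (u ∷ᵛ v ∷ᵛ []ᵛ) ≡.refl ⟩
    u - v + v   ≈⟨ +-congʳ h ⟩
    0# + v      ≈⟨ +-identityˡ v ⟩
    v           ∎

  difference-zero : ∀ {u v} → u ≈ v → u - v ≈ 0#
  difference-zero h = trans (+-congʳ h) (-‿inverseʳ _)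

  -- Linear combinations of hypotheses as certificates

  infix 5.5 _∙_
  record Hypothesis : Set where
    constructor _∙_
    field
      coefficient : Carrier
      {left right} : Carrier
      equal : left ≈ right

  defect : List Hypothesis → Carrier
  defect []       = 0#
  defect (h ∷ hs) = coefficient * (left - right) + defect hs
    where open Hypothesis h

  defect≈0 : ∀ hs → defect hs ≈ 0#
  defect≈0 []       = refl
  defect≈0 (h ∷ hs) = trans (+-cong (trans (*-congˡ (difference-zero equal)) (zeroʳ _)) (defect≈0 hs)) (+-identityˡ _)
    where open Hypothesis h

  -- The premise is an identity of noncommutative polynomials for the solver; the hypotheses enter
  -- only through `defect≈0`. Coefficients multiply from the left, so a hypothesis needed with a
  -- factor on its right is passed through `*-congʳ` first.
  linear-combination : ∀ hs {u v} → u ≈ v + defect hs → u ≈ v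
  linear-combination hs h = trans h (trans (+-congˡ (defect≈0 hs)) (+-identityʳ _))

  -- Bracketing the relations with one generator

  -- The coefficients of G(t/b) G̃(t) − t W⁻(t/b) W⁺(t) and of G(t/b) W⁻(t) − W⁻(t/b) G(t).
  qdet : (G H X Y : ℕ → Carrier) → ℕ → Carrier
  qdet G H X Y n = (G ⋆ H) (suc n) - (X ⋆ Y) n

  minor : (G X : ℕ → Carrier) → ℕ → Carrier
  minor G X = λ n → conv (λ k j → G k * X j - X k * G j) (suc n)

  -- With L and R the left and right multiplication by x, serre x y = (L − R)(L − bR)(L − b⁻¹R) y.
  serre : Carrier → Carrier → Carrier
  serre x y = x * x * x * y - (1# + b + c) * (x * x * y * x) + (1# + b + c) * (x * y * x * x) - y * x * x * x

  -- G, H, X, Y stand for Gₙ, G̃ₙ, W₋ₙ, Wₙ₊₁. Exchanging W₀ with W₁ exchanges G with H and X with Y, so the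
  -- relations are proved for one generator only.
  module Side (G H X Y : ℕ → Carrier) (G₀ : G 0 ≈ 1#) (H₀ : H 0 ≈ 1#) where

    x : Carrier
    x = X 0

    -- The defects of the relations (b − 1) W₋ₖ = [W₀, Gₖ]_b = [G̃ₖ, W₀]_b, [W₀, W₋ₖ] = 0
    -- and [W₀, Wₖ₊₁] = (1 − b⁻¹)(G̃ₖ₊₁ − Gₖ₊₁).
    η₁ η₂ ξ ε : ℕ → Carrier
    η₁ k = b * x * G k - G k * x - (b - 1#) * X k
    η₂ k = b * H k * x - x * H k - (b - 1#) * X k
    ξ k  = x * X k - X k * x
    ε k  = x * Y k - Y k * x - (1# - c) * (H (suc k) - G (suc k))

    -- Expand xQ - bQx for the vanishing minor Q of degree `m`. Moving `x` past `Y` produces H - G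
    -- one degree higher, and these products together with X ⋆ Y and Y ⋆ X assemble into both
    -- determinants of degree m + 1. The defect `ε m` is left from the two ends, with weights b and
    -- -cᵐ. Where `ε` vanishes by definition this transfers the vanishing of one determinant to the
    -- other; for the other generator it then gives the missing `ε`.
    qdet-symmetric : ∀ m → (∀ k → k ≤ m → η₂ k ≈ 0#) → (∀ k → k < m → ε k ≈ 0#) →
      minor H Y m ≈ 0# →
      (b - 1#) * (qdet G H X Y (suc m) - qdet H G Y X (suc m)) + (b - pow c m) * ε m ≈ 0#
    qdet-symmetric m η₂≈0 ε≈0 Q≈0 = begin
      (b - 1#) * (qdet G H X Y (suc m) - qdet H G Y X (suc m)) + (b - pow c m) * ε m
        ≈⟨ linear-combination
             (- b ∙ ⋆-topʳ H ε m H₀ ε≈0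
             ∷ 1# ∙ ⋆-0ˡ η₂ Y (suc m) η₂<
             ∷ 1# ∙ ⋆-topˡ ε H m H₀ ε≈0
             ∷ - 1# ∙ ⋆-0ʳ Y η₂ (suc m) η₂<
             ∷ b - 1# ∙ ⋆-last H H (suc m)
             ∷ - (b - 1#) ∙ ⋆-last H G (suc m)
             ∷ - (b - 1#) ∙ *-congʳ {H (suc m)} (trans H₀ (sym G₀))
             ∷ - ((b - 1#) * (c * pow c m)) ∙ *-congˡ {H (suc m)} (trans G₀ (sym H₀))
             ∷ [])
             (solve 16 (λ e εm h g0 h0 HG C1 C2 C3 C4 C5 C6 C7 C8 C9 C10 →
               (:b :- :1) :* (g0 :* h :+ :c :* C8 :- C4 :- (HG :- C9)) :+ (:b :- e) :* εm
               := (:b :* C1 :+ ((:b :- :1) :* C2 :+ ((:- (:b :- :1)) :* C3 :+ ((:- (:b :- :1)) :* C4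
                    :+ ((:- :1) :* C5 :+ ((:- :1) :* C6 :+ ((:- (:1 :- :c)) :* C7 :+ ((:1 :- :c) :* C8
                    :+ ((:b :- :1) :* C9 :+ (:1 :* C10 :+ :0))))))))))
                  :+ ((:- :b) :* (C1 :- εm) :+ (:1 :* (C5 :- :0) :+ (:1 :* (C6 :- e :* εm)
                    :+ ((:- :1) :* (C10 :- :0) :+ ((:b :- :1) :* (h0 :* h :+ :c :* C7 :- (C2 :+ :c :* e :* (h :* h0)))
                    :+ ((:- (:b :- :1)) :* (HG :- (C3 :+ :c :* e :* (h :* g0)))
                    :+ ((:- (:b :- :1)) :* (h0 :* h :- g0 :* h)
                    :+ ((:- ((:b :- :1) :* (:c :* e))) :* (h :* g0 :- h :* h0) :+ :0)))))))))
               (pow c m ∷ᵛ ε m ∷ᵛ H (suc m) ∷ᵛ G 0 ∷ᵛ H 0 ∷ᵛ (H ⋆ G) (suc (suc m)) ∷ᵛ (H ⋆ ε) (suc m)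
                ∷ᵛ (H ⋆ shift H) (suc m) ∷ᵛ (H ⋆ shift G) (suc m) ∷ᵛ (X ⋆ Y) (suc m)
                ∷ᵛ (η₂ ⋆ Y) (suc m) ∷ᵛ (ε ⋆ H) (suc m) ∷ᵛ (shift H ⋆ H) (suc m) ∷ᵛ (shift G ⋆ H) (suc m)
                ∷ᵛ (Y ⋆ X) (suc m) ∷ᵛ (Y ⋆ η₂) (suc m) ∷ᵛ []ᵛ) ≡.refl) ⟩
      convs combination (suc m)
        ≈⟨ conv-by combination (suc m) (λ k j →
             solve 11 (λ x hk hj hk′ hj′ gk′ gj′ yk yj xk xj →
               let εj  = x :* yj :- yj :* x :- (:1 :- :c) :* (hj′ :- gj′)
                   εk  = x :* yk :- yk :* x :- (:1 :- :c) :* (hk′ :- gk′)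
                   η₂k = :b :* hk :* x :- x :* hk :- (:b :- :1) :* xk
                   η₂j = :b :* hj :* x :- x :* hj :- (:b :- :1) :* xj
               in :1 :* (x :* (hk :* yj :- yk :* hj)) :+ (:- :b) :* ((hk :* yj :- yk :* hj) :* x)
                  := :b :* (hk :* εj) :+ ((:b :- :1) :* (hk :* hj′) :+ ((:- (:b :- :1)) :* (hk :* gj′)
                     :+ ((:- (:b :- :1)) :* (xk :* yj) :+ ((:- :1) :* (η₂k :* yj) :+ ((:- :1) :* (εk :* hj)
                     :+ ((:- (:1 :- :c)) :* (hk′ :* hj) :+ ((:1 :- :c) :* (gk′ :* hj)
                     :+ ((:b :- :1) :* (yk :* xj) :+ (:1 :* (yk :* η₂j) :+ :0))))))))))
             (x ∷ᵛ H k ∷ᵛ H j ∷ᵛ H (suc k) ∷ᵛ H (suc j) ∷ᵛ G (suc k) ∷ᵛ G (suc j) ∷ᵛ Y k ∷ᵛ Y j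
              ∷ᵛ X k ∷ᵛ X j ∷ᵛ []ᵛ) ≡.refl) ⟨
      conv (λ k j → 1# * (x * (H k * Y j - Y k * H j)) + (- b) * ((H k * Y j - Y k * H j) * x)) (suc m)
        ≈⟨ conv-bracket 1# (- b) x (λ k j → H k * Y j - Y k * H j) (suc m) ⟨
      1# * (x * minor H Y m) + (- b) * (minor H Y m * x)
        ≈⟨ +-cong (*-congˡ (*-congˡ Q≈0)) (*-congˡ (*-congʳ Q≈0)) ⟩
      1# * (x * 0#) + (- b) * (0# * x)
        ≈⟨ solve 1 (λ x → :1 :* (x :* :0) :+ (:- :b) :* (:0 :* x) := :0) (x ∷ᵛ []ᵛ) ≡.refl ⟩
      0# ∎
      where
      η₂< : ∀ k → k < suc m → η₂ k ≈ 0#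
      η₂< k (s≤s k≤m) = η₂≈0 k k≤m
      combination : Combination
      combination =
          (b , λ k j → H k * ε j)
        ∷ (b - 1# , λ k j → H k * H (suc j))
        ∷ (- (b - 1#) , λ k j → H k * G (suc j))
        ∷ (- (b - 1#) , λ k j → X k * Y j)
        ∷ (- 1# , λ k j → η₂ k * Y j)
        ∷ (- 1# , λ k j → ε k * H j)
        ∷ (- (1# - c) , λ k j → H (suc k) * H j)
        ∷ (1# - c , λ k j → G (suc k) * H j)
        ∷ (b - 1# , λ k j → Y k * X j)
        ∷ (1# , λ k j → Y k * η₂ j)
        ∷ []

    minor-expand : ∀ n → minor G X n ≈ convs ((1# , λ k j → G k * X j) ∷ (- 1# , λ k j → X k * G j) ∷ []) (suc n)
    minor-expand n = conv-by ((1# , λ k j → G k * X j) ∷ (- 1# , λ k j → X k * G j) ∷ []) (suc n) (λ k j →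
      solve 2 (λ u v → u :- v := :1 :* u :+ ((:- :1) :* v :+ :0)) (G k * X j ∷ᵛ X k * G j ∷ᵛ []ᵛ) ≡.refl)

    module _ (n : ℕ) (η₁≈0 : ∀ k → k < n → η₁ k ≈ 0#) (η₂≈0 : ∀ k → k < n → η₂ k ≈ 0#)
      (ξ≈0 : ∀ k → k < n → ξ k ≈ 0#) (ε≈0 : ∀ k → k < n → ε k ≈ 0#) where

      -- Commute `x` with both products. The terms X ⋆ H cancel up to an end term, the terms G ⋆ X
      -- and X ⋆ G form the minor, and all lower defects are zero; `η₂ n` and `η₁ n` remain from
      -- opposite ends.
      commutator-qdet : qdet G H X Y n ≈ 0# → (b - 1#) * minor G X n + η₂ n - pow c n * η₁ n ≈ 0#
      commutator-qdet P≈0 = linear-combination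
        (- b ∙ *-congˡ {x} P≈0
        ∷ b ∙ *-congʳ {x} P≈0
        ∷ b ∙ bracketGH
        ∷ - b ∙ bracketXY
        ∷ b - 1# ∙ minor-expand n
        ∷ - 1# ∙ ⋆-topʳ G η₂ n G₀ η₂≈0
        ∷ 1# ∙ ⋆-topˡ η₁ H n H₀ η₁≈0
        ∷ - b ∙ ⋆-0ˡ ξ Y n ξ≈0
        ∷ - b ∙ ⋆-0ʳ X ε n ε≈0
        ∷ b - 1# ∙ ⋆-last X H n
        ∷ - (b - 1#) ∙ ⋆-last X G n
        ∷ (b - 1#) * pow c n ∙ *-congˡ {X n} (trans H₀ (sym G₀))
        ∷ [])
        (solve 19 (λ x e Q η₁ η₂ h0 g0 xn GH XY A1 A2 A3 A4 A5 B1 B2 B3 B4 →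
          (:b :- :1) :* Q :+ η₂ :- e :* η₁
          := :0 :+ ((:- :b) :* (x :* (GH :- XY) :- x :* :0)
            :+ (:b :* ((GH :- XY) :* x :- :0 :* x)
            :+ (:b :* (:1 :* (x :* GH) :+ (:- :1) :* (GH :* x) :- ((:1 :- :c) :* A1 :+ ((:- (:1 :- :c)) :* A2
                 :+ ((:- :c) :* A3 :+ (:c :* A4 :+ :0)))))
            :+ ((:- :b) :* (:1 :* (x :* XY) :+ (:- :1) :* (XY :* x) :- (:1 :* B1 :+ (:1 :* B2
                 :+ ((:1 :- :c) :* B3 :+ ((:- (:1 :- :c)) :* B4 :+ :0)))))
            :+ ((:b :- :1) :* (Q :- (:1 :* A2 :+ ((:- :1) :* A5 :+ :0)))
            :+ ((:- :1) :* (A3 :- η₂)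
            :+ (:1 :* (A4 :- e :* η₁)
            :+ ((:- :b) :* (B1 :- :0)
            :+ ((:- :b) :* (B2 :- :0)
            :+ ((:b :- :1) :* (A1 :- (B3 :+ e :* (xn :* h0)))
            :+ ((:- (:b :- :1)) :* (A5 :- (B4 :+ e :* (xn :* g0)))
            :+ ((:b :- :1) :* e :* (xn :* h0 :- xn :* g0) :+ :0)))))))))))))
          (x ∷ᵛ pow c n ∷ᵛ minor G X n ∷ᵛ η₁ n ∷ᵛ η₂ n ∷ᵛ H 0 ∷ᵛ G 0 ∷ᵛ X n ∷ᵛ (G ⋆ H) (suc n) ∷ᵛ (X ⋆ Y) n
           ∷ᵛ (X ⋆ H) (suc n) ∷ᵛ (G ⋆ X) (suc n) ∷ᵛ (G ⋆ η₂) (suc n) ∷ᵛ (η₁ ⋆ H) (suc n) ∷ᵛ (X ⋆ G) (suc n)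
           ∷ᵛ (ξ ⋆ Y) n ∷ᵛ (X ⋆ ε) n ∷ᵛ (X ⋆ shift H) n ∷ᵛ (X ⋆ shift G) n ∷ᵛ []ᵛ) ≡.refl)
        where
        combinationGH combinationXY : Combination
        combinationGH = (1# - c , λ k j → X k * H j) ∷ (- (1# - c) , λ k j → G k * X j)
          ∷ (- c , λ k j → G k * η₂ j) ∷ (c , λ k j → η₁ k * H j) ∷ []
        combinationXY = (1# , λ k j → ξ k * Y j) ∷ (1# , λ k j → X k * ε j)
          ∷ (1# - c , λ k j → X k * H (suc j)) ∷ (- (1# - c) , λ k j → X k * G (suc j)) ∷ []
        bracketGH : 1# * (x * (G ⋆ H) (suc n)) + (- 1#) * ((G ⋆ H) (suc n) * x) ≈ convs combinationGH (suc n)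
        bracketGH = trans (conv-bracket 1# (- 1#) x (λ k j → G k * H j) (suc n))
          (conv-by combinationGH (suc n) (λ k j →
            solve 6 (λ x gk hj xk xj hk → :1 :* (x :* (gk :* hj)) :+ (:- :1) :* (gk :* hj :* x)
              := (:1 :- :c) :* (xk :* hj) :+ ((:- (:1 :- :c)) :* (gk :* xj)
               :+ ((:- :c) :* (gk :* (:b :* hj :* x :- x :* hj :- (:b :- :1) :* xj))
               :+ (:c :* ((:b :* x :* gk :- gk :* x :- (:b :- :1) :* xk) :* hj) :+ :0))))
              (x ∷ᵛ G k ∷ᵛ H j ∷ᵛ X k ∷ᵛ X j ∷ᵛ H k ∷ᵛ []ᵛ) ≡.refl))
        bracketXY : 1# * (x * (X ⋆ Y) n) + (- 1#) * ((X ⋆ Y) n * x) ≈ convs combinationXY n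
        bracketXY = trans (conv-bracket 1# (- 1#) x (λ k j → X k * Y j) n)
          (conv-by combinationXY n (λ k j →
            solve 5 (λ x xk yj hj′ gj′ → :1 :* (x :* (xk :* yj)) :+ (:- :1) :* (xk :* yj :* x)
              := :1 :* ((x :* xk :- xk :* x) :* yj)
               :+ (:1 :* (xk :* (x :* yj :- yj :* x :- (:1 :- :c) :* (hj′ :- gj′)))
               :+ ((:1 :- :c) :* (xk :* hj′) :+ ((:- (:1 :- :c)) :* (xk :* gj′) :+ :0))))
              (x ∷ᵛ X k ∷ᵛ Y j ∷ᵛ H (suc j) ∷ᵛ G (suc j) ∷ᵛ []ᵛ) ≡.refl))

      -- In the determinant of the other order `η₁` and `η₂` appear at exchanged ends. Subtracting
      -- the two results therefore eliminates the minor and leaves a multiple of `η₂ n − η₁ n`.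
      commutator-qdet′ : qdet H G Y X n ≈ 0# → (b - 1#) * minor G X n + η₁ n - pow c n * η₂ n ≈ 0#
      commutator-qdet′ S≈0 = linear-combination
        (1# ∙ *-congˡ {x} S≈0
        ∷ - 1# ∙ *-congʳ {x} S≈0
        ∷ - 1# ∙ bracketHG
        ∷ 1# ∙ bracketYX
        ∷ b - 1# ∙ minor-expand n
        ∷ b - 1# ∙ *-congʳ {X n} (trans G₀ (sym H₀))
        ∷ - 1# ∙ ⋆-topʳ H η₁ n H₀ η₁≈0
        ∷ 1# ∙ ⋆-topˡ η₂ G n G₀ η₂≈0
        ∷ 1# ∙ ⋆-0ˡ ε X n ε≈0
        ∷ 1# ∙ ⋆-0ʳ Y ξ n ξ≈0
        ∷ [])
        (solve 17 (λ x e Q η₁ η₂ h0 g0 xn HG YX A3 A4 A5 B1 B2 B3 B4 →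
          (:b :- :1) :* Q :+ η₁ :- e :* η₂
          := :0 :+ (:1 :* (x :* (HG :- YX) :- x :* :0)
            :+ ((:- :1) :* ((HG :- YX) :* x :- :0 :* x)
            :+ ((:- :1) :* (:1 :* (x :* HG) :+ (:- :1) :* (HG :* x) :- ((:b :- :1) :* (h0 :* xn :+ :c :* B3)
                 :+ (:1 :* A3 :+ ((:- (:b :- :1)) :* A5 :+ ((:- :1) :* A4 :+ :0)))))
            :+ (:1 :* (:1 :* (x :* YX) :+ (:- :1) :* (YX :* x) :- (:1 :* B1 :+ ((:1 :- :c) :* B3
                 :+ ((:- (:1 :- :c)) :* B4 :+ (:1 :* B2 :+ :0)))))
            :+ ((:b :- :1) :* (Q :- (:1 :* (g0 :* xn :+ :c :* B4) :+ ((:- :1) :* A5 :+ :0)))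
            :+ ((:b :- :1) :* (g0 :* xn :- h0 :* xn)
            :+ ((:- :1) :* (A3 :- η₁)
            :+ (:1 :* (A4 :- e :* η₂)
            :+ (:1 :* (B1 :- :0)
            :+ (:1 :* (B2 :- :0) :+ :0)))))))))))
          (x ∷ᵛ pow c n ∷ᵛ minor G X n ∷ᵛ η₁ n ∷ᵛ η₂ n ∷ᵛ H 0 ∷ᵛ G 0 ∷ᵛ X n ∷ᵛ (H ⋆ G) (suc n) ∷ᵛ (Y ⋆ X) n
           ∷ᵛ (H ⋆ η₁) (suc n) ∷ᵛ (η₂ ⋆ G) (suc n) ∷ᵛ (X ⋆ G) (suc n)
           ∷ᵛ (ε ⋆ X) n ∷ᵛ (Y ⋆ ξ) n ∷ᵛ (shift H ⋆ X) n ∷ᵛ (shift G ⋆ X) n ∷ᵛ []ᵛ) ≡.refl)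
        where
        combinationHG combinationYX : Combination
        combinationHG = (b - 1# , λ k j → H k * X j) ∷ (1# , λ k j → H k * η₁ j)
          ∷ (- (b - 1#) , λ k j → X k * G j) ∷ (- 1# , λ k j → η₂ k * G j) ∷ []
        combinationYX = (1# , λ k j → ε k * X j) ∷ (1# - c , λ k j → H (suc k) * X j)
          ∷ (- (1# - c) , λ k j → G (suc k) * X j) ∷ (1# , λ k j → Y k * ξ j) ∷ []
        bracketHG : 1# * (x * (H ⋆ G) (suc n)) + (- 1#) * ((H ⋆ G) (suc n) * x) ≈ convs combinationHG (suc n)
        bracketHG = trans (conv-bracket 1# (- 1#) x (λ k j → H k * G j) (suc n))
          (conv-by combinationHG (suc n) (λ k j →
            solve 5 (λ x hk gj xk xj → :1 :* (x :* (hk :* gj)) :+ (:- :1) :* (hk :* gj :* x)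
              := (:b :- :1) :* (hk :* xj) :+ (:1 :* (hk :* (:b :* x :* gj :- gj :* x :- (:b :- :1) :* xj))
               :+ ((:- (:b :- :1)) :* (xk :* gj)
               :+ ((:- :1) :* ((:b :* hk :* x :- x :* hk :- (:b :- :1) :* xk) :* gj) :+ :0))))
              (x ∷ᵛ H k ∷ᵛ G j ∷ᵛ X k ∷ᵛ X j ∷ᵛ []ᵛ) ≡.refl))
        bracketYX : 1# * (x * (Y ⋆ X) n) + (- 1#) * ((Y ⋆ X) n * x) ≈ convs combinationYX n
        bracketYX = trans (conv-bracket 1# (- 1#) x (λ k j → Y k * X j) n)
          (conv-by combinationYX n (λ k j →
            solve 5 (λ x xj yk hk′ gk′ → :1 :* (x :* (yk :* xj)) :+ (:- :1) :* (yk :* xj :* x)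
              := :1 :* ((x :* yk :- yk :* x :- (:1 :- :c) :* (hk′ :- gk′)) :* xj)
               :+ ((:1 :- :c) :* (hk′ :* xj) :+ ((:- (:1 :- :c)) :* (gk′ :* xj)
               :+ (:1 :* (yk :* (x :* xj :- xj :* x)) :+ :0))))
              (x ∷ᵛ X j ∷ᵛ Y k ∷ᵛ H (suc k) ∷ᵛ G (suc k) ∷ᵛ []ᵛ) ≡.refl))

      -- Expand bxQ - Qx for the minor Q: `ξ n` occurs with weight 1 at one end and -bcⁿ at the
      -- other. The factor is 1 - cⁿ⁻¹ for n ≥ 1 and carries no information when n = 1.
      commutator-minor : η₁ n ≈ 0# → minor G X n ≈ 0# → (1# - b * pow c n) * ξ n ≈ 0#
      commutator-minor η₁n≈0 Q≈0 = linear-combination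
        (b ∙ *-congˡ {x} Q≈0
        ∷ - 1# ∙ *-congʳ {x} Q≈0
        ∷ - 1# ∙ bracket
        ∷ - 1# ∙ ⋆-0ˡ η₁ X (suc n) η₁≤
        ∷ - 1# ∙ ⋆-topʳ G ξ n G₀ ξ≈0
        ∷ b ∙ ⋆-topˡ ξ G n G₀ ξ≈0
        ∷ 1# ∙ ⋆-0ʳ X η₁ (suc n) η₁≤
        ∷ [])
        (solve 8 (λ x e Q ξ A1 A2 A3 A4 →
          (:1 :- :b :* e) :* ξ
          := :0 :+ (:b :* (x :* Q :- x :* :0)
            :+ ((:- :1) :* (Q :* x :- :0 :* x)
            :+ ((:- :1) :* (:b :* (x :* Q) :+ (:- :1) :* (Q :* x)
                 :- (:1 :* A1 :+ (:1 :* A2 :+ ((:- :b) :* A3 :+ ((:- :1) :* A4 :+ :0)))))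
            :+ ((:- :1) :* (A1 :- :0)
            :+ ((:- :1) :* (A2 :- ξ)
            :+ (:b :* (A3 :- e :* ξ)
            :+ (:1 :* (A4 :- :0) :+ :0))))))))
          (x ∷ᵛ pow c n ∷ᵛ minor G X n ∷ᵛ ξ n ∷ᵛ (η₁ ⋆ X) (suc n) ∷ᵛ (G ⋆ ξ) (suc n) ∷ᵛ (ξ ⋆ G) (suc n)
           ∷ᵛ (X ⋆ η₁) (suc n) ∷ᵛ []ᵛ) ≡.refl)
        where
        η₁≤ : ∀ k → k < suc n → η₁ k ≈ 0#
        η₁≤ k (s≤s k≤n) with ℕ.m≤n⇒m<n∨m≡n k≤n
        ... | inj₁ k<n    = η₁≈0 k k<n
        ... | inj₂ ≡.refl = η₁n≈0
        combination : Combination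
        combination = (1# , λ k j → η₁ k * X j) ∷ (1# , λ k j → G k * ξ j)
          ∷ (- b , λ k j → ξ k * G j) ∷ (- 1# , λ k j → X k * η₁ j) ∷ []
        bracket : b * (x * minor G X n) + (- 1#) * (minor G X n * x) ≈ convs combination (suc n)
        bracket = trans (conv-bracket b (- 1#) x (λ k j → G k * X j - X k * G j) (suc n))
          (conv-by combination (suc n) (λ k j →
            solve 5 (λ x gk gj xk xj →
              let η₁k = :b :* x :* gk :- gk :* x :- (:b :- :1) :* xk
                  η₁j = :b :* x :* gj :- gj :* x :- (:b :- :1) :* xj
              in :b :* (x :* (gk :* xj :- xk :* gj)) :+ (:- :1) :* ((gk :* xj :- xk :* gj) :* x)
                 := :1 :* (η₁k :* xj) :+ (:1 :* (gk :* (x :* xj :- xj :* x))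
                  :+ ((:- :b) :* ((x :* xk :- xk :* x) :* gj) :+ ((:- :1) :* (xk :* η₁j) :+ :0))))
              (x ∷ᵛ G k ∷ᵛ G j ∷ᵛ X k ∷ᵛ X j ∷ᵛ []ᵛ) ≡.refl))

    η-equal : ∀ {n} → (b - 1#) * minor G X n + η₂ n - pow c n * η₁ n ≈ 0# →
      (b - 1#) * minor G X n + η₁ n - pow c n * η₂ n ≈ 0# → (1# + pow c n) * (η₂ n - η₁ n) ≈ 0#
    η-equal {n} h h′ = linear-combination (1# ∙ h ∷ - 1# ∙ h′ ∷ [])
      (solve 4 (λ e q η₁ η₂ → (:1 :+ e) :* (η₂ :- η₁) :=
          :0 :+ (:1 :* (q :+ η₂ :- e :* η₁ :- :0) :+ ((:- :1) :* (q :+ η₁ :- e :* η₂ :- :0) :+ :0)))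
        (pow c n ∷ᵛ (b - 1#) * minor G X n ∷ᵛ η₁ n ∷ᵛ η₂ n ∷ᵛ []ᵛ) ≡.refl)

    -- The case n = 1 that `commutator-minor` leaves open: `G 1` is a multiple of a q-commutator of
    -- `Y 0` and `x`, and `X 1` a multiple of a q-commutator of `x` and `G 1`, so [x, X₁] is a
    -- multiple of the cubic Serre expression.
    ξ₁-serre : η₁ 1 ≈ 0# → ε 0 ≈ 0# → qdet G H X Y 1 ≈ 0# →
      x * x * x * Y 0 - (1# + b + c) * (x * x * Y 0 * x) + (1# + b + c) * (x * Y 0 * x * x) - Y 0 * x * x * x ≈ 0# →
      (1# + c) * ((1# - c) * ((b - 1#) * ξ 1)) ≈ 0#
    ξ₁-serre h₁ h₂ h₃ serre = linear-combination
      (- 1# ∙ serre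
      ∷ - ((1# + c) * (1# - c)) ∙ *-congˡ {x} h₁
      ∷ (1# + c) * (1# - c) ∙ *-congʳ {x} h₁
      ∷ b ∙ *-congˡ {x * x} G₁
      ∷ - 1# ∙ *-congˡ {x} (*-congʳ {x} G₁)
      ∷ - b ∙ *-congˡ {x} (*-congʳ {x} G₁)
      ∷ 1# ∙ *-congʳ {x} (*-congʳ {x} G₁)
      ∷ [])
      (solve 4 (λ x y g x₁ →
        let η = :b :* x :* g :- g :* x :- (:b :- :1) :* x₁
            d = (:1 :+ :c) :* ((:1 :- :c) :* g)
            r = y :* x :- :c :* (x :* y)
        in (:1 :+ :c) :* ((:1 :- :c) :* ((:b :- :1) :* (x :* x₁ :- x₁ :* x)))
        := :0 :+ ((:- :1) :* (x :* x :* x :* y :- (:1 :+ :b :+ :c) :* (x :* x :* y :* x)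
                :+ (:1 :+ :b :+ :c) :* (x :* y :* x :* x) :- y :* x :* x :* x :- :0)
            :+ ((:- ((:1 :+ :c) :* (:1 :- :c))) :* (x :* η :- x :* :0)
            :+ ((:1 :+ :c) :* (:1 :- :c) :* (η :* x :- :0 :* x)
            :+ (:b :* (x :* x :* d :- x :* x :* r)
            :+ ((:- :1) :* (x :* (d :* x) :- x :* (r :* x))
            :+ ((:- :b) :* (x :* (d :* x) :- x :* (r :* x))
            :+ (:1 :* (d :* x :* x :- r :* x :* x) :+ :0))))))))
        (x ∷ᵛ Y 0 ∷ᵛ G 1 ∷ᵛ X 1 ∷ᵛ []ᵛ) ≡.refl)
      where
      -- Eliminates H₁ from H₁ + cG₁ = xY₀ and (1 - c)(H₁ - G₁) = [x, Y₀].
      G₁ : (1# + c) * ((1# - c) * G 1) ≈ Y 0 * x - c * (x * Y 0)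
      G₁ = linear-combination
        (1# - c ∙ h₃ ∷ 1# ∙ h₂ ∷ - (1# - c) ∙ *-congʳ {H 1} G₀ ∷ - ((1# - c) * c) ∙ *-congˡ {G 1} H₀ ∷ [])
        (solve 6 (λ x y g0 h0 g h → (:1 :+ :c) :* ((:1 :- :c) :* g) :=
          y :* x :- :c :* (x :* y) :+ ((:1 :- :c) :* (g0 :* h :+ :c :* (g :* h0 :+ :c :* :0) :- (x :* y :+ :c :* :0) :- :0)
            :+ (:1 :* (x :* y :- y :* x :- (:1 :- :c) :* (h :- g) :- :0)
            :+ ((:- (:1 :- :c)) :* (g0 :* h :- :1 :* h) :+ ((:- ((:1 :- :c) :* :c)) :* (g :* h0 :- g :* :1) :+ :0)))))
          (x ∷ᵛ Y 0 ∷ᵛ G 0 ∷ᵛ H 0 ∷ᵛ G 1 ∷ᵛ H 1 ∷ᵛ []ᵛ) ≡.refl)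

    -- The commutator is (1 - c)(H - G) in degree n + 1. By `η₁`, (L - b⁻¹R)G is a multiple of X, by
    -- `η₂` so is (L - bR)H, and L - R kills X by `ξ`. All three factors commute and occur in the
    -- Serre cubic, so it kills both G and H.
    serre-commutator : ∀ n → (∀ k → η₁ k ≈ 0#) → (∀ k → η₂ k ≈ 0#) → (∀ k → ξ k ≈ 0#) → ε n ≈ 0# →
      serre x (x * Y n - Y n * x) ≈ 0#
    serre-commutator n η₁≈0 η₂≈0 ξ≈0 ε≈0 = begin
      serre x z
        ≈⟨ linear-combination
          (1# ∙ *-congˡ {x * x * x} z≈
          ∷ - (1# + b + c) ∙ *-congˡ {x * x} (*-congʳ {x} z≈)
          ∷ 1# + b + c ∙ *-congˡ {x} (*-congʳ {x} (*-congʳ {x} z≈))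
          ∷ - 1# ∙ *-congʳ {x} (*-congʳ {x} (*-congʳ {x} z≈))
          ∷ [])
          (solve 4 (λ x z g h → let s = :1 :+ :b :+ :c ; k = (:1 :- :c) :* (h :- g) in
              S x z := (:1 :- :c) :* (S x h :- S x g)
                :+ (:1 :* (x :* x :* x :* z :- x :* x :* x :* k)
                :+ ((:- s) :* (x :* x :* (z :* x) :- x :* x :* (k :* x))
                :+ (s :* (x :* (z :* x :* x) :- x :* (k :* x :* x))
                :+ ((:- :1) :* (z :* x :* x :* x :- k :* x :* x :* x) :+ :0)))))
            (x ∷ᵛ z ∷ᵛ G (suc n) ∷ᵛ H (suc n) ∷ᵛ []ᵛ) ≡.refl) ⟩
      (1# - c) * (serre x (H (suc n)) - serre x (G (suc n)))
        ≈⟨ linear-combination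
          (- (1# - c) ∙ *-congˡ {x} (*-congˡ {x} (η₂≈0 m))
          ∷ (1# - c) * (1# + c) ∙ *-congˡ {x} (*-congʳ {x} (η₂≈0 m))
          ∷ - ((1# - c) * c) ∙ *-congʳ {x} (*-congʳ {x} (η₂≈0 m))
          ∷ - ((1# - c) * c) ∙ *-congˡ {x} (*-congˡ {x} (η₁≈0 m))
          ∷ (1# - c) * (1# + c) ∙ *-congˡ {x} (*-congʳ {x} (η₁≈0 m))
          ∷ - (1# - c) ∙ *-congʳ {x} (*-congʳ {x} (η₁≈0 m))
          ∷ - ((1# - c) * (b - 1#) * (1# + c)) ∙ *-congˡ {x} (ξ≈0 m)
          ∷ (1# - c) * (b - 1#) * (1# + c) ∙ *-congʳ {x} (ξ≈0 m)
          ∷ [])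
          (solve 4 (λ x x₁ g h → let
                e = :1 :- :c
                η₁ = :b :* x :* g :- g :* x :- (:b :- :1) :* x₁
                η₂ = :b :* h :* x :- x :* h :- (:b :- :1) :* x₁
                ξ = x :* x₁ :- x₁ :* x in
              e :* (S x h :- S x g) := :0
                :+ ((:- e) :* (x :* (x :* η₂) :- x :* (x :* :0))
                :+ (e :* (:1 :+ :c) :* (x :* (η₂ :* x) :- x :* (:0 :* x))
                :+ ((:- (e :* :c)) :* (η₂ :* x :* x :- :0 :* x :* x)
                :+ ((:- (e :* :c)) :* (x :* (x :* η₁) :- x :* (x :* :0))
                :+ (e :* (:1 :+ :c) :* (x :* (η₁ :* x) :- x :* (:0 :* x))
                :+ ((:- e) :* (η₁ :* x :* x :- :0 :* x :* x)
                :+ ((:- (e :* (:b :- :1) :* (:1 :+ :c))) :* (x :* ξ :- x :* :0)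
                :+ (e :* (:b :- :1) :* (:1 :+ :c) :* (ξ :* x :- :0 :* x) :+ :0)))))))))
            (x ∷ᵛ X m ∷ᵛ G m ∷ᵛ H m ∷ᵛ []ᵛ) ≡.refl) ⟩
      0# ∎
      where
      m = suc n
      z = x * Y n - Y n * x
      z≈ : z ≈ (1# - c) * (H m - G m)
      z≈ = zero-difference ε≈0
      S : ∀ {n} → Expr n → Expr n → Expr n
      S x y = x :* x :* x :* y :- (:1 :+ :b :+ :c) :* (x :* x :* y :* x)
        :+ (:1 :+ :b :+ :c) :* (x :* y :* x :* x) :- y :* x :* x :* x

    minor-zero : minor G X 0 ≈ 0#
    minor-zero = linear-combination (1# ∙ *-congʳ {x} G₀ ∷ - 1# ∙ *-congˡ {x} G₀ ∷ [])
      (solve 2 (λ x g → g :* x :- x :* g :+ :c :* :0 := :0 :+ (:1 :* (g :* x :- :1 :* x)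
         :+ ((:- :1) :* (x :* g :- x :* :1) :+ :0))) (x ∷ᵛ G 0 ∷ᵛ []ᵛ) ≡.refl)

    η₁-zero : η₁ 0 ≈ 0#
    η₁-zero = linear-combination (b ∙ *-congˡ {x} G₀ ∷ - 1# ∙ *-congʳ {x} G₀ ∷ [])
      (solve 2 (λ x g → :b :* x :* g :- g :* x :- (:b :- :1) :* x := :0 :+ (:b :* (x :* g :- x :* :1)
         :+ ((:- :1) :* (g :* x :- :1 :* x) :+ :0))) (x ∷ᵛ G 0 ∷ᵛ []ᵛ) ≡.refl)

    η₂-zero : η₂ 0 ≈ 0#
    η₂-zero = linear-combination (b ∙ *-congʳ {x} H₀ ∷ - 1# ∙ *-congˡ {x} H₀ ∷ [])
      (solve 2 (λ x g → :b :* g :* x :- x :* g :- (:b :- :1) :* x := :0 :+ (:b :* (g :* x :- :1 :* x)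
         :+ ((:- :1) :* (x :* g :- x :* :1) :+ :0))) (x ∷ᵛ H 0 ∷ᵛ []ᵛ) ≡.refl)

  -- Induction on the degree

  module Recursion
    (1-cⁿ-cancel : ∀ n {z} → (1# - pow c (suc n)) * z ≈ 0# → z ≈ 0#)
    (1+cⁿ-cancel : ∀ n {z} → (1# + pow c (suc n)) * z ≈ 0# → z ≈ 0#)
    (G H X Y : ℕ → Carrier) (G₀ : G 0 ≈ 1#) (H₀ : H 0 ≈ 1#) where

    module x-side = Side G H X Y G₀ H₀
    module y-side = Side H G Y X H₀ G₀

    module _
      (X-def : ∀ n → x-side.η₁ n ≈ 0#) (Y-def : ∀ n → y-side.η₂ n ≈ 0#)
      (H-def : ∀ n → x-side.ε n ≈ 0#) (G-def : ∀ n → qdet G H X Y (suc n) ≈ 0#)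
      (serre-xy : serre (X 0) (Y 0) ≈ 0#) (serre-yx : serre (Y 0) (X 0) ≈ 0#) where

      1-c-cancel : ∀ {z} → (1# - c) * z ≈ 0# → z ≈ 0#
      1-c-cancel {z} h = 1-cⁿ-cancel 0 (trans
        (solve 1 (λ z → (:1 :- :c :* :1) :* z := (:1 :- :c) :* z) (z ∷ᵛ []ᵛ) ≡.refl) h)

      1+c-cancel : ∀ {z} → (1# + c) * z ≈ 0# → z ≈ 0#
      1+c-cancel {z} h = 1+cⁿ-cancel 0 (trans
        (solve 1 (λ z → (:1 :+ :c :* :1) :* z := (:1 :+ :c) :* z) (z ∷ᵛ []ᵛ) ≡.refl) h)

      b-1-cancel : ∀ {z} → (b - 1#) * z ≈ 0# → z ≈ 0#
      b-1-cancel {z} h = 1-c-cancel (linear-combination (c ∙ h ∷ [])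
        (solve 1 (λ z → (:1 :- :c) :* z := :0 :+ (:c :* ((:b :- :1) :* z :- :0) :+ :0)) (z ∷ᵛ []ᵛ) ≡.refl))

      b-cⁿ-cancel : ∀ n {z} → (b - pow c n) * z ≈ 0# → z ≈ 0#
      b-cⁿ-cancel n {z} h = 1-cⁿ-cancel n (linear-combination (c ∙ h ∷ [])
        (solve 2 (λ e z → (:1 :- :c :* e) :* z := :0 :+ (:c :* ((:b :- e) :* z :- :0) :+ :0)) (pow c n ∷ᵛ z ∷ᵛ []ᵛ) ≡.refl))

      -- The exponent starts at 2 because 1 - bc is zero.
      1-bcⁿ-cancel : ∀ n {z} → (1# - b * pow c (suc (suc n))) * z ≈ 0# → z ≈ 0#
      1-bcⁿ-cancel n {z} h = 1-cⁿ-cancel n (trans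
        (solve 2 (λ e z → (:1 :- :c :* e) :* z := (:1 :- :b :* (:c :* (:c :* e))) :* z) (pow c n ∷ᵛ z ∷ᵛ []ᵛ) ≡.refl) h)

      -- These are the relations that the recursion does not give outright. `ε≈0′` is indexed one
      -- lower because `ε m` involves G and H in degree m + 1.
      record Relations (n : ℕ) : Set where
        field
          η₂≈0  : x-side.η₂ n ≈ 0#
          ξ≈0   : x-side.ξ n ≈ 0#
          Q≈0   : minor G X n ≈ 0#
          η₁≈0′ : y-side.η₁ n ≈ 0#
          ξ≈0′  : y-side.ξ n ≈ 0#
          Q≈0′  : minor H Y n ≈ 0#
          ε≈0′  : ∀ {m} → n ≡ suc m → y-side.ε m ≈ 0#
      open Relations

      zero-addend : ∀ {u v} → v ≈ 0# → u + v ≈ 0# → u ≈ 0#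
      zero-addend {u} {v} v≈0 h = trans (sym (trans (+-congˡ v≈0) (+-identityʳ u))) h

      zero-scaled : ∀ {a z} → z ≈ 0# → a * z ≈ 0#
      zero-scaled h = trans (*-congˡ h) (zeroʳ _)

      relations-zero : Relations 0
      relations-zero = record
        { η₂≈0 = x-side.η₂-zero ; ξ≈0 = -‿inverseʳ _ ; Q≈0 = x-side.minor-zero
        ; η₁≈0′ = y-side.η₁-zero ; ξ≈0′ = -‿inverseʳ _ ; Q≈0′ = y-side.minor-zero
        ; ε≈0′ = λ () }

      -- The order is forced. The minor of `H` and `Y` in degree `m` gives the second determinant,
      -- both determinants and the other minor give `ε` for the second generator, and only then can
      -- both generators be commuted with both determinants. This yields the missing `η`, then the
      -- minors of degree n, and finally `ξ`.
      relations-suc : ∀ m → (∀ k → k < suc m → Relations k) → Relations (suc m)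
      relations-suc m below = record
        { η₂≈0 = η₂-top ; ξ≈0 = ξ-top m ≡.refl ; Q≈0 = Q-top
        ; η₁≈0′ = η₁-top′ ; ξ≈0′ = ξ-top′ m ≡.refl ; Q≈0′ = Q-top′
        ; ε≈0′ = λ { ≡.refl → ε-top′ } }
        where
        n = suc m
        ε<′ : ∀ k → k < m → y-side.ε k ≈ 0#
        ε<′ k k<m = ε≈0′ (below (suc k) (s≤s k<m)) ≡.refl

        qdet≈0′ : qdet H G Y X n ≈ 0#
        qdet≈0′ = b-1-cancel (linear-combination
          (- 1# ∙ x-side.qdet-symmetric m (λ k k≤m → η₂≈0 (below k (s≤s k≤m))) (λ k _ → H-def k) (Q≈0′ (below m ℕ.≤-refl))
          ∷ b - 1# ∙ G-def m ∷ b - pow c m ∙ H-def m ∷ [])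
          (solve 4 (λ e p s ε → (:b :- :1) :* s := :0 :+ ((:- :1) :* ((:b :- :1) :* (p :- s) :+ (:b :- e) :* ε :- :0)
              :+ ((:b :- :1) :* (p :- :0) :+ ((:b :- e) :* (ε :- :0) :+ :0))))
            (pow c m ∷ᵛ qdet G H X Y n ∷ᵛ qdet H G Y X n ∷ᵛ x-side.ε m ∷ᵛ []ᵛ) ≡.refl))

        ε-top′ : y-side.ε m ≈ 0#
        ε-top′ = b-cⁿ-cancel m (linear-combination
          (1# ∙ y-side.qdet-symmetric m (λ k _ → Y-def k) ε<′ (Q≈0 (below m ℕ.≤-refl))
          ∷ b - 1# ∙ G-def m ∷ - (b - 1#) ∙ qdet≈0′ ∷ [])
          (solve 4 (λ e p s ε → (:b :- e) :* ε := :0 :+ (:1 :* ((:b :- :1) :* (s :- p) :+ (:b :- e) :* ε :- :0)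
              :+ ((:b :- :1) :* (p :- :0) :+ ((:- (:b :- :1)) :* (s :- :0) :+ :0))))
            (pow c m ∷ᵛ qdet G H X Y n ∷ᵛ qdet H G Y X n ∷ᵛ y-side.ε m ∷ᵛ []ᵛ) ≡.refl))

        ε≤′ : ∀ k → k < n → y-side.ε k ≈ 0#
        ε≤′ k (s≤s k≤m) with ℕ.m≤n⇒m<n∨m≡n k≤m
        ... | inj₁ k<m    = ε<′ k k<m
        ... | inj₂ ≡.refl = ε-top′

        equation = x-side.commutator-qdet n (λ k _ → X-def k) (λ k k<n → η₂≈0 (below k k<n))
          (λ k k<n → ξ≈0 (below k k<n)) (λ k _ → H-def k) (G-def m)

        equation′ = y-side.commutator-qdet n (λ k k<n → η₁≈0′ (below k k<n)) (λ k _ → Y-def k)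
          (λ k k<n → ξ≈0′ (below k k<n)) ε≤′ qdet≈0′

        η₂-top : x-side.η₂ n ≈ 0#
        η₂-top = trans (zero-difference (1+cⁿ-cancel m (x-side.η-equal equation
          (x-side.commutator-qdet′ n (λ k _ → X-def k) (λ k k<n → η₂≈0 (below k k<n))
            (λ k k<n → ξ≈0 (below k k<n)) (λ k _ → H-def k) qdet≈0′)))) (X-def n)

        η₁-top′ : y-side.η₁ n ≈ 0#
        η₁-top′ = trans (sym (zero-difference (1+cⁿ-cancel m (y-side.η-equal equation′
          (y-side.commutator-qdet′ n (λ k k<n → η₁≈0′ (below k k<n)) (λ k _ → Y-def k)
            (λ k k<n → ξ≈0′ (below k k<n)) ε≤′ (G-def m)))))) (Y-def n)

        Q-top : minor G X n ≈ 0#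
        Q-top = b-1-cancel (zero-addend η₂-top (zero-addend
          (trans (-‿cong (zero-scaled (X-def n))) -0#≈0#) equation))

        Q-top′ : minor H Y n ≈ 0#
        Q-top′ = b-1-cancel (zero-addend (Y-def n) (zero-addend
          (trans (-‿cong (zero-scaled η₁-top′)) -0#≈0#) equation′))

        -- The extra index `k` exposes whether n = 1; there the Serre relation takes the place of
        -- `commutator-minor`.
        ξ-top : ∀ k → m ≡ k → x-side.ξ n ≈ 0#
        ξ-top zero    ≡.refl = b-1-cancel (1-c-cancel (1+c-cancel
          (x-side.ξ₁-serre (X-def 1) (H-def 0) (G-def 0) serre-xy)))
        ξ-top (suc k) ≡.refl = 1-bcⁿ-cancel k
          (x-side.commutator-minor n (λ k _ → X-def k) (λ k k<n → η₂≈0 (below k k<n))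
            (λ k k<n → ξ≈0 (below k k<n)) (λ k _ → H-def k) (X-def n) Q-top)

        ξ-top′ : ∀ k → m ≡ k → y-side.ξ n ≈ 0#
        ξ-top′ zero    ≡.refl = b-1-cancel (1-c-cancel (1+c-cancel
          (y-side.ξ₁-serre η₁-top′ ε-top′ qdet≈0′ serre-yx)))
        ξ-top′ (suc k) ≡.refl = 1-bcⁿ-cancel k
          (y-side.commutator-minor n (λ k k<n → η₁≈0′ (below k k<n)) (λ k _ → Y-def k)
            (λ k k<n → ξ≈0′ (below k k<n)) ε≤′ η₁-top′ Q-top′)

      relations-below : ∀ n k → k < n → Relations k
      relations-below (suc n) k (s≤s k≤n) with ℕ.m≤n⇒m<n∨m≡n k≤n
      ... | inj₁ k<n = relations-below n k k<n
      relations-below (suc zero)    _ _ | inj₂ ≡.refl = relations-zero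
      relations-below (suc (suc m)) _ _ | inj₂ ≡.refl = relations-suc m (relations-below (suc m))

      relations : ∀ n → Relations n
      relations n = relations-below (suc n) n ℕ.≤-refl

  -- From the recursive definition to the defining relations

  module FromRecursion
    (G H X Y : ℕ → Carrier) (G₀ : G 0 ≈ 1#) (H₀ : H 0 ≈ 1#)
    (β γ : Carrier) (u v w : ℕ → Carrier)
    (β-inv : (b - 1#) * β ≈ 1#) (γ-inv : (1# - c) * γ ≈ 1#)
    (v-inv : ∀ n → v n * (1# - pow c (suc n)) ≈ 1#)
    (u-inv : ∀ n → u n * (1# + pow c (suc n)) ≈ 1#)
    (u-invʳ : ∀ n → (1# + pow c (suc n)) * u n ≈ 1#)
    (w-inv : ∀ n → (1# + pow c (suc n)) * ((1# - c) * w n) ≈ 1#)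
    (G-rec : ∀ n → G (suc n) ≈ u n * ((X ⋆ Y) (suc n) - c * (shift G ⋆ shift H) n) + w n * (Y n * X 0 - X 0 * Y n))
    (H-rec : ∀ n → H (suc n) ≈ G (suc n) + γ * (X 0 * Y n - Y n * X 0))
    (X-rec : ∀ n → X (suc n) ≈ β * (b * (X 0 * G (suc n)) - G (suc n) * X 0))
    (Y-rec : ∀ n → Y (suc n) ≈ β * (b * (G (suc n) * Y 0) - Y 0 * G (suc n)))
    (serre-xy : serre (X 0) (Y 0) ≈ 0#) (serre-yx : serre (Y 0) (X 0) ≈ 0#) where

    cancel-invertible : ∀ {a a⁻¹ z} → a⁻¹ * a ≈ 1# → a * z ≈ 0# → z ≈ 0#
    cancel-invertible {a} {a⁻¹} {z} inverse h = begin
      z               ≈⟨ *-identityˡ z ⟨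
      1# * z          ≈⟨ *-congʳ inverse ⟨
      a⁻¹ * a * z     ≈⟨ *-assoc _ _ _ ⟩
      a⁻¹ * (a * z)   ≈⟨ *-congˡ h ⟩
      a⁻¹ * 0#        ≈⟨ zeroʳ _ ⟩
      0#              ∎

    open Recursion (λ n → cancel-invertible (v-inv n)) (λ n → cancel-invertible (u-inv n)) G H X Y G₀ H₀

    X-def : ∀ n → x-side.η₁ n ≈ 0#
    X-def zero    = x-side.η₁-zero
    X-def (suc n) = linear-combination (- (b - 1#) ∙ X-rec n ∷ - 1# ∙ *-congʳ {z} β-inv ∷ [])
      (solve 4 (λ x g x₁ β → let z = :b :* (x :* g) :- g :* x in
          :b :* x :* g :- g :* x :- (:b :- :1) :* x₁ := :0 :+ ((:- (:b :- :1)) :* (x₁ :- β :* z)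
            :+ ((:- :1) :* ((:b :- :1) :* β :* z :- :1 :* z) :+ :0)))
        (X 0 ∷ᵛ G (suc n) ∷ᵛ X (suc n) ∷ᵛ β ∷ᵛ []ᵛ) ≡.refl)
      where z = b * (X 0 * G (suc n)) - G (suc n) * X 0

    Y-def : ∀ n → y-side.η₂ n ≈ 0#
    Y-def zero    = y-side.η₂-zero
    Y-def (suc n) = linear-combination (- (b - 1#) ∙ Y-rec n ∷ - 1# ∙ *-congʳ {z} β-inv ∷ [])
      (solve 4 (λ y g y₁ β → let z = :b :* (g :* y) :- y :* g in
          :b :* g :* y :- y :* g :- (:b :- :1) :* y₁ := :0 :+ ((:- (:b :- :1)) :* (y₁ :- β :* z)
            :+ ((:- :1) :* ((:b :- :1) :* β :* z :- :1 :* z) :+ :0)))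
        (Y 0 ∷ᵛ G (suc n) ∷ᵛ Y (suc n) ∷ᵛ β ∷ᵛ []ᵛ) ≡.refl)
      where z = b * (G (suc n) * Y 0) - Y 0 * G (suc n)

    H-def : ∀ n → x-side.ε n ≈ 0#
    H-def n = linear-combination (- (1# - c) ∙ H-rec n ∷ - 1# ∙ *-congʳ {z} γ-inv ∷ [])
      (solve 4 (λ z g h γ →
          z :- (:1 :- :c) :* (h :- g) := :0 :+ ((:- (:1 :- :c)) :* (h :- (g :+ γ :* z))
            :+ ((:- :1) :* ((:1 :- :c) :* γ :* z :- :1 :* z) :+ :0)))
        (z ∷ᵛ G (suc n) ∷ᵛ H (suc n) ∷ᵛ γ ∷ᵛ []ᵛ) ≡.refl)
      where z = X 0 * Y n - Y n * X 0

    -- The two ends of G ⋆ H are H and cⁿ⁺¹G in degree n + 1. Substituting the recursion for H turns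
    -- their sum into (1 + cⁿ⁺¹)G plus a commutator, and the recursion for G solves exactly this
    -- equation; (1 + cⁿ⁺¹)w = γ matches the commutator terms.
    G-def : ∀ n → qdet G H X Y (suc n) ≈ 0#
    G-def n = linear-combination
      (1# + c * pow c n ∙ G-rec n
      ∷ 1# ∙ *-congʳ {(X ⋆ Y) (suc n) - c * (shift G ⋆ shift H) n} (u-invʳ n)
      ∷ 1# ∙ *-congʳ {Y n * X 0 - X 0 * Y n} w≈γ
      ∷ 1# ∙ H-rec n
      ∷ 1# ∙ *-congʳ {H (suc n)} G₀
      ∷ c * pow c n ∙ *-congˡ {G (suc n)} H₀
      ∷ c ∙ ⋆-last (shift G) H n
      ∷ [])
      (solve 13 (λ e g0 h0 g h S C T x y u w γ → let K = y :* x :- x :* y ; K′ = x :* y :- y :* x in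
          g0 :* h :+ :c :* C :- S := :0 :+ ((:1 :+ :c :* e) :* (g :- (u :* (S :- :c :* T) :+ w :* K))
            :+ (:1 :* ((:1 :+ :c :* e) :* u :* (S :- :c :* T) :- :1 :* (S :- :c :* T))
            :+ (:1 :* ((:1 :+ :c :* e) :* w :* K :- γ :* K)
            :+ (:1 :* (h :- (g :+ γ :* K′))
            :+ (:1 :* (g0 :* h :- :1 :* h)
            :+ (:c :* e :* (g :* h0 :- g :* :1)
            :+ (:c :* (C :- (T :+ e :* (g :* h0))) :+ :0))))))))
        (pow c n ∷ᵛ G 0 ∷ᵛ H 0 ∷ᵛ G (suc n) ∷ᵛ H (suc n) ∷ᵛ (X ⋆ Y) (suc n) ∷ᵛ (shift G ⋆ H) (suc n)
         ∷ᵛ (shift G ⋆ shift H) n ∷ᵛ X 0 ∷ᵛ Y n ∷ᵛ u n ∷ᵛ w n ∷ᵛ γ ∷ᵛ []ᵛ) ≡.refl)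
      where
      w≈γ : (1# + c * pow c n) * w n ≈ γ
      w≈γ = linear-combination
        (- 1# ∙ *-congˡ {(1# + c * pow c n) * w n} γ-inv ∷ 1# ∙ *-congʳ {γ} (w-inv n) ∷ [])
        (solve 3 (λ e w γ → let e₁ = :1 :+ :c :* e in
            e₁ :* w := γ :+ ((:- :1) :* (e₁ :* w :* ((:1 :- :c) :* γ) :- e₁ :* w :* :1)
              :+ (:1 :* (e₁ :* ((:1 :- :c) :* w) :* γ :- :1 :* γ) :+ :0)))
          (pow c n ∷ᵛ w n ∷ᵛ γ ∷ᵛ []ᵛ) ≡.refl)

    private
      relations-at : ∀ n → Relations X-def Y-def H-def G-def serre-xy serre-yx n
      relations-at = relations X-def Y-def H-def G-def serre-xy serre-yx

    [x,X]≈0 : ∀ n → X 0 * X n - X n * X 0 ≈ 0#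
    [x,X]≈0 n = Relations.ξ≈0 (relations-at n)

    [y,Y]≈0 : ∀ n → Y 0 * Y n - Y n * Y 0 ≈ 0#
    [y,Y]≈0 n = Relations.ξ≈0′ (relations-at n)

    serre-x-[x,Y] : ∀ n → serre (X 0) (X 0 * Y n - Y n * X 0) ≈ 0#
    serre-x-[x,Y] n = x-side.serre-commutator n X-def (λ k → Relations.η₂≈0 (relations-at k)) [x,X]≈0 (H-def n)

    serre-y-[y,X] : ∀ n → serre (Y 0) (Y 0 * X n - X n * Y 0) ≈ 0#
    serre-y-[y,X] n = y-side.serre-commutator n (λ k → Relations.η₁≈0′ (relations-at k)) Y-def [y,Y]≈0
      (Relations.ε≈0′ (relations-at (suc n)) ≡.refl)

-- Alternating sums over the entries of a list

-- removal φ [a₀, …, aₙ] = Σ (−1)ⁱ φ aᵢ [a₀, …, âᵢ, …, aₙ].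
module Removal (M : AbelianGroup 0ℓ 0ℓ) where
  open AbelianGroup M renaming (_∙_ to _+_; ε to 0#; _⁻¹ to -_; ∙-cong to +-cong; ∙-congˡ to +-congˡ;
    ∙-congʳ to +-congʳ; ⁻¹-cong to -‿cong; assoc to +-assoc; comm to +-comm;
    identityˡ to +-identityˡ; inverseʳ to -‿inverseʳ)
  open AbelianGroupProperties M renaming (⁻¹-involutive to -‿involutive; ε⁻¹≈ε to -0≈0; ⁻¹-∙-comm to -‿+-comm)
  open CommutativeSemigroupProperties (AbelianGroup.commutativeSemigroup M) using (interchange)
  open SetoidReasoning setoid

  removal : {A : Set} → (A → List A → Carrier) → List A → Carrier
  removal φ []       = 0#
  removal φ (a ∷ as) = φ a as + - removal (λ a′ r → φ a′ (a ∷ r)) as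

  removal-cong : {A : Set} {φ ψ : A → List A → Carrier} → (∀ a r → φ a r ≈ ψ a r) → ∀ as → removal φ as ≈ removal ψ as
  removal-cong h []       = refl
  removal-cong h (a ∷ as) = +-cong (h a as) (-‿cong (removal-cong (λ a′ r → h a′ (a ∷ r)) as))

  removal-0 : {A : Set} {φ : A → List A → Carrier} → (∀ a r → φ a r ≈ 0#) → ∀ as → removal φ as ≈ 0#
  removal-0 h []       = refl
  removal-0 h (a ∷ as) = trans (+-cong (h a as) (trans (-‿cong (removal-0 (λ a′ r → h a′ (a ∷ r)) as)) -0≈0)) (+-identityˡ _)

  removal-difference : {A : Set} (φ ψ : A → List A → Carrier) → ∀ as →
    removal (λ a r → φ a r + - ψ a r) as ≈ removal φ as + - removal ψ as
  removal-difference φ ψ []       = sym (-‿inverseʳ _)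
  removal-difference φ ψ (a ∷ as) = begin
    (φ a as + - ψ a as) + - removal (λ a′ r → φ′ a′ r + - ψ′ a′ r) as
      ≈⟨ +-congˡ (-‿cong (removal-difference φ′ ψ′ as)) ⟩
    (φ a as + - ψ a as) + - (removal φ′ as + - removal ψ′ as)
      ≈⟨ +-congˡ (-‿+-comm _ _) ⟨
    (φ a as + - ψ a as) + (- removal φ′ as + - - removal ψ′ as)
      ≈⟨ interchange _ _ _ _ ⟩
    (φ a as + - removal φ′ as) + (- ψ a as + - - removal ψ′ as)
      ≈⟨ +-congˡ (-‿+-comm _ _) ⟩
    (φ a as + - removal φ′ as) + - (ψ a as + - removal ψ′ as) ∎
    where
    φ′ = λ a′ r → φ a′ (a ∷ r)
    ψ′ = λ a′ r → ψ a′ (a ∷ r)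

  removal-map : {A B : Set} (g : A → B) (φ : B → List B → Carrier) → ∀ as →
    removal φ (map g as) ≡ removal (λ a r → φ (g a) (map g r)) as
  removal-map g φ []       = ≡.refl
  removal-map g φ (a ∷ as) = ≡.cong (λ z → φ (g a) (map g as) + - z) (removal-map g (λ b r → φ b (g a ∷ r)) as)

  removal² : {A : Set} → (A → A → List A → Carrier) → List A → Carrier
  removal² ψ = removal (λ a → removal (ψ a))

  private
    removal²-∷ : {A : Set} (ψ : A → A → List A → Carrier) → ∀ a as → removal² ψ (a ∷ as) ≈
      (removal (ψ a) as + - removal (λ a′ → ψ a′ a) as) + removal² (λ a′ a″ r → ψ a′ a″ (a ∷ r)) as
    removal²-∷ ψ a as = begin
      removal (ψ a) as + - removal (λ a′ r → ψ a′ a r + - removal (λ a″ r′ → ψ a′ a″ (a ∷ r′)) r) as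
        ≈⟨ +-congˡ (-‿cong (removal-difference (λ a′ → ψ a′ a) _ as)) ⟩
      removal (ψ a) as + - (removal (λ a′ → ψ a′ a) as + - removal² (λ a′ a″ r → ψ a′ a″ (a ∷ r)) as)
        ≈⟨ +-congˡ (trans (sym (-‿+-comm _ _)) (+-congˡ (-‿involutive _))) ⟩
      removal (ψ a) as + (- removal (λ a′ → ψ a′ a) as + removal² (λ a′ a″ r → ψ a′ a″ (a ∷ r)) as)
        ≈⟨ +-assoc _ _ _ ⟨
      (removal (ψ a) as + - removal (λ a′ → ψ a′ a) as) + removal² (λ a′ a″ r → ψ a′ a″ (a ∷ r)) as ∎

  -- Removing two given entries in one order and in the other carries opposite signs, so symmetric
  -- contributions cancel in pairs. `removal²-swap` rests on the same sign.
  removal²-symmetric : {A : Set} (ψ : A → A → List A → Carrier) → (∀ a a′ r → ψ a a′ r ≈ ψ a′ a r) →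
    ∀ as → removal² ψ as ≈ 0#
  removal²-symmetric ψ h []       = refl
  removal²-symmetric ψ h (a ∷ as) = trans (removal²-∷ ψ a as) (trans (+-cong
    (trans (+-congˡ (-‿cong (removal-cong (λ a′ r → h a′ a r) as))) (-‿inverseʳ _))
    (removal²-symmetric _ (λ a′ a″ r → h a′ a″ (a ∷ r)) as)) (+-identityˡ _))

  removal²-swap : {A : Set} (ψ : A → A → List A → Carrier) → ∀ as →
    removal² ψ as ≈ - removal² (λ a a′ → ψ a′ a) as
  removal²-swap ψ []       = sym -0≈0
  removal²-swap ψ (a ∷ as) = begin
    removal² ψ (a ∷ as)
      ≈⟨ removal²-∷ ψ a as ⟩
    (p + - q) + removal² (λ a′ a″ r → ψ a′ a″ (a ∷ r)) as
      ≈⟨ +-cong (trans (+-comm _ _) (+-congˡ (sym (-‿involutive _)))) (removal²-swap _ as) ⟩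
    (- q + - - p) + - removal² (λ a′ a″ r → ψ a″ a′ (a ∷ r)) as
      ≈⟨ +-congʳ (-‿+-comm _ _) ⟩
    - (q + - p) + - removal² (λ a′ a″ r → ψ a″ a′ (a ∷ r)) as
      ≈⟨ -‿+-comm _ _ ⟩
    - ((q + - p) + removal² (λ a′ a″ r → ψ a″ a′ (a ∷ r)) as)
      ≈⟨ -‿cong (removal²-∷ (λ a a′ → ψ a′ a) a as) ⟨
    - removal² (λ a a′ → ψ a′ a) (a ∷ as) ∎
    where
    p = removal (ψ a) as
    q = removal (λ a′ → ψ a′ a) as

  -- Applied to the dependence of n + 1 vectors given by `cramer`: when the terms omitting one of
  -- `vs` vanish, a relation among the remaining vectors is left. Its overall sign is immaterial.
  removal-suffix : {A : Set} (φ : A → List A → Carrier) → ∀ vs as →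
    (∀ a r → suc (length r) ≡ length vs → φ a (r ++ as) ≈ 0#) →
    removal φ (vs ++ as) ≈ 0# → removal (λ a r → φ a (vs ++ r)) as ≈ 0#
  removal-suffix φ []       as h total = total
  removal-suffix φ (v ∷ vs) as h total = removal-suffix (λ a r → φ a (v ∷ r)) vs as
    (λ a r eq → h a (v ∷ r) (≡.cong suc eq))
    (begin
      z                           ≈⟨ -‿involutive z ⟨
      - - z                       ≈⟨ -‿cong (+-identityˡ (- z)) ⟨
      - (0# + - z)                ≈⟨ -‿cong (+-congʳ (h v vs ≡.refl)) ⟨
      - (φ v (vs ++ as) + - z)    ≈⟨ -‿cong total ⟩
      - 0#                        ≈⟨ -0≈0 ⟩
      0#                          ∎)
    where z = removal (λ a r → φ a (v ∷ r)) (vs ++ as)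

module _ (M N : AbelianGroup 0ℓ 0ℓ) where
  private
    module M = AbelianGroup M
    module N = AbelianGroup N
    open Removal

  removal-homo : (f : M.Carrier → N.Carrier) → f M.ε N.≈ N.ε →
    (∀ u v → f (u M.∙ (v M.⁻¹)) N.≈ f u N.∙ (f v N.⁻¹)) →
    {A : Set} (φ : A → List A → M.Carrier) → ∀ as → f (removal M φ as) N.≈ removal N (λ a r → f (φ a r)) as
  removal-homo f f-0 f-sub φ []       = f-0
  removal-homo f f-0 f-sub φ (a ∷ as) = N.trans (f-sub _ _)
    (N.∙-congˡ (N.⁻¹-cong (removal-homo f f-0 f-sub (λ a′ r → φ a′ (a ∷ r)) as)))

-- An ordering of the eigenspaces, either the given one or its reversal.
record Ranking (d : ℕ) : Set where
  field
    rank           : Fin (suc d) → ℕ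
    rank≤d         : ∀ j → rank j ≤ d
    rank-injective : ∀ {i j} → rank i ≡ rank j → i ≡ j
    unrank         : ∀ n → n ≤ d → ∃ λ j → rank j ≡ n
    rank-adjacent  : ∀ i j → toℕ j ≤ suc (toℕ i) → toℕ i ≤ suc (toℕ j) → rank j ≤ suc (rank i)

ascending : ∀ d → Ranking d
ascending d = record
  { rank = toℕ
  ; rank≤d = λ j → ℕ.≤-pred (Fin.toℕ<n j)
  ; rank-injective = Fin.toℕ-injective
  ; unrank = λ n n≤d → Fin.fromℕ< (s≤s n≤d) , Fin.toℕ-fromℕ< (s≤s n≤d)
  ; rank-adjacent = λ i j j≤ _ → j≤ }

∸-suc-≤ : ∀ d {m n} → m ≤ suc n → d ∸ n ≤ suc (d ∸ m)
∸-suc-≤ d {m} {n} m≤1+n = ℕ.m≤n+o⇒m∸n≤o d n (ℕ.≤-trans (ℕ.m≤n+m∸n d m)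
  (ℕ.≤-trans (ℕ.+-monoˡ-≤ (d ∸ m) m≤1+n) (ℕ.≤-reflexive (≡.sym (ℕ.+-suc n (d ∸ m))))))

module _ {d : ℕ} (R : Ranking d) where
  open Ranking R

  reversed : Ranking d
  reversed = record
    { rank = λ j → d ∸ rank j
    ; rank≤d = λ j → ℕ.m∸n≤m d (rank j)
    ; rank-injective = λ {i} {j} eq → rank-injective (≡.trans (≡.sym (ℕ.m∸[m∸n]≡n (rank≤d i)))
        (≡.trans (≡.cong (d ∸_) eq) (ℕ.m∸[m∸n]≡n (rank≤d j))))
    ; unrank = λ n n≤d → let (j , eq) = unrank (d ∸ n) (ℕ.m∸n≤m d n) in
        j , ≡.trans (≡.cong (d ∸_) eq) (ℕ.m∸[m∸n]≡n n≤d)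
    ; rank-adjacent = λ i j j≤ i≤ → ∸-suc-≤ d (rank-adjacent j i i≤ j≤) }

-- Linear algebra over a field without decidable equality

module Representation (F : Field) (V : LeftModule (Field.ring F) 0ℓ 0ℓ) where
  open Field F hiding (zero)
  open LeftModule V
  open Setup F V

  module LinearAlgebra where
    open RingProperties ring using (-‿distribˡ-*; -‿distribʳ-*; -0#≈0#)
    open AbelianGroupProperties +ᴹ-abelianGroup using ()
      renaming (ε⁻¹≈ε to -0ᴹ≈0ᴹ; ⁻¹-∙-comm to -ᴹ‿+ᴹ-comm; inverseʳ-unique to -ᴹ-unique;
                x∙y⁻¹≈ε⇒x≈y to difference≈0ᴹ)
    open CommutativeSemigroupProperties (AbelianGroup.commutativeSemigroup +ᴹ-abelianGroup)
      using () renaming (interchange to +ᴹ-interchange)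

    -- Determinants

    Coordinates : ℕ → Set
    Coordinates n = Fin n → Carrier

    tail : ∀ {n} → Coordinates (suc n) → Coordinates n
    tail w i = w (suc i)

    open Removal +-abelianGroup

    -- Laplace expansion along the first coordinate. Vectors come as a list of arbitrary length so
    -- that they can be removed and prepended freely; the value is the determinant only when the
    -- length is `n`.
    det : ∀ n → List (Coordinates n) → Carrier
    det zero    ws = 1#
    det (suc n) ws = removal (λ w r → w zero * det n (map tail r)) ws

    removal-*ʳ : {A : Set} (φ : A → List A → Carrier) → ∀ as z → removal φ as * z ≈ removal (λ a r → φ a r * z) as
    removal-*ʳ φ as z = removal-homo +-abelianGroup +-abelianGroup (_* z) (zeroˡ z)
      (λ u v → trans (distribʳ z u (- v)) (+-congˡ (sym (-‿distribˡ-* v z)))) φ as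

    removal-*ˡ : {A : Set} (φ : A → List A → Carrier) → ∀ as z → z * removal φ as ≈ removal (λ a r → z * φ a r) as
    removal-*ˡ φ as z = removal-homo +-abelianGroup +-abelianGroup (z *_) (zeroʳ z)
      (λ u v → trans (distribˡ z u (- v)) (+-congˡ (sym (-‿distribʳ-* z v)))) φ as

    -- Cramer's rule as a linear dependence, meaningful for n + 1 vectors. In coordinate 0 the
    -- double expansion is symmetric in the two removed vectors, as for a determinant with a
    -- repeated column. For another coordinate, exchange the two removals, take out the first
    -- coordinate and apply the identity to the tails.
    cramer : ∀ n ws (i : Fin n) → removal (λ w r → det n r * w i) ws ≈ 0#
    cramer (suc n) ws zero = trans
      (removal-cong (λ w r → removal-*ʳ _ r (w zero)) ws)
      (removal²-symmetric (λ w w′ r → w′ zero * det n (map tail r) * w zero)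
        (λ w w′ r → trans (*-comm _ _) (trans (*-congˡ (*-comm _ _)) (sym (*-assoc _ _ _)))) ws)
    cramer (suc n) ws (suc i) = begin
      removal (λ w r → det (suc n) r * w (suc i)) ws
        ≈⟨ removal-cong (λ w r → removal-*ʳ _ r (w (suc i))) ws ⟩
      removal² (λ w w′ r → w′ zero * det n (map tail r) * w (suc i)) ws
        ≈⟨ removal²-swap _ ws ⟩
      - removal² (λ w w′ r → w zero * det n (map tail r) * w′ (suc i)) ws
        ≈⟨ -‿cong (removal-0 (λ w r → begin
             removal (λ w′ r′ → w zero * det n (map tail r′) * w′ (suc i)) r
               ≈⟨ removal-cong (λ w′ r′ → *-assoc _ _ _) r ⟩
             removal (λ w′ r′ → w zero * (det n (map tail r′) * w′ (suc i))) r
               ≈⟨ removal-*ˡ _ r (w zero) ⟨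
             w zero * removal (λ w′ r′ → det n (map tail r′) * w′ (suc i)) r
               ≡⟨ ≡.cong (w zero *_) (removal-map tail (λ u r′ → det n r′ * u i) r) ⟨
             w zero * removal (λ u r′ → det n r′ * u i) (map tail r)
               ≈⟨ *-congˡ (cramer n (map tail r) i) ⟩
             w zero * 0#
               ≈⟨ zeroʳ _ ⟩
             0# ∎) ws) ⟩
      - 0#
        ≈⟨ -0#≈0# ⟩
      0# ∎
      where open SetoidReasoning setoid

    nonzero-det : ∀ n → ∃ λ ws → length ws ≡ n × det n ws ≈ 1#
    nonzero-det zero = [] , ≡.refl , refl
    nonzero-det (suc n) with nonzero-det n
    ... | ws , length≡n , det≈1 = first ∷ map 0∷ ws , ≡.cong suc (≡.trans (List.length-map 0∷ ws) length≡n) , (begin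
      1# * det n (map tail (map 0∷ ws)) + - removal (λ w r → w zero * D w r) (map 0∷ ws)
        ≈⟨ +-cong (*-identityˡ _) (-‿cong (trans (reflexive (removal-map 0∷ _ ws)) (removal-0 (λ w r → zeroˡ _) ws))) ⟩
      det n (map tail (map 0∷ ws)) + - 0#
        ≈⟨ +-cong (reflexive (≡.cong (det n) (≡.trans (≡.sym (List.map-∘ ws)) (List.map-id ws)))) -0#≈0# ⟩
      det n ws + 0#
        ≈⟨ +-identityʳ _ ⟩
      det n ws
        ≈⟨ det≈1 ⟩
      1# ∎)
      where
      open SetoidReasoning setoid
      0∷ : Coordinates n → Coordinates (suc n)
      0∷ w zero    = 0#
      0∷ w (suc i) = w i
      first : Coordinates (suc n)
      first zero    = 1#
      first (suc i) = 0#
      D = λ (w : Coordinates (suc n)) r → det n (map tail (first ∷ r))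

    -- Finite sums, spans and coordinates

    vsum-cong : ∀ {n} {f g : Fin n → Vec} → (∀ j → f j ≈ᴹ g j) → vsum f ≈ᴹ vsum g
    vsum-cong {zero}  h = ≈ᴹ-refl
    vsum-cong {suc n} h = +ᴹ-cong (h zero) (vsum-cong (λ j → h (suc j)))

    vsum-0 : ∀ {n} {f : Fin n → Vec} → (∀ j → f j ≈ᴹ 0ᴹ) → vsum f ≈ᴹ 0ᴹ
    vsum-0 {zero}  h = ≈ᴹ-refl
    vsum-0 {suc n} h = ≈ᴹ-trans (+ᴹ-cong (h zero) (vsum-0 (λ j → h (suc j)))) (+ᴹ-identityˡ _)

    vsum-+ : ∀ {n} (f g : Fin n → Vec) → vsum (λ j → f j +ᴹ g j) ≈ᴹ vsum f +ᴹ vsum g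
    vsum-+ {zero}  f g = ≈ᴹ-sym (+ᴹ-identityˡ _)
    vsum-+ {suc n} f g = ≈ᴹ-trans (+ᴹ-congˡ (vsum-+ (λ j → f (suc j)) (λ j → g (suc j)))) (+ᴹ-interchange _ _ _ _)

    vsum-*ₗ : ∀ {n} a (f : Fin n → Vec) → vsum (λ j → a *ₗ f j) ≈ᴹ a *ₗ vsum f
    vsum-*ₗ {zero}  a f = ≈ᴹ-sym (*ₗ-zeroʳ a)
    vsum-*ₗ {suc n} a f = ≈ᴹ-trans (+ᴹ-congˡ (vsum-*ₗ a (λ j → f (suc j)))) (≈ᴹ-sym (*ₗ-distribˡ a _ _))

    -1*ₗ : ∀ v → (- 1#) *ₗ v ≈ᴹ -ᴹ v
    -1*ₗ v = -ᴹ-unique v ((- 1#) *ₗ v) (begin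
      v +ᴹ (- 1#) *ₗ v            ≈⟨ +ᴹ-congʳ (*ₗ-identityˡ v) ⟨
      1# *ₗ v +ᴹ (- 1#) *ₗ v      ≈⟨ *ₗ-distribʳ v 1# (- 1#) ⟨
      (1# + - 1#) *ₗ v            ≈⟨ *ₗ-congʳ (-‿inverseʳ 1#) ⟩
      0# *ₗ v                     ≈⟨ *ₗ-zeroˡ v ⟩
      0ᴹ                          ∎)
      where open SetoidReasoning ≈ᴹ-setoid

    -ᴹ-*ₗ : ∀ a v → (- a) *ₗ v ≈ᴹ -ᴹ (a *ₗ v)
    -ᴹ-*ₗ a v = -ᴹ-unique (a *ₗ v) ((- a) *ₗ v) (≈ᴹ-trans (≈ᴹ-sym (*ₗ-distribʳ v a (- a)))
      (≈ᴹ-trans (*ₗ-congʳ (-‿inverseʳ a)) (*ₗ-zeroˡ v)))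

    *ₗ-‿-ᴹ : ∀ a v → a *ₗ (-ᴹ v) ≈ᴹ -ᴹ (a *ₗ v)
    *ₗ-‿-ᴹ a v = -ᴹ-unique (a *ₗ v) (a *ₗ (-ᴹ v)) (≈ᴹ-trans (≈ᴹ-sym (*ₗ-distribˡ a v (-ᴹ v)))
      (≈ᴹ-trans (*ₗ-congˡ (-ᴹ‿inverseʳ v)) (*ₗ-zeroʳ a)))

    app-0 : ∀ T → app T 0ᴹ ≈ᴹ 0ᴹ
    app-0 T = ≈ᴹ-trans (End.cong T (≈ᴹ-sym (*ₗ-zeroˡ 0ᴹ))) (≈ᴹ-trans (End.*-hom T 0# 0ᴹ) (*ₗ-zeroˡ _))

    app-neg : ∀ T v → app T (-ᴹ v) ≈ᴹ -ᴹ app T v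
    app-neg T v = ≈ᴹ-trans (End.cong T (≈ᴹ-sym (-1*ₗ v))) (≈ᴹ-trans (End.*-hom T (- 1#) v) (-1*ₗ _))

    app-vsum : ∀ T {n} (f : Fin n → Vec) → app T (vsum f) ≈ᴹ vsum (λ j → app T (f j))
    app-vsum T {zero}  f = app-0 T
    app-vsum T {suc n} f = ≈ᴹ-trans (End.+-hom T _ _) (+ᴹ-congˡ (app-vsum T (λ j → f (suc j))))

    InSpan : List Vec → Vec → Set
    InSpan []       v = v ≈ᴹ 0ᴹ
    InSpan (e ∷ es) v = ∃ λ a → ∃ λ u → InSpan es u × v ≈ᴹ a *ₗ e +ᴹ u

    -- Each vector is compared only with the later ones, in step with an induction that discards
    -- vectors from the front.
    Independent : List Vec → Set
    Independent []       = ⊤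
    Independent (e ∷ es) = (∀ a u → InSpan es u → a *ₗ e +ᴹ u ≈ᴹ 0ᴹ → a ≈ 0#) × Independent es

    span-neg : ∀ es {v} → InSpan es v → InSpan es (-ᴹ v)
    span-neg []       v≈0 = ≈ᴹ-trans (-ᴹ‿cong v≈0) -0ᴹ≈0ᴹ
    span-neg (e ∷ es) (a , u , u∈ , v≈) = - a , -ᴹ u , span-neg es u∈ ,
      ≈ᴹ-trans (-ᴹ‿cong v≈) (≈ᴹ-trans (≈ᴹ-sym (-ᴹ‿+ᴹ-comm _ _)) (+ᴹ-congʳ (≈ᴹ-sym (-ᴹ-*ₗ a e))))

    module VectorRemoval = Removal +ᴹ-abelianGroup

    removal-in-span : ∀ (χ : List Vec → Carrier) es → InSpan es (VectorRemoval.removal (λ e r → χ r *ₗ e) es)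
    removal-in-span χ []       = ≈ᴹ-refl
    removal-in-span χ (e ∷ es) = χ es , _ , span-neg es (removal-in-span (λ r → χ (e ∷ r)) es) , ≈ᴹ-refl

    record IsCoordinateMap {n} (f : Vec → Coordinates n) : Set where
      field
        f-cong : ∀ {u v} → u ≈ᴹ v → ∀ i → f u i ≈ f v i
        f-+    : ∀ u v i → f (u +ᴹ v) i ≈ f u i + f v i
        f-*    : ∀ a v i → f (a *ₗ v) i ≈ a * f v i

      f-0 : ∀ i → f 0ᴹ i ≈ 0#
      f-0 i = trans (f-cong (≈ᴹ-sym (*ₗ-zeroˡ 0ᴹ)) i) (trans (f-* 0# 0ᴹ i) (zeroˡ _))

      f-neg : ∀ v i → f (-ᴹ v) i ≈ - f v i
      f-neg v i = trans (f-cong (≈ᴹ-sym (-1*ₗ v)) i) (trans (f-* (- 1#) v i)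
        (trans (sym (-‿distribˡ-* 1# _)) (-‿cong (*-identityˡ _))))

      f-removal : ∀ (χ : List Vec → Carrier) es i →
        f (VectorRemoval.removal (λ e r → χ r *ₗ e) es) i ≈ removal (λ e r → χ r * f e i) es
      f-removal χ es i = trans
        (removal-homo +ᴹ-abelianGroup +-abelianGroup (λ v → f v i) (f-0 i)
          (λ u v → trans (f-+ u (-ᴹ v) i) (+-congˡ (f-neg v i))) _ es)
        (removal-cong (λ e r → f-* (χ r) e i) es)

    module _ {n} {f : Vec → Coordinates n} (f-map : IsCoordinateMap f)
      (f-injective : ∀ v → (∀ i → f v i ≈ 0#) → v ≈ᴹ 0ᴹ) where
      open IsCoordinateMap f-map

      -- If det vanishes on all completions of f(e₁), …, f(eₖ), then so it does for f(e₂), …, f(eₖ).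
      independent⇒completable : ∀ es → Independent es →
        (∀ vs → length vs ℕ.+ length es ≡ n → det n (vs ++ map f es) ≈ 0#) → ⊥
      independent⇒completable [] _ h with nonzero-det n
      ... | ws , length≡n , det≈1 = 1≉0 (trans (sym det≈1)
        (trans (reflexive (≡.cong (det n) (≡.sym (List.++-identityʳ ws))))
          (h ws (≡.trans (ℕ.+-identityʳ _) length≡n))))
      independent⇒completable (e ∷ es) (e-ind , es-ind) h = independent⇒completable es es-ind (λ vs length≡n →
        e-ind _ _ (span-neg es (removal-in-span _ es)) (f-injective _ (λ i → trans
          (f-removal (λ r → det n (vs ++ map f r)) (e ∷ es) i)
          (trans (reflexive (≡.sym (removal-map f (λ w r → det n (vs ++ r) * w i) (e ∷ es))))
            (removal-suffix (λ w r → det n r * w i) vs (map f (e ∷ es))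
              (λ w r eq → trans (*-congʳ (h r (≡.trans (ℕ.+-suc _ _)
                (≡.trans (≡.cong (ℕ._+ length es) eq) length≡n)))) (zeroˡ _))
              (cramer n (vs ++ map f (e ∷ es)) i))))))

    module _ {n} (e : Fin n → Vec) (basis : IsBasis e) where
      private
        module ≈-Reasoningᴹ = SetoidReasoning ≈ᴹ-setoid
        combination : (Fin n → Carrier) → Vec
        combination a = vsum (λ j → a j *ₗ e j)

      coordinates : Vec → Coordinates n
      coordinates v = proj₁ (proj₁ basis v)

      coordinates-spec : ∀ v → v ≈ᴹ combination (coordinates v)
      coordinates-spec v = proj₂ (proj₁ basis v)

      combination-+ : ∀ a a′ → combination (λ j → a j + a′ j) ≈ᴹ combination a +ᴹ combination a′
      combination-+ a a′ = ≈ᴹ-trans (vsum-cong (λ j → *ₗ-distribʳ (e j) (a j) (a′ j))) (vsum-+ (λ j → a j *ₗ e j) (λ j → a′ j *ₗ e j))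

      combination-* : ∀ z a → combination (λ j → z * a j) ≈ᴹ z *ₗ combination a
      combination-* z a = ≈ᴹ-trans (vsum-cong (λ j → *ₗ-assoc z (a j) (e j))) (vsum-*ₗ z (λ j → a j *ₗ e j))

      combination-injective : ∀ a a′ → combination a ≈ᴹ combination a′ → ∀ j → a j ≈ a′ j
      combination-injective a a′ eq j = begin
        a j                        ≈⟨ +-identityʳ _ ⟨
        a j + 0#                   ≈⟨ +-congˡ (-‿inverseˡ _) ⟨
        a j + (- a′ j + a′ j)      ≈⟨ +-assoc _ _ _ ⟨
        a j + - a′ j + a′ j        ≈⟨ +-congʳ (+-congˡ (trans (-‿cong (sym (*-identityˡ _))) (-‿distribˡ-* 1# _))) ⟩
        a j + - 1# * a′ j + a′ j   ≈⟨ +-congʳ (proj₂ basis _ difference≈0 j) ⟩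
        0# + a′ j                  ≈⟨ +-identityˡ _ ⟩
        a′ j                       ∎
        where
        open SetoidReasoning setoid
        difference≈0 : combination (λ j → a j + - 1# * a′ j) ≈ᴹ 0ᴹ
        difference≈0 = ≈ᴹ-trans (combination-+ a _) (≈ᴹ-trans (+ᴹ-cong eq
          (≈ᴹ-trans (combination-* (- 1#) a′) (-1*ₗ _))) (-ᴹ‿inverseʳ _))

      coordinates-map : IsCoordinateMap coordinates
      coordinates-map = record
        { f-cong = λ {u} {v} u≈v → combination-injective _ _
            (≈ᴹ-trans (≈ᴹ-sym (coordinates-spec u)) (≈ᴹ-trans u≈v (coordinates-spec v)))
        ; f-+ = λ u v → combination-injective _ _ (≈ᴹ-trans (≈ᴹ-sym (coordinates-spec (u +ᴹ v)))
            (≈ᴹ-trans (+ᴹ-cong (coordinates-spec u) (coordinates-spec v)) (≈ᴹ-sym (combination-+ _ _))))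
        ; f-* = λ a v → combination-injective _ _ (≈ᴹ-trans (≈ᴹ-sym (coordinates-spec (a *ₗ v)))
            (≈ᴹ-trans (*ₗ-congˡ (coordinates-spec v)) (≈ᴹ-sym (combination-* a _))))
        }

      coordinates-injective : ∀ v → (∀ i → coordinates v i ≈ 0#) → v ≈ᴹ 0ᴹ
      coordinates-injective v h = ≈ᴹ-trans (coordinates-spec v)
        (vsum-0 (λ j → ≈ᴹ-trans (*ₗ-congʳ (h j)) (*ₗ-zeroˡ _)))

    prepend : ∀ {n} → Carrier → (Fin n → Carrier) → Fin (suc n) → Carrier
    prepend a a′ zero    = a
    prepend a a′ (suc j) = a′ j

    span-tabulate : ∀ {n} (e : Fin n → Vec) {v} → InSpan (tabulate e) v → ∃ λ (a : Fin n → Carrier) → v ≈ᴹ vsum (λ j → a j *ₗ e j)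
    span-tabulate {zero}  e v≈0 = (λ ()) , v≈0
    span-tabulate {suc n} e (a , u , u∈ , v≈) =
      let (a′ , u≈) = span-tabulate (λ j → e (suc j)) u∈ in prepend a a′ , ≈ᴹ-trans v≈ (+ᴹ-congˡ u≈)

    independent-tabulate : ∀ {n} (e : Fin n → Vec) →
      (∀ (a : Fin n → Carrier) → vsum (λ j → a j *ₗ e j) ≈ᴹ 0ᴹ → ∀ j → a j ≈ 0#) → Independent (tabulate e)
    independent-tabulate {zero}  e h = tt
    independent-tabulate {suc n} e h =
      (λ a u u∈ eq → let (a′ , u≈) = span-tabulate (λ j → e (suc j)) u∈ in
        h (prepend a a′) (≈ᴹ-trans (+ᴹ-congˡ (≈ᴹ-sym u≈)) eq) zero) ,
      independent-tabulate (λ j → e (suc j)) (λ a eq j →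
        h (prepend 0# a) (≈ᴹ-trans (+ᴹ-cong (*ₗ-zeroˡ (e zero)) eq) (+ᴹ-identityˡ _)) (suc j))

    -- Stated for ¬ ¬ injectivity since only the nonvanishing of a determinant is needed.
    injective⇒surjective : FinDimNonzero → ∀ T → ¬ ¬ (∀ v → app T v ≈ᴹ 0ᴹ → v ≈ᴹ 0ᴹ) → ∀ v → ∃ λ u → app T u ≈ᴹ v
    injective⇒surjective (n , _ , e , basis) T ¬¬injective v = inv δ *ₗ u , (begin
      app T (inv δ *ₗ u)       ≈⟨ End.*-hom T (inv δ) u ⟩
      inv δ *ₗ app T u         ≈⟨ *ₗ-congˡ (difference≈0ᴹ _ _ (coordinates-injective e basis _ cramer-v)) ⟨
      inv δ *ₗ (δ *ₗ v)        ≈⟨ *ₗ-assoc (inv δ) δ v ⟨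
      (inv δ * δ) *ₗ v         ≈⟨ *ₗ-congʳ (trans (*-comm _ _) (inverseʳ δ δ≉0)) ⟩
      1# *ₗ v                  ≈⟨ *ₗ-identityˡ v ⟩
      v                        ∎)
      where
      open SetoidReasoning ≈ᴹ-setoid
      κ = coordinates e basis
      κ-map = coordinates-map e basis
      f : Vec → Coordinates n
      f u = κ (app T u)
      f-map : IsCoordinateMap f
      f-map = record
        { f-cong = λ u≈v → IsCoordinateMap.f-cong κ-map (End.cong T u≈v)
        ; f-+ = λ u v i → trans (IsCoordinateMap.f-cong κ-map (End.+-hom T u v) i) (IsCoordinateMap.f-+ κ-map _ _ i)
        ; f-* = λ a v i → trans (IsCoordinateMap.f-cong κ-map (End.*-hom T a v) i) (IsCoordinateMap.f-* κ-map a _ i)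
        }
      es = tabulate e
      δ = det n (map f es)
      δ≉0 : ¬ (δ ≈ 0#)
      δ≉0 δ≈0 = ¬¬injective (λ injective → independent⇒completable f-map
        (λ u h → injective u (coordinates-injective e basis _ h)) es (independent-tabulate e (proj₂ basis))
        only-[])
        where
        -- The basis already has `n` vectors, so the empty list is the only completion, and its
        -- determinant is `δ`.
        only-[] : ∀ vs → length vs ℕ.+ length es ≡ n → det n (vs ++ map f es) ≈ 0#
        only-[] []       _ = δ≈0
        only-[] (_ ∷ vs) eq with () ← ℕ.m≢1+n+m n {length vs} (≡.sym (≡.trans
          (≡.cong (λ m → suc (length vs ℕ.+ m)) (≡.sym (List.length-tabulate e))) eq))
      -- Cramer's relation for the n + 1 vectors v, Te₁, ..., Teₙ reads δv - Tu = 0 with these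
      -- coefficients in `u`.
      χ : List Vec → Carrier
      χ r = det n (κ v ∷ map f r)
      u = VectorRemoval.removal (λ e r → χ r *ₗ e) es
      cramer-v : ∀ i → κ (δ *ₗ v +ᴹ -ᴹ app T u) i ≈ 0#
      cramer-v i = trans (IsCoordinateMap.f-+ κ-map _ _ i) (trans
        (+-cong (IsCoordinateMap.f-* κ-map δ v i) (trans (IsCoordinateMap.f-neg κ-map _ i)
          (-‿cong (trans (IsCoordinateMap.f-removal f-map χ es i)
            (reflexive (≡.sym (removal-map f (λ w r → det n (κ v ∷ r) * w i) es)))))))
        (cramer n (κ v ∷ map f es) i))

  -- The ring of endomorphisms

  module EndomorphismRing where
    open LinearAlgebra
    open AbelianGroupProperties +ᴹ-abelianGroup using () renaming (⁻¹-∙-comm to -ᴹ‿+ᴹ-comm)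
    open CommutativeSemigroupProperties (AbelianGroup.commutativeSemigroup +ᴹ-abelianGroup)
      using () renaming (interchange to +ᴹ-interchange)

    -- The alternating elements are given as bare maps, so linearity is established separately
    -- before they can enter the ring.
    record IsLinear (f : Op) : Set where
      field
        f-cong : ∀ {u v} → u ≈ᴹ v → f u ≈ᴹ f v
        f-+    : ∀ u v → f (u +ᴹ v) ≈ᴹ f u +ᴹ f v
        f-*    : ∀ c v → f (c *ₗ v) ≈ᴹ c *ₗ f v
    open IsLinear

    toEnd : (f : Op) → IsLinear f → End
    toEnd f l = record { app = f ; cong = f-cong l ; +-hom = f-+ l ; *-hom = f-* l }

    app-linear : ∀ T → IsLinear (app T)
    app-linear T = record { f-cong = End.cong T ; f-+ = End.+-hom T ; f-* = End.*-hom T }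

    ⊕-linear : ∀ {f g} → IsLinear f → IsLinear g → IsLinear (f ⊕ g)
    ⊕-linear p q = record
      { f-cong = λ eq → +ᴹ-cong (f-cong p eq) (f-cong q eq)
      ; f-+ = λ u v → ≈ᴹ-trans (+ᴹ-cong (f-+ p u v) (f-+ q u v)) (+ᴹ-interchange _ _ _ _)
      ; f-* = λ c v → ≈ᴹ-trans (+ᴹ-cong (f-* p c v) (f-* q c v)) (≈ᴹ-sym (*ₗ-distribˡ c _ _)) }

    negOp : Op → Op
    negOp f v = -ᴹ f v

    neg-linear : ∀ {f} → IsLinear f → IsLinear (negOp f)
    neg-linear p = record
      { f-cong = λ eq → -ᴹ‿cong (f-cong p eq)
      ; f-+ = λ u v → ≈ᴹ-trans (-ᴹ‿cong (f-+ p u v)) (≈ᴹ-sym (-ᴹ‿+ᴹ-comm _ _))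
      ; f-* = λ c v → ≈ᴹ-trans (-ᴹ‿cong (f-* p c v)) (≈ᴹ-sym (*ₗ-‿-ᴹ c _)) }

    ⊖-linear : ∀ {f g} → IsLinear f → IsLinear g → IsLinear (f ⊖ g)
    ⊖-linear p q = ⊕-linear p (neg-linear q)

    ⊙-linear : ∀ a {f} → IsLinear f → IsLinear (a ⊙ f)
    ⊙-linear a p = record
      { f-cong = λ eq → *ₗ-congˡ (f-cong p eq)
      ; f-+ = λ u v → ≈ᴹ-trans (*ₗ-congˡ (f-+ p u v)) (*ₗ-distribˡ a _ _)
      ; f-* = λ c v → ≈ᴹ-trans (*ₗ-congˡ (f-* p c v)) (≈ᴹ-trans (≈ᴹ-sym (*ₗ-assoc a c _))
          (≈ᴹ-trans (*ₗ-congʳ (*-comm a c)) (*ₗ-assoc c a _))) }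

    ∘-linear : ∀ {f g} → IsLinear f → IsLinear g → IsLinear (f ∘ₒ g)
    ∘-linear p q = record
      { f-cong = λ eq → f-cong p (f-cong q eq)
      ; f-+ = λ u v → ≈ᴹ-trans (f-cong p (f-+ q u v)) (f-+ p _ _)
      ; f-* = λ c v → ≈ᴹ-trans (f-cong p (f-* q c v)) (f-* p c _) }

    id-linear : IsLinear idₒ
    id-linear = record { f-cong = λ eq → eq ; f-+ = λ _ _ → ≈ᴹ-refl ; f-* = λ _ _ → ≈ᴹ-refl }

    0-linear : IsLinear 0ₒ
    0-linear = record
      { f-cong = λ _ → ≈ᴹ-refl ; f-+ = λ _ _ → ≈ᴹ-sym (+ᴹ-identityˡ _) ; f-* = λ c _ → ≈ᴹ-sym (*ₗ-zeroʳ c) }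

    opsum-linear : ∀ {n} {f : Fin n → Op} → (∀ j → IsLinear (f j)) → IsLinear (opsum f)
    opsum-linear {zero}  p = 0-linear
    opsum-linear {suc n} p = ⊕-linear (p zero) (opsum-linear (λ j → p (suc j)))

    endRing : Ring 0ℓ 0ℓ
    endRing = record
      { Carrier = End
      ; _≈_ = λ S T → ∀ v → app S v ≈ᴹ app T v
      ; _+_ = λ S T → toEnd (app S ⊕ app T) (⊕-linear (app-linear S) (app-linear T))
      ; _*_ = λ S T → toEnd (app S ∘ₒ app T) (∘-linear (app-linear S) (app-linear T))
      ; -_ = λ S → toEnd (negOp (app S)) (neg-linear (app-linear S))
      ; 0# = toEnd 0ₒ 0-linear
      ; 1# = toEnd idₒ id-linear
      ; isRing = record
        { +-isAbelianGroup = record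
          { isGroup = record
            { isMonoid = record
              { isSemigroup = record
                { isMagma = record
                  { isEquivalence = record
                    { refl = λ v → ≈ᴹ-refl ; sym = λ h v → ≈ᴹ-sym (h v) ; trans = λ h k v → ≈ᴹ-trans (h v) (k v) }
                  ; ∙-cong = λ h k v → +ᴹ-cong (h v) (k v) }
                ; assoc = λ S T U v → +ᴹ-assoc _ _ _ }
              ; identity = (λ S v → +ᴹ-identityˡ _) , (λ S v → +ᴹ-identityʳ _) }
            ; inverse = (λ S v → -ᴹ‿inverseˡ _) , (λ S v → -ᴹ‿inverseʳ _)
            ; ⁻¹-cong = λ h v → -ᴹ‿cong (h v) }
          ; comm = λ S T v → +ᴹ-comm _ _ }
        ; *-cong = λ {S} h k v → ≈ᴹ-trans (End.cong S (k v)) (h _)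
        ; *-assoc = λ S T U v → ≈ᴹ-refl
        ; *-identity = (λ S v → ≈ᴹ-refl) , (λ S v → ≈ᴹ-refl)
        ; distrib = (λ S T U v → End.+-hom S _ _) , (λ S T U v → ≈ᴹ-refl)
        }
      }

    module E = Ring endRing

    scalar : Carrier → End
    scalar a = toEnd (a ⊙ idₒ) (⊙-linear a id-linear)

    scalar-central : ∀ a T → scalar a E.* T E.≈ T E.* scalar a
    scalar-central a T v = ≈ᴹ-sym (End.*-hom T a v)

    scalar-1 : scalar 1# E.≈ E.1#
    scalar-1 v = *ₗ-identityˡ v

    scalar-+ : ∀ a a′ → scalar (a + a′) E.≈ scalar a E.+ scalar a′
    scalar-+ a a′ v = *ₗ-distribʳ v a a′

    scalar-neg : ∀ a → scalar (- a) E.≈ E.- scalar a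
    scalar-neg a v = -ᴹ-*ₗ a v

  -- Powers of an element that is not a root of unity

  module Powers
    (r r′ : Carrier) (r*r′≈1 : r * r′ ≈ 1#) (r-not-root : ∀ n → ¬ (pow r (suc n) ≈ 1#)) where
    open CommutativeSemigroupProperties *-commutativeSemigroup using () renaming (interchange to *-interchange)
    open SetoidReasoning setoid

    *-cancel : ∀ {x y z} → ¬ (x ≈ 0#) → x * y ≈ x * z → y ≈ z
    *-cancel {x} {y} {z} x≉0 h = begin
      y                    ≈⟨ x⁻¹*x*y≈y y ⟨
      inv x * (x * y)      ≈⟨ *-congˡ h ⟩
      inv x * (x * z)      ≈⟨ x⁻¹*x*y≈y z ⟩
      z                    ∎
      where
      x⁻¹*x*y≈y : ∀ y → inv x * (x * y) ≈ y
      x⁻¹*x*y≈y y = trans (sym (*-assoc _ _ _)) (trans (*-congʳ (trans (*-comm _ _) (inverseʳ x x≉0))) (*-identityˡ y))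

    *-nonzero : ∀ {x y} → ¬ (x ≈ 0#) → ¬ (y ≈ 0#) → ¬ (x * y ≈ 0#)
    *-nonzero x≉0 y≉0 h = y≉0 (*-cancel x≉0 (trans h (sym (zeroʳ _))))

    pow-+ : ∀ x m n → pow x (m ℕ.+ n) ≈ pow x m * pow x n
    pow-+ x zero    n = sym (*-identityˡ _)
    pow-+ x (suc m) n = trans (*-congˡ (pow-+ x m n)) (sym (*-assoc _ _ _))

    pow-inverse : ∀ n → pow r n * pow r′ n ≈ 1#
    pow-inverse zero    = *-identityˡ _
    pow-inverse (suc n) = trans (*-interchange _ _ _ _) (trans (*-cong r*r′≈1 (pow-inverse n)) (*-identityˡ _))

    r′-not-root : ∀ n → ¬ (pow r′ (suc n) ≈ 1#)
    r′-not-root n h = r-not-root n (trans (sym (*-identityʳ _)) (trans (*-congˡ (sym h)) (pow-inverse (suc n))))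

    pow-nonzero : ∀ n → ¬ (pow r n ≈ 0#)
    pow-nonzero n h = 1≉0 (trans (sym (pow-inverse n)) (trans (*-congʳ h) (zeroˡ _)))

    private
      pow-injective-< : ∀ m k → ¬ (pow r (m ℕ.+ suc k) ≈ pow r m)
      pow-injective-< m k h = r-not-root k (*-cancel (pow-nonzero m)
        (trans (sym (pow-+ r m (suc k))) (trans h (sym (*-identityʳ _)))))

    pow-injective : ∀ m n → pow r m ≈ pow r n → m ≡ n
    pow-injective m n h with ℕ.<-cmp m n
    ... | tri≈ _ eq _ = eq
    ... | tri< m<n _ _ with ℕ.m≤n⇒∃[o]m+o≡n m<n
    ...   | k , ≡.refl = ⊥-elim (pow-injective-< m k (trans (reflexive (≡.cong (pow r) (ℕ.+-suc m k))) (sym h)))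
    pow-injective m n h | tri> _ _ n<m with ℕ.m≤n⇒∃[o]m+o≡n n<m
    ...   | k , ≡.refl = ⊥-elim (pow-injective-< n k (trans (reflexive (≡.cong (pow r) (ℕ.+-suc n k))) h))

  -- The alternating elements as endomorphisms

  module AlternatingOperators
    (b : Carrier) (b≉0 : ¬ (b ≈ 0#)) (b-not-root : ∀ n → ¬ (pow b (suc n) ≈ 1#))
    (A A* : End) where
    open LinearAlgebra
    open EndomorphismRing
    open Alternating b (app A) (app A*)
    open RingProperties ring using (-‿distribˡ-*; -‿involutive)

    record LinearAlt (a : Alt) : Set where
      field
        Wneg-linear : IsLinear (Alt.Wneg a)
        Wpos-linear : IsLinear (Alt.Wpos a)
        G-linear    : IsLinear (Alt.G a)
        Gt-linear   : IsLinear (Alt.Gt a)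
    open LinearAlt

    step-linear : ∀ n h → (∀ j → LinearAlt (h j)) → LinearAlt (step n h)
    step-linear n h p = record
      { Wneg-linear = ⊙-linear _ (⊖-linear (⊙-linear b (∘-linear A-linear G-lin)) (∘-linear G-lin A-linear))
      ; Wpos-linear = ⊙-linear _ (⊖-linear (⊙-linear b (∘-linear G-lin A*-linear)) (∘-linear A*-linear G-lin))
      ; G-linear = G-lin
      ; Gt-linear = ⊕-linear G-lin (⊙-linear _ (⊖-linear (∘-linear A-linear W-linear) (∘-linear W-linear A-linear))) }
      where
      A-linear = app-linear A
      A*-linear = app-linear A*
      W-linear = Wpos-linear (p (fromℕ n))
      G-lin : IsLinear (Alt.G (step n h))
      G-lin = ⊕-linear
        (⊙-linear _ (⊖-linear
          (opsum-linear (λ k → ⊙-linear (pow bi (toℕ k)) (∘-linear (Wneg-linear (p k)) (Wpos-linear (p (opposite k))))))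
          (opsum-linear (λ j → ⊙-linear (pow bi (suc (toℕ j))) (∘-linear (G-linear (p (suc j))) (Gt-linear (p (opposite (inject₁ j)))))))))
        (⊙-linear _ (⊖-linear (∘-linear W-linear A-linear) (∘-linear A-linear W-linear)))

    table-linear : ∀ n j → LinearAlt (table n j)
    table-linear zero    j = record
      { Wneg-linear = app-linear A ; Wpos-linear = app-linear A* ; G-linear = id-linear ; Gt-linear = id-linear }
    table-linear (suc n) j with toℕ j ℕ.≟ suc n
    ... | yes _ = step-linear n (table n) (table-linear n)
    ... | no  p = table-linear n _

    entry-suc : ∀ n → entry (suc n) ≡ step n (table n)
    entry-suc n with toℕ (fromℕ (suc n)) ℕ.≟ suc n
    ... | yes _ = ≡.refl
    ... | no ¬p = ⊥-elim (¬p (Fin.toℕ-fromℕ (suc n)))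

    -- Older entries are copied unchanged into every later table, so the recursion may be read as
    -- one on sequences.
    table-entry : ∀ n j → table n j ≡ entry (toℕ j)
    table-entry zero    zero = ≡.refl
    table-entry (suc n) j with toℕ j ℕ.≟ suc n
    ... | yes eq = ≡.trans (≡.sym (entry-suc n)) (≡.cong entry (≡.sym eq))
    ... | no  p  = ≡.trans (table-entry n _) (≡.cong entry (Fin.toℕ-lower₁ j _))

    G H X Y : ℕ → End
    X n = toEnd (Wminus n) (Wneg-linear (table-linear n (fromℕ n)))
    Y n = toEnd (Wplus n) (Wpos-linear (table-linear n (fromℕ n)))
    G n = toEnd (Alt.G (entry n)) (G-linear (table-linear n (fromℕ n)))
    H n = toEnd (Alt.Gt (entry n)) (Gt-linear (table-linear n (fromℕ n)))

    b*bi≈1 : b * bi ≈ 1#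
    b*bi≈1 = inverseʳ b b≉0

    open Powers b bi b*bi≈1 b-not-root

    1-p≉0 : ∀ {p} → ¬ (p ≈ 1#) → ¬ (1# - p ≈ 0#)
    1-p≉0 p≉1 h = p≉1 (sym (AbelianGroupProperties.x∙y⁻¹≈ε⇒x≈y +-abelianGroup _ _ h))

    1-biⁿ≉0 : ∀ n → ¬ (1# - pow bi (suc n) ≈ 0#)
    1-biⁿ≉0 n = 1-p≉0 (r′-not-root n)

    1-bi≉0 : ¬ (1# - bi ≈ 0#)
    1-bi≉0 = 1-p≉0 (λ h → r′-not-root 0 (trans (*-identityʳ _) h))

    b-1≉0 : ¬ (b - 1# ≈ 0#)
    b-1≉0 h = b-not-root 0 (trans (*-identityʳ _) (AbelianGroupProperties.x∙y⁻¹≈ε⇒x≈y +-abelianGroup _ _ h))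

    -- 1 + b⁻ⁿ = 0 would give b²ⁿ = 1.
    1+biⁿ≉0 : ∀ n → ¬ (1# + pow bi (suc n) ≈ 0#)
    1+biⁿ≉0 n h = r′-not-root (n ℕ.+ suc n) (begin
      pow bi (suc n ℕ.+ suc n)   ≈⟨ pow-+ bi (suc n) (suc n) ⟩
      p * p                      ≈⟨ *-cong p≈-1 p≈-1 ⟩
      - 1# * - 1#                ≈⟨ -‿distribˡ-* 1# (- 1#) ⟨
      - (1# * - 1#)              ≈⟨ -‿cong (*-identityˡ _) ⟩
      - - 1#                     ≈⟨ -‿involutive 1# ⟩
      1#                         ∎)
      where
      open SetoidReasoning setoid
      p = pow bi (suc n)
      p≈-1 : p ≈ - 1#
      p≈-1 = AbelianGroupProperties.inverseʳ-unique +-abelianGroup 1# p h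

    -- Stated up to `≈` because factors such as 1 - cⁿ are built by the ring operations and are not
    -- literally of the form `scalar a`.
    scalar-invertible : ∀ {S T a a′} → S E.≈ scalar a → T E.≈ scalar a′ → a * a′ ≈ 1# → S E.* T E.≈ E.1#
    scalar-invertible {a = a} {a′} hS hT aa′≈1 v = begin
      _                 ≈⟨ hS _ ⟩
      a *ₗ _            ≈⟨ *ₗ-congˡ (hT v) ⟩
      a *ₗ (a′ *ₗ v)    ≈⟨ *ₗ-assoc a a′ v ⟨
      (a * a′) *ₗ v     ≈⟨ *ₗ-congʳ aa′≈1 ⟩
      1# *ₗ v           ≈⟨ *ₗ-identityˡ v ⟩
      v                 ∎
      where open SetoidReasoning ≈ᴹ-setoid

    bE cE : End
    bE = scalar b
    cE = scalar bi

    b-unit : CentralUnit endRing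
    b-unit = record { b = bE ; c = cE ; b-central = scalar-central b ; c-central = scalar-central bi
      ; bc≈1 = scalar-invertible {bE} {cE} (λ v → ≈ᴹ-refl) (λ v → ≈ᴹ-refl) b*bi≈1 }

    open AlternatingRelations endRing b-unit public
      using (conv; _⋆_; shift; serre; module FromRecursion)
    open LaurentSolver endRing b-unit using () renaming (pow to powE)

    pow-scalar : ∀ n → powE cE n E.≈ scalar (pow bi n)
    pow-scalar zero    v = ≈ᴹ-sym (scalar-1 v)
    pow-scalar (suc n) v = ≈ᴹ-trans (*ₗ-congˡ (pow-scalar n v)) (≈ᴹ-sym (*ₗ-assoc bi _ v))

    1-scalar : ∀ {S a} → S E.≈ scalar a → E.1# E.- S E.≈ scalar (1# - a)
    1-scalar {a = a} h v = ≈ᴹ-trans (+ᴹ-cong (≈ᴹ-sym (scalar-1 v))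
      (≈ᴹ-trans (-ᴹ‿cong (h v)) (≈ᴹ-sym (scalar-neg a v)))) (≈ᴹ-sym (scalar-+ 1# (- a) v))

    1+scalar : ∀ {S a} → S E.≈ scalar a → E.1# E.+ S E.≈ scalar (1# + a)
    1+scalar {a = a} h v = ≈ᴹ-trans (+ᴹ-cong (≈ᴹ-sym (scalar-1 v)) (h v)) (≈ᴹ-sym (scalar-+ 1# a v))

    b-1-scalar : bE E.- E.1# E.≈ scalar (b - 1#)
    b-1-scalar v = ≈ᴹ-trans (+ᴹ-congˡ (≈ᴹ-trans (-ᴹ‿cong (≈ᴹ-sym (scalar-1 v))) (≈ᴹ-sym (scalar-neg 1# v))))
      (≈ᴹ-sym (scalar-+ b (- 1#) v))

    opsum-cong : ∀ {n} (f g : Fin n → Op) v → (∀ j → f j v ≈ᴹ g j v) → opsum f v ≈ᴹ opsum g v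
    opsum-cong {zero}  f g v h = ≈ᴹ-refl
    opsum-cong {suc n} f g v h = +ᴹ-cong (h zero) (opsum-cong _ _ v (λ j → h (suc j)))

    opsum-⊙ : ∀ {n} a (f : Fin n → Op) v → opsum (λ j → a ⊙ f j) v ≈ᴹ a *ₗ opsum f v
    opsum-⊙ {zero}  a f v = ≈ᴹ-sym (*ₗ-zeroʳ a)
    opsum-⊙ {suc n} a f v = ≈ᴹ-trans (+ᴹ-congˡ (opsum-⊙ a (λ j → f (suc j)) v)) (≈ᴹ-sym (*ₗ-distribˡ a _ _))

    -- For `k` in `Fin n` the value of `opposite k` is n - 1 - k, which matches the convention k + j
    -- + 1 = n of `conv`.
    opsum-conv : ∀ n (t : ℕ → ℕ → End) v →
      opsum (λ (k : Fin n) → pow bi (toℕ k) ⊙ app (t (toℕ k) (toℕ (opposite k)))) v ≈ᴹ app (conv t n) v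
    opsum-conv zero    t v = ≈ᴹ-refl
    opsum-conv (suc n) t v = +ᴹ-cong
      (≈ᴹ-trans (*ₗ-identityˡ _) (≈ᴹ-reflexive (≡.cong (λ j → app (t 0 j) v) (Fin.toℕ-fromℕ n))))
      (begin
        opsum f v
          ≈⟨ opsum-cong f (λ k → bi ⊙ g k) v (λ k → ≈ᴹ-trans (*ₗ-assoc bi _ _) (*ₗ-congˡ (*ₗ-congˡ
               (≈ᴹ-reflexive (≡.cong (λ j → app (t (suc (toℕ k)) j) v) (Fin.toℕ-inject₁ (opposite k))))))) ⟩
        opsum (λ k → bi ⊙ g k) v
          ≈⟨ opsum-⊙ bi g v ⟩
        bi *ₗ opsum g v
          ≈⟨ *ₗ-congˡ (opsum-conv n (λ k → t (suc k)) v) ⟩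
        bi *ₗ app (conv (λ k → t (suc k)) n) v ∎)
      where
      open SetoidReasoning ≈ᴹ-setoid
      f g : Fin n → Op
      f k = (bi * pow bi (toℕ k)) ⊙ app (t (suc (toℕ k)) (toℕ (inject₁ (opposite k))))
      g k = pow bi (toℕ k) ⊙ app (t (suc (toℕ k)) (toℕ (opposite k)))

    opposite-inject₁ : ∀ {n} (j : Fin n) → toℕ (opposite (inject₁ j)) ≡ suc (toℕ (opposite j))
    opposite-inject₁ {suc n} zero    = ≡.refl
    opposite-inject₁ {suc n} (suc j) = ≡.trans (Fin.toℕ-inject₁ _)
      (≡.trans (opposite-inject₁ j) (≡.cong suc (≡.sym (Fin.toℕ-inject₁ _))))

    module _ (n : ℕ) (v : Vec) where
      open SetoidReasoning ≈ᴹ-setoid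

      private
        next : Alt
        next = step n (table n)

        f₁ f₁′ : Fin (suc n) → Op
        f₁ k  = pow bi (toℕ k) ⊙ (Alt.Wneg (table n k) ∘ₒ Alt.Wpos (table n (opposite k)))
        f₁′ k = pow bi (toℕ k) ⊙ app (X (toℕ k) E.* Y (toℕ (opposite k)))

        f₂ f₂′ : Fin n → Op
        f₂ j  = pow bi (suc (toℕ j)) ⊙ (Alt.G (table n (suc j)) ∘ₒ Alt.Gt (table n (opposite (inject₁ j))))
        f₂′ j = pow bi (toℕ j) ⊙ app (shift G (toℕ j) E.* shift H (toℕ (opposite j)))

      opsum-X⋆Y : opsum f₁ v ≈ᴹ app ((X ⋆ Y) (suc n)) v
      opsum-X⋆Y = ≈ᴹ-trans (opsum-cong f₁ f₁′ v (λ k → *ₗ-congˡ (≈ᴹ-reflexive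
          (≡.cong₂ (λ a a′ → Alt.Wneg a (Alt.Wpos a′ v)) (table-entry n k) (table-entry n (opposite k))))))
        (opsum-conv (suc n) (λ k j → X k E.* Y j) v)

      -- This sum starts at k = 1 and also omits the other end, hence one extra factor b⁻¹ and
      -- shifted sequences on both sides.
      opsum-G⋆H : opsum f₂ v ≈ᴹ app (cE E.* (shift G ⋆ shift H) n) v
      opsum-G⋆H = begin
        opsum f₂ v
          ≈⟨ opsum-cong f₂ (λ j → bi ⊙ f₂′ j) v (λ j → ≈ᴹ-trans (*ₗ-assoc bi _ _) (*ₗ-congˡ (*ₗ-congˡ (≈ᴹ-reflexive
               (≡.cong₂ (λ a a′ → Alt.G a (Alt.Gt a′ v)) (table-entry n (suc j))
                 (≡.trans (table-entry n (opposite (inject₁ j))) (≡.cong entry (opposite-inject₁ j)))))))) ⟩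
        opsum (λ j → bi ⊙ f₂′ j) v
          ≈⟨ opsum-⊙ bi f₂′ v ⟩
        bi *ₗ opsum f₂′ v
          ≈⟨ *ₗ-congˡ (opsum-conv n (λ k j → shift G k E.* shift H j) v) ⟩
        bi *ₗ app ((shift G ⋆ shift H) n) v ∎

      G-next : app (G (suc n)) v ≡ Alt.G next v
      G-next = ≡.cong (λ a → Alt.G a v) (entry-suc n)

    inv-1+ inv-1+1- : ℕ → End
    inv-1+ n   = scalar (inv (1# + pow bi (suc n)))
    inv-1+1- n = scalar (inv ((1# + pow bi (suc n)) * (1# - bi)))

    G-recursion : ∀ n → G (suc n) E.≈ inv-1+ n E.* ((X ⋆ Y) (suc n) E.- cE E.* (shift G ⋆ shift H) n)
      E.+ inv-1+1- n E.* (Y n E.* X 0 E.- X 0 E.* Y n)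
    G-recursion n v = ≈ᴹ-trans (≈ᴹ-reflexive (G-next n v))
      (+ᴹ-congʳ (*ₗ-congˡ (+ᴹ-cong (opsum-X⋆Y n v) (-ᴹ‿cong (opsum-G⋆H n v)))))

    H-recursion : ∀ n → H (suc n) E.≈ G (suc n) E.+ scalar (inv (1# - bi)) E.* (X 0 E.* Y n E.- Y n E.* X 0)
    H-recursion n v = ≈ᴹ-trans (≈ᴹ-reflexive (≡.cong (λ a → Alt.Gt a v) (entry-suc n)))
      (+ᴹ-congʳ (≈ᴹ-reflexive (≡.sym (G-next n v))))

    X-recursion : ∀ n → X (suc n) E.≈ scalar (inv (b - 1#)) E.* (bE E.* (X 0 E.* G (suc n)) E.- G (suc n) E.* X 0)
    X-recursion n v = ≈ᴹ-trans (≈ᴹ-reflexive (≡.cong (λ a → Alt.Wneg a v) (entry-suc n)))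
      (≈ᴹ-reflexive (≡.sym (≡.cong₂ (λ g g′ → inv (b - 1#) *ₗ (b *ₗ app A g +ᴹ -ᴹ g′))
        (G-next n v) (G-next n (app A v)))))

    Y-recursion : ∀ n → Y (suc n) E.≈ scalar (inv (b - 1#)) E.* (bE E.* (G (suc n) E.* Y 0) E.- Y 0 E.* G (suc n))
    Y-recursion n v = ≈ᴹ-trans (≈ᴹ-reflexive (≡.cong (λ a → Alt.Wpos a v) (entry-suc n)))
      (≈ᴹ-reflexive (≡.sym (≡.cong₂ (λ g g′ → inv (b - 1#) *ₗ (b *ₗ g +ᴹ -ᴹ app A* g′))
        (G-next n (app A* v)) (G-next n v))))

    module Relations (serre-xy : serre A A* E.≈ E.0#) (serre-yx : serre A* A E.≈ E.0#) =
      FromRecursion G H X Y (λ v → ≈ᴹ-refl) (λ v → ≈ᴹ-refl)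
        (scalar (inv (b - 1#))) (scalar (inv (1# - bi)))
        inv-1+ (λ n → scalar (inv (1# - pow bi (suc n)))) inv-1+1-
        (scalar-invertible {bE E.- E.1#} {scalar (inv (b - 1#))} b-1-scalar (λ v → ≈ᴹ-refl) (inverseʳ _ b-1≉0))
        (scalar-invertible {E.1# E.- cE} {scalar (inv (1# - bi))} (1-scalar {cE} (λ v → ≈ᴹ-refl)) (λ v → ≈ᴹ-refl) (inverseʳ _ 1-bi≉0))
        (λ n → scalar-invertible {scalar (inv (1# - pow bi (suc n)))} {E.1# E.- powE cE (suc n)}
          (λ v → ≈ᴹ-refl) (1-scalar {powE cE (suc n)} (pow-scalar (suc n)))
          (trans (*-comm _ _) (inverseʳ _ (1-biⁿ≉0 n))))
        (λ n → scalar-invertible {inv-1+ n} {E.1# E.+ powE cE (suc n)}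
          (λ v → ≈ᴹ-refl) (1+scalar {powE cE (suc n)} (pow-scalar (suc n)))
          (trans (*-comm _ _) (inverseʳ _ (1+biⁿ≉0 n))))
        (λ n → scalar-invertible {E.1# E.+ powE cE (suc n)} {inv-1+ n}
          (1+scalar {powE cE (suc n)} (pow-scalar (suc n))) (λ v → ≈ᴹ-refl)
          (inverseʳ _ (1+biⁿ≉0 n)))
        (λ n → scalar-invertible {E.1# E.+ powE cE (suc n)} {(E.1# E.- cE) E.* inv-1+1- n}
          (1+scalar {powE cE (suc n)} (pow-scalar (suc n)))
          (λ v → ≈ᴹ-trans (1-scalar {cE} (λ v → ≈ᴹ-refl) _) (≈ᴹ-sym (*ₗ-assoc (1# - bi) (inv ((1# + pow bi (suc n)) * (1# - bi))) v)))
          (trans (sym (*-assoc _ _ _)) (inverseʳ _ (*-nonzero (1+biⁿ≉0 n) 1-bi≉0))))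
        G-recursion H-recursion X-recursion Y-recursion serre-xy serre-yx

  -- Eigenspace components of vectors and operators

  module Eigenspaces {d : ℕ} (A : End) (θ : Fin (suc d) → Carrier) (ordering : EigenOrdering A θ) where
    open LinearAlgebra
    open EndomorphismRing
    open AbelianGroupProperties +ᴹ-abelianGroup using () renaming (x∙y⁻¹≈ε⇒x≈y to difference≈0ᴹ)

    Index : Set
    Index = Fin (suc d)

    vsum-single : ∀ {n} (f : Fin n → Vec) i → (∀ j → ¬ (j ≡ i) → f j ≈ᴹ 0ᴹ) → vsum f ≈ᴹ f i
    vsum-single f zero    h = ≈ᴹ-trans (+ᴹ-congˡ (vsum-0 (λ j → h (suc j) (λ ())))) (+ᴹ-identityʳ _)
    vsum-single f (suc i) h = ≈ᴹ-trans (+ᴹ-cong (h zero (λ ()))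
      (vsum-single (λ j → f (suc j)) i (λ j j≢i → h (suc j) (λ eq → j≢i (Fin.suc-injective eq))))) (+ᴹ-identityˡ _)

    *ₗ-cancel : ∀ {a v} → ¬ (a ≈ 0#) → a *ₗ v ≈ᴹ 0ᴹ → v ≈ᴹ 0ᴹ
    *ₗ-cancel {a} {v} a≉0 h = begin
      v                    ≈⟨ *ₗ-identityˡ v ⟨
      1# *ₗ v              ≈⟨ *ₗ-congʳ (trans (*-comm _ _) (inverseʳ a a≉0)) ⟨
      (inv a * a) *ₗ v     ≈⟨ *ₗ-assoc _ _ _ ⟩
      inv a *ₗ (a *ₗ v)    ≈⟨ *ₗ-congˡ h ⟩
      inv a *ₗ 0ᴹ          ≈⟨ *ₗ-zeroʳ _ ⟩
      0ᴹ                   ∎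
      where open SetoidReasoning ≈ᴹ-setoid

    θ-distinct : ∀ {i j} → ¬ (i ≡ j) → ¬ (θ i - θ j ≈ 0#)
    θ-distinct {i} {j} i≢j h = i≢j (proj₁ ordering i j (AbelianGroupProperties.x∙y⁻¹≈ε⇒x≈y +-abelianGroup _ _ h))

    -- The primitive idempotent Eⱼ.
    comp : Index → Vec → Vec
    comp j v = proj₁ (proj₁ (proj₂ (proj₂ (proj₂ ordering))) v) j

    comp-eigen : ∀ j v → Eig A (θ j) (comp j v)
    comp-eigen j v = proj₁ (proj₂ (proj₁ (proj₂ (proj₂ (proj₂ ordering))) v)) j

    comp-sum : ∀ v → v ≈ᴹ vsum (λ j → comp j v)
    comp-sum v = proj₂ (proj₂ (proj₁ (proj₂ (proj₂ (proj₂ ordering))) v))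

    Eig-subspace : ∀ j → IsSubspace (Eig A (θ j))
    Eig-subspace j = proj₁ (proj₂ (proj₂ ordering)) j

    Eig-≈ : ∀ j {u v} → u ≈ᴹ v → Eig A (θ j) u → Eig A (θ j) v
    Eig-≈ j = proj₁ (Eig-subspace j)

    Eig-0 : ∀ j → Eig A (θ j) 0ᴹ
    Eig-0 j = proj₁ (proj₂ (Eig-subspace j))

    Eig-+ : ∀ j {u v} → Eig A (θ j) u → Eig A (θ j) v → Eig A (θ j) (u +ᴹ v)
    Eig-+ j = proj₁ (proj₂ (proj₂ (Eig-subspace j)))

    Eig-* : ∀ j c {v} → Eig A (θ j) v → Eig A (θ j) (c *ₗ v)
    Eig-* j = proj₂ (proj₂ (proj₂ (Eig-subspace j)))

    -- The components come from a choice that is not assumed linear, or even compatible with `≈ᴹ`.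
    -- Uniqueness supplies both, and the commutation with `A`.
    comp-unique : ∀ (f : Index → Vec) v → (∀ j → Eig A (θ j) (f j)) → v ≈ᴹ vsum f → ∀ j → comp j v ≈ᴹ f j
    comp-unique f v f-eigen v≈ j = difference≈0ᴹ _ _ (≈ᴹ-trans (+ᴹ-congˡ (≈ᴹ-sym (-1*ₗ (f j))))
      (proj₂ (proj₂ (proj₂ (proj₂ ordering))) (λ j → comp j v +ᴹ (- 1#) *ₗ f j)
        (λ j → Eig-+ j (comp-eigen j v) (Eig-* j (- 1#) (f-eigen j))) difference j))
      where
      difference : vsum (λ j → comp j v +ᴹ (- 1#) *ₗ f j) ≈ᴹ 0ᴹ
      difference = ≈ᴹ-trans (vsum-+ (λ j → comp j v) (λ j → (- 1#) *ₗ f j)) (≈ᴹ-trans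
        (+ᴹ-cong (≈ᴹ-sym (comp-sum v)) (≈ᴹ-trans (vsum-*ₗ (- 1#) f) (≈ᴹ-trans (-1*ₗ _) (-ᴹ‿cong (≈ᴹ-sym v≈)))))
        (-ᴹ‿inverseʳ v))

    comp-linear : ∀ j → IsLinear (comp j)
    comp-linear j = record
      { f-cong = λ {u} {v} u≈v → comp-unique (λ j → comp j v) u (λ j → comp-eigen j v) (≈ᴹ-trans u≈v (comp-sum v)) j
      ; f-+ = λ u v → comp-unique (λ j → comp j u +ᴹ comp j v) (u +ᴹ v) (λ j → Eig-+ j (comp-eigen j u) (comp-eigen j v))
          (≈ᴹ-trans (+ᴹ-cong (comp-sum u) (comp-sum v)) (≈ᴹ-sym (vsum-+ (λ j → comp j u) (λ j → comp j v)))) j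
      ; f-* = λ c v → comp-unique (λ j → c *ₗ comp j v) (c *ₗ v) (λ j → Eig-* j c (comp-eigen j v))
          (≈ᴹ-trans (*ₗ-congˡ (comp-sum v)) (≈ᴹ-sym (vsum-*ₗ c (λ j → comp j v)))) j
      }

    compE : Index → End
    compE j = toEnd (comp j) (comp-linear j)

    comp-cong : ∀ j {u v} → u ≈ᴹ v → comp j u ≈ᴹ comp j v
    comp-cong j = End.cong (compE j)

    comp-A : ∀ j v → comp j (app A v) ≈ᴹ θ j *ₗ comp j v
    comp-A j v = comp-unique (λ j → θ j *ₗ comp j v) (app A v) (λ j → Eig-* j (θ j) (comp-eigen j v))
      (≈ᴹ-trans (End.cong A (comp-sum v)) (≈ᴹ-trans (app-vsum A (λ j → comp j v)) (vsum-cong (λ j → comp-eigen j v)))) j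

    comp-other : ∀ {i j v} → Eig A (θ i) v → ¬ (j ≡ i) → comp j v ≈ᴹ 0ᴹ
    comp-other {i} {j} {v} v∈ j≢i = *ₗ-cancel (θ-distinct j≢i) (begin
      (θ j - θ i) *ₗ comp j v                     ≈⟨ *ₗ-distribʳ _ _ _ ⟩
      θ j *ₗ comp j v +ᴹ (- θ i) *ₗ comp j v      ≈⟨ +ᴹ-cong (≈ᴹ-trans (≈ᴹ-sym (comp-A j v))
                                                       (≈ᴹ-trans (comp-cong j v∈) (End.*-hom (compE j) (θ i) v)))
                                                       (-ᴹ-*ₗ (θ i) _) ⟩
      θ i *ₗ comp j v +ᴹ -ᴹ (θ i *ₗ comp j v)     ≈⟨ -ᴹ‿inverseʳ _ ⟩
      0ᴹ                                          ∎)
      where open SetoidReasoning ≈ᴹ-setoid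

    comp-own : ∀ {i v} → Eig A (θ i) v → comp i v ≈ᴹ v
    comp-own {i} {v} v∈ = ≈ᴹ-trans (≈ᴹ-sym (vsum-single (λ j → comp j v) i (λ j → comp-other v∈))) (≈ᴹ-sym (comp-sum v))

    comp-ext : ∀ {u v} → (∀ j → comp j u ≈ᴹ comp j v) → u ≈ᴹ v
    comp-ext {u} {v} h = ≈ᴹ-trans (comp-sum u) (≈ᴹ-trans (vsum-cong h) (≈ᴹ-sym (comp-sum v)))

    comp-zero : ∀ {v} → (∀ j → comp j v ≈ᴹ 0ᴹ) → v ≈ᴹ 0ᴹ
    comp-zero {v} h = ≈ᴹ-trans (comp-sum v) (vsum-0 h)

    comp-only⇒eigen : ∀ {i v} → (∀ j → ¬ (j ≡ i) → comp j v ≈ᴹ 0ᴹ) → Eig A (θ i) v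
    comp-only⇒eigen {i} {v} h = Eig-≈ i (≈ᴹ-sym (≈ᴹ-trans (comp-sum v) (vsum-single (λ j → comp j v) i h))) (comp-eigen i v)

    -- Sums of eigenspaces

    Supp : (Index → Set) → Sub
    Supp P v = ∀ j → ¬ P j → comp j v ≈ᴹ 0ᴹ

    Supp-≈ : ∀ {P u v} → u ≈ᴹ v → Supp P u → Supp P v
    Supp-≈ u≈v h j ¬p = ≈ᴹ-trans (comp-cong j (≈ᴹ-sym u≈v)) (h j ¬p)

    Supp-+ : ∀ {P u v} → Supp P u → Supp P v → Supp P (u +ᴹ v)
    Supp-+ h k j ¬p = ≈ᴹ-trans (End.+-hom (compE j) _ _) (≈ᴹ-trans (+ᴹ-cong (h j ¬p) (k j ¬p)) (+ᴹ-identityˡ _))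

    Supp-* : ∀ {P v} c → Supp P v → Supp P (c *ₗ v)
    Supp-* c h j ¬p = ≈ᴹ-trans (End.*-hom (compE j) c _) (≈ᴹ-trans (*ₗ-congˡ (h j ¬p)) (*ₗ-zeroʳ c))

    Supp-0 : ∀ {P} → Supp P 0ᴹ
    Supp-0 j _ = app-0 (compE j)

    Supp-neg : ∀ {P v} → Supp P v → Supp P (-ᴹ v)
    Supp-neg {v = v} h = Supp-≈ (-1*ₗ v) (Supp-* (- 1#) h)

    Supp-⊆ : ∀ {P Q : Index → Set} {v} → (∀ j → P j → Q j) → Supp P v → Supp Q v
    Supp-⊆ P⊆Q h j ¬q = h j (λ p → ¬q (P⊆Q j p))

    restrict : ∀ {P : Index → Set} → (∀ j → Dec (P j)) → (Index → Vec) → Index → Vec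
    restrict P? f j = if does (P? j) then f j else 0ᴹ

    proj : ∀ {P : Index → Set} → (∀ j → Dec (P j)) → Vec → Vec
    proj P? v = vsum (restrict P? (λ j → comp j v))

    comp-proj : ∀ {P : Index → Set} (P? : ∀ j → Dec (P j)) v j → comp j (proj P? v) ≈ᴹ restrict P? (λ j → comp j v) j
    comp-proj P? v = comp-unique (restrict P? (λ j → comp j v)) _ eigen ≈ᴹ-refl
      where
      eigen : ∀ j → Eig A (θ j) (restrict P? (λ j → comp j v) j)
      eigen j with P? j
      ... | yes _ = comp-eigen j v
      ... | no  _ = Eig-0 j

    comp-proj-in : ∀ {P : Index → Set} (P? : ∀ j → Dec (P j)) v {j} → P j → comp j (proj P? v) ≈ᴹ comp j v
    comp-proj-in P? v {j} p with P? j | comp-proj P? v j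
    ... | yes _ | eq = eq
    ... | no ¬p | _  = ⊥-elim (¬p p)

    proj-Supp : ∀ {P : Index → Set} (P? : ∀ j → Dec (P j)) v → Supp P (proj P? v)
    proj-Supp P? v j ¬p with P? j | comp-proj P? v j
    ... | yes p | _  = ⊥-elim (¬p p)
    ... | no _  | eq = eq

    proj-linear : ∀ {P : Index → Set} (P? : ∀ j → Dec (P j)) → IsLinear (proj P?)
    proj-linear P? = record
      { f-cong = λ {u} {v} u≈v → vsum-cong (λ j → restrict-cong (comps u) (comps v) j (comp-cong j u≈v))
      ; f-+ = λ u v → ≈ᴹ-trans
          (vsum-cong (λ j → restrict-+ (comps (u +ᴹ v)) (comps u) (comps v) j (End.+-hom (compE j) u v)))
          (vsum-+ (restrict P? (comps u)) (restrict P? (comps v)))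
      ; f-* = λ c v → ≈ᴹ-trans
          (vsum-cong (λ j → restrict-* (comps (c *ₗ v)) (comps v) c j (End.*-hom (compE j) c v)))
          (vsum-*ₗ c (restrict P? (comps v)))
      }
      where
      comps : Vec → Index → Vec
      comps v j = comp j v
      restrict-cong : ∀ (f g : Index → Vec) j → f j ≈ᴹ g j → restrict P? f j ≈ᴹ restrict P? g j
      restrict-cong _ _ j h with P? j
      ... | yes _ = h
      ... | no  _ = ≈ᴹ-refl
      restrict-+ : ∀ (f g h : Index → Vec) j → f j ≈ᴹ g j +ᴹ h j → restrict P? f j ≈ᴹ restrict P? g j +ᴹ restrict P? h j
      restrict-+ _ _ _ j h with P? j
      ... | yes _ = h
      ... | no  _ = ≈ᴹ-sym (+ᴹ-identityˡ _)
      restrict-* : ∀ (f g : Index → Vec) c j → f j ≈ᴹ c *ₗ g j → restrict P? f j ≈ᴹ c *ₗ restrict P? g j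
      restrict-* _ _ c j h with P? j
      ... | yes _ = h
      ... | no  _ = ≈ᴹ-sym (*ₗ-zeroʳ c)

    proj-id : ∀ {P : Index → Set} (P? : ∀ j → Dec (P j)) {v} → Supp P v → proj P? v ≈ᴹ v
    proj-id P? {v} h = comp-ext λ j → lemma j (P? j)
      where
      lemma : ∀ j → Dec _ → comp j (proj P? v) ≈ᴹ comp j v
      lemma j (yes p) = comp-proj-in P? v p
      lemma j (no ¬p) = ≈ᴹ-trans (proj-Supp P? v j ¬p) (≈ᴹ-sym (h j ¬p))

    proj-kernel : ∀ {P Q : Index → Set} (P? : ∀ j → Dec (P j)) {v} → (∀ j → ¬ P j → Q j) → proj P? v ≈ᴹ 0ᴹ → Supp Q v
    proj-kernel P? {v} P∨Q h j ¬q with P? j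
    ... | yes p = ≈ᴹ-trans (≈ᴹ-sym (comp-proj-in P? v p)) (≈ᴹ-trans (comp-cong j h) (app-0 (compE j)))
    ... | no ¬p = ⊥-elim (¬q (P∨Q j ¬p))

    RangeSum⇒Supp : ∀ {lo hi v} → RangeSum (λ j → Eig A (θ j)) lo hi v → Supp (λ j → lo ≤ toℕ j × toℕ j ≤ hi) v
    RangeSum⇒Supp {lo} {hi} {v} (f , f∈ , f≈0 , v≈) j ¬p = ≈ᴹ-trans (comp-unique f v eigen v≈ j) (f≈0 j ¬p)
      where
      eigen : ∀ j → Eig A (θ j) (f j)
      eigen j with (lo ℕ.≤? toℕ j) ×-dec (toℕ j ℕ.≤? hi)
      ... | yes (p , q) = f∈ j p q
      ... | no ¬p       = Eig-≈ j (≈ᴹ-sym (f≈0 j ¬p)) (Eig-0 j)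

    Supp⇒RangeSum : ∀ {lo hi v} → Supp (λ j → lo ≤ toℕ j × toℕ j ≤ hi) v → RangeSum (λ j → Eig A (θ j)) lo hi v
    Supp⇒RangeSum {v = v} h = (λ j → comp j v) , (λ j _ _ → comp-eigen j v) , h , comp-sum v

    -- Band structure of operators

    Adjacent : Index → Index → Set
    Adjacent i j = toℕ j ≤ suc (toℕ i) × toℕ i ≤ suc (toℕ j)

    adjacent? : ∀ i j → Dec (Adjacent i j)
    adjacent? i j = (toℕ j ℕ.≤? suc (toℕ i)) ×-dec (toℕ i ℕ.≤? suc (toℕ j))

    Tridiagonal : End → Set
    Tridiagonal T = ∀ i j → ¬ Adjacent i j → ∀ v → comp j (app T (comp i v)) ≈ᴹ 0ᴹ

    comp-app : ∀ T j v → comp j (app T v) ≈ᴹ vsum (λ i → comp j (app T (comp i v)))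
    comp-app T j v = ≈ᴹ-trans (comp-cong j (≈ᴹ-trans (End.cong T (comp-sum v)) (app-vsum T (λ i → comp i v)))) (app-vsum (compE j) (λ i → app T (comp i v)))

    blocks-zero : ∀ T → (∀ i j v → comp j (app T (comp i v)) ≈ᴹ 0ᴹ) → ∀ v → app T v ≈ᴹ 0ᴹ
    blocks-zero T h v = comp-zero (λ j → ≈ᴹ-trans (comp-app T j v) (vsum-0 (λ i → h i j v)))

    Tridiagonal-Supp : ∀ {T} → Tridiagonal T → ∀ {P Q : Index → Set} {v} →
      (∀ i j → P i → Adjacent i j → Q j) → Supp P v → Supp Q (app T v)
    Tridiagonal-Supp {T} tri {P} {Q} {v} step h j ¬q = ≈ᴹ-trans (comp-app T j v) (vsum-0 block)
      where
      block : ∀ i → comp j (app T (comp i v)) ≈ᴹ 0ᴹ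
      block i with adjacent? i j
      ... | no ¬adj = tri i j ¬adj v
      ... | yes adj = ≈ᴹ-trans (comp-cong j (≈ᴹ-trans (End.cong T (h i (λ p → ¬q (step i j p adj)))) (app-0 T))) (app-0 (compE j))

    commuting-Supp : ∀ T → (∀ v → app A (app T v) ≈ᴹ app T (app A v)) → ∀ {P v} → Supp P v → Supp P (app T v)
    commuting-Supp T commutes {P} {v} h j ¬p = ≈ᴹ-trans (comp-app T j v) (vsum-0 block)
      where
      block : ∀ i → comp j (app T (comp i v)) ≈ᴹ 0ᴹ
      block i with j Fin.≟ i
      ... | yes ≡.refl = ≈ᴹ-trans (comp-cong j (≈ᴹ-trans (End.cong T (h j ¬p)) (app-0 T))) (app-0 (compE j))
      ... | no j≢i = comp-other (≈ᴹ-trans (commutes _) (≈ᴹ-trans (End.cong T (comp-eigen i v)) (End.*-hom T _ _))) j≢i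

    -- The Serre expression with its middle coefficient 1 + b + b⁻¹ as one scalar. It is symmetric
    -- in b and b⁻¹, so the same expression serves the ratio b of `A` and the ratio b⁻¹ of A*.
    serreσ : Carrier → End → End
    serreσ σ T = ((A E.* A E.* A E.* T E.- scalar σ E.* (A E.* A E.* T E.* A))
      E.+ scalar σ E.* (A E.* T E.* A E.* A)) E.- T E.* A E.* A E.* A

    -- A factor `A` left of `T` acts on the component `j` as θⱼ, one right of `T` acts on `comp i v`
    -- as θᵢ. The factors `1#` record where each accumulated product starts.
    serre-block : ∀ σ T i j v → comp j (app (serreσ σ T) (comp i v)) ≈ᴹ
      (θ j * (θ j * (θ j * 1#)) - σ * (θ j * (θ j * (1# * θ i))) + σ * (θ j * (1# * θ i * θ i)) - 1# * θ i * θ i * θ i)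
        *ₗ comp j (app T (comp i v))
    serre-block σ T i j v = sum (sum (sum
        (left (left (left own)))
        (negative (scaled (left (left (T-scaled (A-scaled once)))))))
        (scaled (left (T-scaled (A-scaled (A-scaled once))))))
      (negative (T-scaled (A-scaled (A-scaled (A-scaled once)))))
      where
      u = comp i v
      w = comp j (app T u)
      once : u ≈ᴹ 1# *ₗ u
      once = ≈ᴹ-sym (*ₗ-identityˡ u)
      _∼_ : Vec → Carrier → Set
      x ∼ a = comp j x ≈ᴹ a *ₗ w
      sum : ∀ {x y a a′} → x ∼ a → y ∼ a′ → (x +ᴹ y) ∼ (a + a′)
      sum p q = ≈ᴹ-trans (End.+-hom (compE j) _ _) (≈ᴹ-trans (+ᴹ-cong p q) (≈ᴹ-sym (*ₗ-distribʳ w _ _)))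
      scaled : ∀ {x a c} → x ∼ a → (c *ₗ x) ∼ (c * a)
      scaled p = ≈ᴹ-trans (End.*-hom (compE j) _ _) (≈ᴹ-trans (*ₗ-congˡ p) (≈ᴹ-sym (*ₗ-assoc _ _ w)))
      negative : ∀ {x a} → x ∼ a → (-ᴹ x) ∼ (- a)
      negative p = ≈ᴹ-trans (app-neg (compE j) _) (≈ᴹ-trans (-ᴹ‿cong p) (≈ᴹ-sym (-ᴹ-*ₗ _ w)))
      left : ∀ {x a} → x ∼ a → app A x ∼ (θ j * a)
      left {x} p = ≈ᴹ-trans (comp-A j x) (≈ᴹ-trans (*ₗ-congˡ p) (≈ᴹ-sym (*ₗ-assoc _ _ w)))
      own : app T u ∼ 1#
      own = ≈ᴹ-sym (*ₗ-identityˡ w)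
      T-scaled : ∀ {x a} → x ≈ᴹ a *ₗ u → app T x ∼ a
      T-scaled p = ≈ᴹ-trans (comp-cong j (≈ᴹ-trans (End.cong T p) (End.*-hom T _ u))) (End.*-hom (compE j) _ _)
      A-scaled : ∀ {x a} → x ≈ᴹ a *ₗ u → app A x ≈ᴹ (a * θ i) *ₗ u
      A-scaled p = ≈ᴹ-trans (End.cong A p) (≈ᴹ-trans (End.*-hom A _ u) (≈ᴹ-trans (*ₗ-congˡ (comp-eigen i v)) (≈ᴹ-sym (*ₗ-assoc _ _ u))))

    -- The Serre relation for a geometric sequence of eigenvalues

    module Geometric (r r′ : Carrier) (r*r′≈1 : r * r′ ≈ 1#) (r-not-root : ∀ n → ¬ (pow r (suc n) ≈ 1#))
      (σ : Carrier) (σ≈1+r+r′ : σ ≈ 1# + r + r′)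
      (1≤d : 1 ≤ d) (geometric : ∀ (i : Fin d) → θ (suc i) ≈ r * θ (inject₁ i)) where
      open Powers r r′ r*r′≈1 r-not-root

      θ-pow : ∀ n j → toℕ j ≡ n → θ j ≈ pow r n * θ zero
      θ-pow zero    zero    _  = sym (*-identityˡ _)
      θ-pow (suc n) (suc i) eq = trans (geometric i) (trans
        (*-congˡ (θ-pow n (inject₁ i) (≡.trans (Fin.toℕ-inject₁ i) (ℕ.suc-injective eq)))) (sym (*-assoc _ _ _)))

      -- If θ₀ were 0, so would be θ_d, and as d ≥ 1 two different indices would share an
      -- eigenvalue.
      θ₀≉0 : ¬ (θ zero ≈ 0#)
      θ₀≉0 h = 0≢last (proj₁ ordering zero (fromℕ d) (trans h
        (sym (trans (θ-pow d (fromℕ d) (Fin.toℕ-fromℕ d)) (trans (*-congˡ h) (zeroʳ _))))))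
        where
        0≢last : ¬ (zero ≡ fromℕ d)
        0≢last eq = ℕ.<⇒≢ 1≤d (≡.trans (≡.cong toℕ eq) (Fin.toℕ-fromℕ d))

      θ-injective : ∀ {m n} → pow r m * θ zero ≈ pow r n * θ zero → m ≡ n
      θ-injective {m} {n} h = pow-injective m n (*-cancel θ₀≉0 (trans (*-comm _ _) (trans h (*-comm _ _))))

      r*θ≈θ⇒ : ∀ i j → r * θ i ≈ θ j → toℕ j ≡ suc (toℕ i)
      r*θ≈θ⇒ i j h = ≡.sym (θ-injective (trans (*-assoc _ _ _)
        (trans (*-congˡ (sym (θ-pow _ i ≡.refl))) (trans h (θ-pow _ j ≡.refl)))))

      θ-next : ∀ {i j} → toℕ j ≡ suc (toℕ i) → θ j ≈ r * θ i
      θ-next {i} {j} eq = trans (θ-pow _ j eq) (trans (*-assoc _ _ _) (*-congˡ (sym (θ-pow _ i ≡.refl))))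

      r′*r*x : ∀ x → r′ * (r * x) ≈ x
      r′*r*x x = trans (sym (*-assoc _ _ _)) (trans (*-congʳ (trans (*-comm _ _) r*r′≈1)) (*-identityˡ x))

      r*r′*x : ∀ x → r * (r′ * x) ≈ x
      r*r′*x x = trans (sym (*-assoc _ _ _)) (trans (*-congʳ r*r′≈1) (*-identityˡ x))

      factors : Index → Index → Carrier
      factors j i = (θ j - θ i) * ((θ j - r * θ i) * (θ j - r′ * θ i))

      difference≈0 : ∀ {x y} → x - y ≈ 0# → x ≈ y
      difference≈0 = AbelianGroupProperties.x∙y⁻¹≈ε⇒x≈y +-abelianGroup _ _

      -- Powers of r are distinct and θ₀ is nonzero, so θⱼ = rθᵢ forces j = i + 1 and θⱼ = r′θᵢ
      -- forces i = j + 1. Thus the product vanishes exactly on the three central diagonals.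
      factors-nonzero : ∀ i j → ¬ Adjacent i j → ¬ (factors j i ≈ 0#)
      factors-nonzero i j ¬adj = *-nonzero (θ-distinct (λ { ≡.refl → ¬adj (ℕ.n≤1+n _ , ℕ.n≤1+n _) }))
        (*-nonzero
          (λ h → ¬adj (after (r*θ≈θ⇒ i j (sym (difference≈0 h)))))
          (λ h → ¬adj (before (r*θ≈θ⇒ j i (trans (*-congˡ (difference≈0 h)) (r*r′*x _))))))
        where
        after : toℕ j ≡ suc (toℕ i) → Adjacent i j
        after eq rewrite eq = ℕ.≤-refl , ℕ.m≤n⇒m≤1+n (ℕ.n≤1+n _)
        before : toℕ i ≡ suc (toℕ j) → Adjacent i j
        before eq rewrite eq = ℕ.m≤n⇒m≤1+n (ℕ.n≤1+n _) , ℕ.≤-refl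

      factors-zero : ∀ i j → Adjacent i j → factors j i ≈ 0#
      factors-zero i j (j≤1+i , i≤1+j) with ℕ.<-cmp (toℕ i) (toℕ j)
      ... | tri≈ _ eq _ with ≡.refl ← Fin.toℕ-injective eq = trans (*-congʳ (-‿inverseʳ _)) (zeroˡ _)
      ... | tri< i<j _ _ = trans (*-congˡ (trans (*-congʳ (trans (+-congʳ (θ-next (ℕ.≤-antisym j≤1+i i<j))) (-‿inverseʳ _))) (zeroˡ _))) (zeroʳ _)
      ... | tri> _ _ j<i = trans (*-congˡ (trans (*-congˡ (trans (+-congʳ
        (trans (sym (r′*r*x _)) (*-congˡ (sym (θ-next (ℕ.≤-antisym i≤1+j j<i)))))) (-‿inverseʳ _))) (zeroʳ _))) (zeroʳ _)

      -- The field as a ring with central unit, so that the same solver handles scalar identities.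
      r-unit : CentralUnit ring
      r-unit = record { b = r ; c = r′ ; b-central = *-comm r ; c-central = *-comm r′ ; bc≈1 = r*r′≈1 }

      open AlternatingRelations ring r-unit using (linear-combination; _∙_)
      open LaurentSolver ring r-unit hiding (pow)

      factorization : ∀ t s → t * (t * (t * 1#)) - σ * (t * (t * (1# * s))) + σ * (t * (1# * s * s)) - 1# * s * s * s
        ≈ (t - s) * ((t - r * s) * (t - r′ * s))
      -- The solver knows no commutativity, so every exchange of `s` and `t` enters as a hypothesis.
      factorization t s = linear-combination
        (- 1# ∙ *-congʳ {t * (t * s)} σ≈1+r+r′
        ∷ 1# ∙ *-congʳ {t * (s * s)} σ≈1+r+r′
        ∷ r ∙ *-congˡ {t} (*-comm s t)
        ∷ 1# ∙ *-congʳ {t} (*-comm s t)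
        ∷ 1# ∙ *-congˡ {t} (*-comm s t)
        ∷ - r′ ∙ *-congʳ {s} (*-comm s t)
        ∷ - r ∙ *-congˡ {s} (*-comm s t)
        ∷ - r ∙ *-congʳ {s} (*-comm s t)
        ∷ [])
        (solve 3 (λ t s σ → let e = :1 :+ :b :+ :c in
          t :* (t :* (t :* :1)) :- σ :* (t :* (t :* (:1 :* s))) :+ σ :* (t :* (:1 :* s :* s)) :- :1 :* s :* s :* s
          := (t :- s) :* ((t :- :b :* s) :* (t :- :c :* s))
            :+ ((:- :1) :* (σ :* (t :* (t :* s)) :- e :* (t :* (t :* s)))
            :+ (:1 :* (σ :* (t :* (s :* s)) :- e :* (t :* (s :* s)))
            :+ (:b :* (t :* (s :* t) :- t :* (t :* s))
            :+ (:1 :* (s :* t :* t :- t :* s :* t)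
            :+ (:1 :* (t :* (s :* t) :- t :* (t :* s))
            :+ ((:- :c) :* (s :* t :* s :- t :* s :* s)
            :+ ((:- :b) :* (s :* (s :* t) :- s :* (t :* s))
            :+ ((:- :b) :* (s :* t :* s :- t :* s :* s) :+ :0)))))))))
          (t ∷ᵛ s ∷ᵛ σ ∷ᵛ []ᵛ) ≡.refl)

      serre-block′ : ∀ T i j v → comp j (app (serreσ σ T) (comp i v)) ≈ᴹ factors j i *ₗ comp j (app T (comp i v))
      serre-block′ T i j v = ≈ᴹ-trans (serre-block σ T i j v) (*ₗ-congʳ (factorization (θ j) (θ i)))

      tridiagonal⇒serre : ∀ T → Tridiagonal T → ∀ v → app (serreσ σ T) v ≈ᴹ 0ᴹ
      tridiagonal⇒serre T tri = blocks-zero (serreσ σ T) block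
        where
        block : ∀ i j v → comp j (app (serreσ σ T) (comp i v)) ≈ᴹ 0ᴹ
        block i j v with adjacent? i j
        ... | yes adj = ≈ᴹ-trans (serre-block′ T i j v) (≈ᴹ-trans (*ₗ-congʳ (factors-zero i j adj)) (*ₗ-zeroˡ _))
        ... | no ¬adj = ≈ᴹ-trans (serre-block′ T i j v) (≈ᴹ-trans (*ₗ-congˡ (tri i j ¬adj v)) (*ₗ-zeroʳ _))

      -- Passing to the commutator multiplies a block by θⱼ - θᵢ. Off the central diagonals this and
      -- the Serre factors are nonzero, so the block of `T` itself must vanish.
      serre-commutator⇒tridiagonal : ∀ T → (∀ v → app (serreσ σ (A E.* T E.- T E.* A)) v ≈ᴹ 0ᴹ) → Tridiagonal T
      serre-commutator⇒tridiagonal T h i j ¬adj v = *ₗ-cancel (θ-distinct j≢i) (*ₗ-cancel (factors-nonzero i j ¬adj) (begin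
        factors j i *ₗ ((θ j - θ i) *ₗ w)                                  ≈⟨ *ₗ-congˡ commutator-block ⟨
        factors j i *ₗ comp j (app (A E.* T E.- T E.* A) u)                ≈⟨ serre-block′ (A E.* T E.- T E.* A) i j v ⟨
        comp j (app (serreσ σ (A E.* T E.- T E.* A)) u)                    ≈⟨ comp-cong j (h u) ⟩
        comp j 0ᴹ                                                          ≈⟨ app-0 (compE j) ⟩
        0ᴹ                                                                 ∎))
        where
        open SetoidReasoning ≈ᴹ-setoid
        u = comp i v
        w = comp j (app T u)
        j≢i : ¬ (j ≡ i)
        j≢i ≡.refl = ¬adj (ℕ.n≤1+n _ , ℕ.n≤1+n _)
        commutator-block : comp j (app (A E.* T E.- T E.* A) u) ≈ᴹ (θ j - θ i) *ₗ w
        commutator-block = begin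
          comp j (app A (app T u) +ᴹ -ᴹ app T (app A u))       ≈⟨ End.+-hom (compE j) _ _ ⟩
          comp j (app A (app T u)) +ᴹ comp j (-ᴹ app T (app A u))
            ≈⟨ +ᴹ-cong (comp-A j _) (≈ᴹ-trans (app-neg (compE j) _) (-ᴹ‿cong (comp-cong j
                 (≈ᴹ-trans (End.cong T (comp-eigen i v)) (End.*-hom T _ u))))) ⟩
          θ j *ₗ w +ᴹ -ᴹ comp j (θ i *ₗ app T u)
            ≈⟨ +ᴹ-congˡ (≈ᴹ-trans (-ᴹ‿cong (End.*-hom (compE j) _ _)) (≈ᴹ-sym (-ᴹ-*ₗ _ w))) ⟩
          θ j *ₗ w +ᴹ (- θ i) *ₗ w                             ≈⟨ *ₗ-distribʳ w _ _ ⟨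
          (θ j - θ i) *ₗ w                                     ∎

  -- Neighbouring subspaces in a sequence

  module Bands {d : ℕ} (S : Fin (suc d) → Sub) where

    ext-in : ∀ j {v} → S j v → ext S (toℕ j) v
    ext-in j {v} h with toℕ j ℕ.<? suc d
    ... | yes p = ≡.subst (λ j → S j v) (≡.sym (Fin.fromℕ<-toℕ j p)) h
    ... | no ¬p = ⊥-elim (¬p (Fin.toℕ<n j))

    ext-zero : ∀ {n v} → ¬ (n < suc d) → v ≈ᴹ 0ᴹ → ext S n v
    ext-zero {n} n≮ h with n ℕ.<? suc d
    ... | yes p = ⊥-elim (n≮ p)
    ... | no _  = h

    ext-out : ∀ n {v} → ext S n v → (∃ λ j → toℕ j ≡ n × S j v) ⊎ v ≈ᴹ 0ᴹ
    ext-out n h with n ℕ.<? suc d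
    ... | yes p = inj₁ (Fin.fromℕ< p , Fin.toℕ-fromℕ< p , h)
    ... | no _  = inj₂ h

    Prev-in : ∀ i j {v} → suc (toℕ j) ≡ toℕ i → S j v → Prev S i v
    Prev-in i j eq h with toℕ i | eq
    ... | suc m | ≡.refl = ext-in j h

    Prev-zero : ∀ i {v} → toℕ i ≡ 0 → v ≈ᴹ 0ᴹ → Prev S i v
    Prev-zero i eq h with toℕ i | eq
    ... | zero | ≡.refl = h

    Prev-out : ∀ i {v} → Prev S i v → (∃ λ j → suc (toℕ j) ≡ toℕ i × S j v) ⊎ v ≈ᴹ 0ᴹ
    Prev-out i h with toℕ i
    ... | zero  = inj₂ h
    ... | suc m with ext-out m h
    ...   | inj₁ (j , eq , p) = inj₁ (j , ≡.cong suc eq , p)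
    ...   | inj₂ v≈0          = inj₂ v≈0

    Next-in : ∀ i j {v} → toℕ j ≡ suc (toℕ i) → S j v → Next S i v
    Next-in i j {v} eq h = ≡.subst (λ n → ext S n v) eq (ext-in j h)

    Next-zero : ∀ i {v} → ¬ (toℕ i < d) → v ≈ᴹ 0ᴹ → Next S i v
    Next-zero i i≮d = ext-zero (λ { (s≤s i<d) → i≮d i<d })

    Next-out : ∀ i {v} → Next S i v → (∃ λ j → toℕ j ≡ suc (toℕ i) × S j v) ⊎ v ≈ᴹ 0ᴹ
    Next-out i = ext-out (suc (toℕ i))

  -- Tridiagonal action expressed through neighbouring eigenspaces

  module EigenBands {d : ℕ} (A : End) (θ : Fin (suc d) → Carrier) (ordering : EigenOrdering A θ) where
    open LinearAlgebra
    open EndomorphismRing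
    open Eigenspaces A θ ordering
    open Bands (λ j → Eig A (θ j))

    Tri : Index → Sub
    Tri i = (Prev (λ j → Eig A (θ j)) i +ₛ Eig A (θ i)) +ₛ Next (λ j → Eig A (θ j)) i

    remove-Supp : ∀ {P Q : Index → Set} (Q? : ∀ j → Dec (Q j)) {v} → Supp P v → Supp (λ j → P j × ¬ Q j) (v +ᴹ -ᴹ proj Q? v)
    remove-Supp Q? {v} h j ¬pq = ≈ᴹ-trans (End.+-hom (compE j) _ _) (≈ᴹ-trans (+ᴹ-congˡ (app-neg (compE j) _)) (vanish (Q? j)))
      where
      vanish : Dec _ → comp j v +ᴹ -ᴹ comp j (proj Q? v) ≈ᴹ 0ᴹ
      vanish (yes q) = ≈ᴹ-trans (+ᴹ-congˡ (-ᴹ‿cong (comp-proj-in Q? v q))) (-ᴹ‿inverseʳ _)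
      vanish (no ¬q) = ≈ᴹ-trans (+ᴹ-cong (h j (λ p → ¬pq (p , ¬q))) (-ᴹ‿cong (proj-Supp Q? v j ¬q))) (-ᴹ‿inverseʳ _)

    Supp⇒Prev : ∀ i {v} → Supp (λ j → suc (toℕ j) ≡ toℕ i) v → Prev (λ j → Eig A (θ j)) i v
    Supp⇒Prev zero    h = Prev-zero zero ≡.refl (comp-zero (λ j → h j (λ ())))
    Supp⇒Prev (suc i) h = Prev-in (suc i) (inject₁ i) (≡.cong suc (Fin.toℕ-inject₁ i))
      (comp-only⇒eigen (λ j j≢ → h j (λ eq → j≢ (Fin.toℕ-injective (≡.trans (ℕ.suc-injective eq) (≡.sym (Fin.toℕ-inject₁ i)))))))

    Supp⇒Next : ∀ i {v} → Supp (λ j → toℕ j ≡ suc (toℕ i)) v → Next (λ j → Eig A (θ j)) i v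
    Supp⇒Next i {v} h with toℕ i ℕ.<? d
    ... | yes i<d = Next-in i k toℕ-k (comp-only⇒eigen (λ j j≢ → h j (λ eq → j≢ (Fin.toℕ-injective (≡.trans eq (≡.sym toℕ-k))))))
      where
      k = Fin.fromℕ< (s≤s i<d)
      toℕ-k : toℕ k ≡ suc (toℕ i)
      toℕ-k = Fin.toℕ-fromℕ< (s≤s i<d)
    ... | no i≮d = Next-zero i i≮d (comp-zero (λ j → h j (λ eq → i≮d (ℕ.≤-pred (≡.subst (ℕ._< suc d) eq (Fin.toℕ<n j))))))

    -- Project off the lower neighbour, then the upper one; what remains has only the component `i`.
    Supp⇒Tri : ∀ i {v} → Supp (Adjacent i) v → Tri i v
    Supp⇒Tri i {v} h = p +ᴹ m , n , (p , m , Supp⇒Prev i (proj-Supp prev? v) , eigen , ≈ᴹ-refl) ,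
      Supp⇒Next i (proj-Supp next? v′) , (begin
        v                        ≈⟨ sub-add v p ⟨
        p +ᴹ v′                  ≈⟨ +ᴹ-congˡ (≈ᴹ-trans (+ᴹ-comm m n) (sub-add v′ n)) ⟨
        p +ᴹ (m +ᴹ n)            ≈⟨ +ᴹ-assoc p m n ⟨
        p +ᴹ m +ᴹ n              ∎)
      where
      open SetoidReasoning ≈ᴹ-setoid
      sub-add : ∀ u w → w +ᴹ (u +ᴹ -ᴹ w) ≈ᴹ u
      sub-add u w = ≈ᴹ-trans (+ᴹ-comm w _) (≈ᴹ-trans (+ᴹ-assoc u (-ᴹ w) w) (≈ᴹ-trans (+ᴹ-congˡ (-ᴹ‿inverseˡ w)) (+ᴹ-identityʳ u)))
      prev? : ∀ j → Dec (suc (toℕ j) ≡ toℕ i)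
      prev? j = suc (toℕ j) ℕ.≟ toℕ i
      next? : ∀ j → Dec (toℕ j ≡ suc (toℕ i))
      next? j = toℕ j ℕ.≟ suc (toℕ i)
      p v′ n m : Vec
      p  = proj prev? v
      v′ = v +ᴹ -ᴹ p
      n  = proj next? v′
      m  = v′ +ᴹ -ᴹ n
      only : ∀ j → (Adjacent i j × ¬ (suc (toℕ j) ≡ toℕ i)) × ¬ (toℕ j ≡ suc (toℕ i)) → j ≡ i
      only j (((j≤ , i≤) , ¬prev) , ¬next) = Fin.toℕ-injective (ℕ.≤-antisym
        (ℕ.≤-pred (ℕ.≤∧≢⇒< j≤ ¬next)) (ℕ.≤-pred (ℕ.≤∧≢⇒< i≤ (λ eq → ¬prev (≡.sym eq)))))
      eigen : Eig A (θ i) m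
      eigen = comp-only⇒eigen (λ j j≢i → remove-Supp next? (remove-Supp prev? h) j (λ q → j≢i (only j q)))

    Tri⇒Tridiagonal : ∀ T → (∀ i → MapsInto (app T) (Eig A (θ i)) (Tri i)) → Tridiagonal T
    Tri⇒Tridiagonal T h i j ¬adj v with h i (comp i v) (comp-eigen i v)
    ... | x , n , (p , m , p∈ , m∈ , x≈) , n∈ , Tv≈ = begin
      comp j (app T (comp i v))                 ≈⟨ comp-cong j (≈ᴹ-trans Tv≈ (+ᴹ-congʳ x≈)) ⟩
      comp j (p +ᴹ m +ᴹ n)                      ≈⟨ ≈ᴹ-trans (End.+-hom (compE j) _ _) (+ᴹ-congʳ (End.+-hom (compE j) _ _)) ⟩
      comp j p +ᴹ comp j m +ᴹ comp j n          ≈⟨ +ᴹ-cong (+ᴹ-cong (prev-zero (Prev-out i p∈))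
                                                      (comp-other m∈ (λ { ≡.refl → ¬adj (ℕ.n≤1+n _ , ℕ.n≤1+n _) })))
                                                      (next-zero (Next-out i n∈)) ⟩
      0ᴹ +ᴹ 0ᴹ +ᴹ 0ᴹ                            ≈⟨ ≈ᴹ-trans (+ᴹ-identityʳ _) (+ᴹ-identityʳ _) ⟩
      0ᴹ                                        ∎
      where
      open SetoidReasoning ≈ᴹ-setoid
      prev-zero : (∃ λ k → suc (toℕ k) ≡ toℕ i × Eig A (θ k) p) ⊎ p ≈ᴹ 0ᴹ → comp j p ≈ᴹ 0ᴹ
      prev-zero (inj₂ p≈0) = ≈ᴹ-trans (comp-cong j p≈0) (app-0 (compE j))
      prev-zero (inj₁ (k , eq , p∈)) = comp-other p∈ λ { ≡.refl →
        ¬adj (ℕ.≤-trans (ℕ.n≤1+n _) (ℕ.≤-trans (ℕ.≤-reflexive eq) (ℕ.n≤1+n _)) , ℕ.≤-reflexive (≡.sym eq)) }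
      next-zero : (∃ λ k → toℕ k ≡ suc (toℕ i) × Eig A (θ k) n) ⊎ n ≈ᴹ 0ᴹ → comp j n ≈ᴹ 0ᴹ
      next-zero (inj₂ n≈0) = ≈ᴹ-trans (comp-cong j n≈0) (app-0 (compE j))
      next-zero (inj₁ (k , eq , n∈)) = comp-other n∈ λ { ≡.refl →
        ¬adj (ℕ.≤-reflexive eq , ℕ.≤-trans (ℕ.n≤1+n _) (ℕ.≤-trans (ℕ.≤-reflexive (≡.sym eq)) (ℕ.n≤1+n _))) }

    Tridiagonal⇒Tri : ∀ {T} → Tridiagonal T → ∀ i → MapsInto (app T) (Eig A (θ i)) (Tri i)
    Tridiagonal⇒Tri {T} tri i v v∈ = Supp⇒Tri i (Tridiagonal-Supp {T} tri {P = λ j → j ≡ i}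
      (λ { _ j ≡.refl adj → adj }) (λ j j≢i → comp-other v∈ j≢i))

  -- Split decompositions

  module SplitDecomposition
    {d : ℕ} (A A* : End) (θ θ* : Fin (suc d) → Carrier)
    (ordering : EigenOrdering A θ) (ordering* : EigenOrdering A* θ*)
    (A*-tridiagonal : Eigenspaces.Tridiagonal A θ ordering A*)
    (A-tridiagonal : Eigenspaces.Tridiagonal A* θ* ordering* A)
    (irreducible : ¬ (Σ Sub λ W → IsSubspace W × MapsInto (app A) W W × MapsInto (app A*) W W ×
      ¬ (W ⊆ 0ₛ) × ¬ (Vₛ ⊆ W)))
    (finDim : FinDimNonzero) where
    open LinearAlgebra
    open EndomorphismRing
    open AbelianGroupProperties +ᴹ-abelianGroup using () renaming (x∙y⁻¹≈ε⇒x≈y to difference≈0ᴹ)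
    module E₁ = Eigenspaces A θ ordering
    module E* = Eigenspaces A* θ* ordering*

    sub-add : ∀ u w → u ≈ᴹ (u +ᴹ -ᴹ w) +ᴹ w
    sub-add u w = ≈ᴹ-sym (≈ᴹ-trans (+ᴹ-assoc u (-ᴹ w) w) (≈ᴹ-trans (+ᴹ-congˡ (-ᴹ‿inverseˡ w)) (+ᴹ-identityʳ u)))

    module Lowering (A : End) (θ : Fin (suc d) → Carrier) (ordering : EigenOrdering A θ) (R : Ranking d) where
      open Eigenspaces A θ ordering
      open Ranking R

      -- Ranks are injective, so A - θᵢ removes the only component of rank `n` and rescales the
      -- others.
      lower : ∀ {n v} i → rank i ≡ n → Supp (λ j → rank j ≤ n) v → Supp (λ j → rank j < n) (app A v +ᴹ (- θ i) *ₗ v)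
      lower {n} {v} i eq h j j≮n = begin
        comp j (app A v +ᴹ (- θ i) *ₗ v)
          ≈⟨ ≈ᴹ-trans (End.+-hom (compE j) _ _) (+ᴹ-cong (comp-A j v) (End.*-hom (compE j) _ _)) ⟩
        θ j *ₗ comp j v +ᴹ (- θ i) *ₗ comp j v
          ≈⟨ *ₗ-distribʳ _ _ _ ⟨
        (θ j - θ i) *ₗ comp j v
          ≈⟨ vanish ⟩
        0ᴹ ∎
        where
        open SetoidReasoning ≈ᴹ-setoid
        vanish : (θ j - θ i) *ₗ comp j v ≈ᴹ 0ᴹ
        vanish with rank j ℕ.≟ n
        ... | yes eq′ with ≡.refl ← rank-injective (≡.trans eq′ (≡.sym eq)) = ≈ᴹ-trans (*ₗ-congʳ (-‿inverseʳ _)) (*ₗ-zeroˡ _)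
        ... | no neq = ≈ᴹ-trans (*ₗ-congˡ (h j (λ j≤n → j≮n (ℕ.≤∧≢⇒< j≤n neq)))) (*ₗ-zeroʳ _)

      raise : ∀ {n v} T → Tridiagonal T → Supp (λ j → rank j ≤ n) v → Supp (λ j → rank j ≤ suc n) (app T v)
      raise T tri = Tridiagonal-Supp {T} tri (λ i j i≤n adj →
        ℕ.≤-trans (rank-adjacent i j (proj₁ adj) (proj₂ adj)) (s≤s i≤n))

      weaken : ∀ {m n v} → m ≤ n → Supp (λ j → rank j ≤ m) v → Supp (λ j → rank j ≤ n) v
      weaken m≤n = Supp-⊆ (λ j j≤m → ℕ.≤-trans j≤m m≤n)

    module _ (R R* : Ranking d) where
      open Ranking R
      open Ranking R* using () renaming (rank to rank*; unrank to unrank*)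
      private
        module L₁ = Lowering A θ ordering R
        module L* = Lowering A* θ* ordering* R*

      Lo Lo* : ℕ → Sub
      Lo n  = E₁.Supp (λ j → rank j ≤ n)
      Lo* n = E*.Supp (λ j → rank* j ≤ n)

      -- The sum of the intersections with i + j = r, generated inductively: the subspace laws are
      -- constructors, and invariance needs work only on the generators.
      data Antidiagonal (r : ℕ) : Vec → Set where
        intersection : ∀ i j {v} → i ℕ.+ j ≡ r → Lo* i v → Lo j v → Antidiagonal r v
        respects     : ∀ {u v} → u ≈ᴹ v → Antidiagonal r u → Antidiagonal r v
        zero         : Antidiagonal r 0ᴹ
        plus         : ∀ {u v} → Antidiagonal r u → Antidiagonal r v → Antidiagonal r (u +ᴹ v)
        scale        : ∀ c {v} → Antidiagonal r v → Antidiagonal r (c *ₗ v)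

      -- Write A = (A - θₖ) + θₖ with `k` of rank `j`. Then A - θₖ lowers `j` by one, while
      -- tridiagonality raises `i` by at most one, so i + j is preserved; for j = 0 the first part
      -- is zero. A* moves along the antidiagonal in the opposite direction.
      antidiagonal-A : ∀ {r} → r ≤ d → ∀ {v} → Antidiagonal r v → Antidiagonal r (app A v)
      antidiagonal-A r≤d (respects u≈v w) = respects (End.cong A u≈v) (antidiagonal-A r≤d w)
      antidiagonal-A r≤d zero             = respects (≈ᴹ-sym (app-0 A)) zero
      antidiagonal-A r≤d (plus w w′)      = respects (≈ᴹ-sym (End.+-hom A _ _)) (plus (antidiagonal-A r≤d w) (antidiagonal-A r≤d w′))
      antidiagonal-A r≤d (scale c w)      = respects (≈ᴹ-sym (End.*-hom A c _)) (scale c (antidiagonal-A r≤d w))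
      antidiagonal-A {r} r≤d (intersection i j {v} eq v∈* v∈) with unrank j (ℕ.≤-trans (ℕ.m+n≤o⇒n≤o i (ℕ.≤-reflexive eq)) r≤d)
      ... | k , rank-k = respects eq′ (plus (shifted j eq rank-k v∈) (scale (θ k) (intersection i j eq v∈* v∈)))
        where
        eq′ : (app A v +ᴹ (- θ k) *ₗ v) +ᴹ θ k *ₗ v ≈ᴹ app A v
        eq′ = ≈ᴹ-trans (+ᴹ-congʳ (+ᴹ-congˡ (-ᴹ-*ₗ (θ k) v))) (≈ᴹ-sym (sub-add _ _))
        shifted : ∀ j → i ℕ.+ j ≡ r → rank k ≡ j → Lo j v → Antidiagonal r (app A v +ᴹ (- θ k) *ₗ v)
        shifted zero    _  rank-k v∈ = respects (≈ᴹ-sym (E₁.comp-zero (λ l → L₁.lower k rank-k v∈ l (λ ())))) zero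
        shifted (suc j) eq rank-k v∈ = intersection (suc i) j (≡.trans (≡.sym (ℕ.+-suc i j)) eq)
          (E*.Supp-+ (L*.raise A A-tridiagonal v∈*) (E*.Supp-* (- θ k) (L*.weaken (ℕ.n≤1+n i) v∈*)))
          (E₁.Supp-⊆ (λ _ → ℕ.≤-pred) (L₁.lower k rank-k v∈))

      antidiagonal-A* : ∀ {r} → r ≤ d → ∀ {v} → Antidiagonal r v → Antidiagonal r (app A* v)
      antidiagonal-A* r≤d (respects u≈v w) = respects (End.cong A* u≈v) (antidiagonal-A* r≤d w)
      antidiagonal-A* r≤d zero             = respects (≈ᴹ-sym (app-0 A*)) zero
      antidiagonal-A* r≤d (plus w w′)      = respects (≈ᴹ-sym (End.+-hom A* _ _)) (plus (antidiagonal-A* r≤d w) (antidiagonal-A* r≤d w′))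
      antidiagonal-A* r≤d (scale c w)      = respects (≈ᴹ-sym (End.*-hom A* c _)) (scale c (antidiagonal-A* r≤d w))
      antidiagonal-A* {r} r≤d (intersection i j {v} eq v∈* v∈) with unrank* i (ℕ.≤-trans (ℕ.m+n≤o⇒m≤o i (ℕ.≤-reflexive eq)) r≤d)
      ... | k , rank-k = respects eq′ (plus (shifted i eq rank-k v∈*) (scale (θ* k) (intersection i j eq v∈* v∈)))
        where
        eq′ : (app A* v +ᴹ (- θ* k) *ₗ v) +ᴹ θ* k *ₗ v ≈ᴹ app A* v
        eq′ = ≈ᴹ-trans (+ᴹ-congʳ (+ᴹ-congˡ (-ᴹ-*ₗ (θ* k) v))) (≈ᴹ-sym (sub-add _ _))
        shifted : ∀ i → i ℕ.+ j ≡ r → rank* k ≡ i → Lo* i v → Antidiagonal r (app A* v +ᴹ (- θ* k) *ₗ v)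
        shifted zero    _  rank-k v∈* = respects (≈ᴹ-sym (E*.comp-zero (λ l → L*.lower k rank-k v∈* l (λ ())))) zero
        shifted (suc i) eq rank-k v∈* = intersection i (suc j) (≡.trans (ℕ.+-suc i j) eq)
          (E*.Supp-⊆ (λ _ → ℕ.≤-pred) (L*.lower k rank-k v∈*))
          (E₁.Supp-+ (L₁.raise A* A*-tridiagonal v∈) (E₁.Supp-* (- θ* k) (L₁.weaken (ℕ.n≤1+n j) v∈)))

      antidiagonal⊆Lo : ∀ {r v} → Antidiagonal r v → Lo r v
      antidiagonal⊆Lo (intersection i j eq _ v∈) = L₁.weaken (ℕ.m+n≤o⇒n≤o i (ℕ.≤-reflexive eq)) v∈
      antidiagonal⊆Lo (respects u≈v w) = E₁.Supp-≈ u≈v (antidiagonal⊆Lo w)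
      antidiagonal⊆Lo zero             = E₁.Supp-0
      antidiagonal⊆Lo (plus w w′)      = E₁.Supp-+ (antidiagonal⊆Lo w) (antidiagonal⊆Lo w′)
      antidiagonal⊆Lo (scale c w)      = E₁.Supp-* c (antidiagonal⊆Lo w)

      -- The sum lies in `Lo r`, which for r < d misses every nonzero eigenvector of rank `d`. It is
      -- therefore a proper invariant subspace, and irreducibility refutes that it is nonzero.
      antidiagonal-trivial : ∀ {r} → r < d → ¬ ¬ (∀ v → Antidiagonal r v → v ≈ᴹ 0ᴹ)
      antidiagonal-trivial {r} r<d nontrivial = irreducible (Antidiagonal r , (respects , zero , plus , scale) ,
        (λ v → antidiagonal-A (ℕ.<⇒≤ r<d)) , (λ v → antidiagonal-A* (ℕ.<⇒≤ r<d)) , nontrivial , proper)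
        where
        proper : ¬ (Vₛ ⊆ Antidiagonal r)
        proper full with unrank d ℕ.≤-refl
        ... | k , rank-k with proj₁ (proj₂ ordering) k
        ...   | v , v∈ , v≉0 = v≉0 (≈ᴹ-trans (≈ᴹ-sym (E₁.comp-own v∈))
          (antidiagonal⊆Lo (full v tt) k (λ k≤r → ℕ.<⇒≱ r<d (≡.subst (_≤ r) rank-k k≤r))))

      intersection-trivial : ∀ {i j} → i ℕ.+ j < d → ¬ ¬ (∀ v → Lo* i v → Lo j v → v ≈ᴹ 0ᴹ)
      intersection-trivial {i} {j} i+j<d k = antidiagonal-trivial i+j<d
        (λ h → k (λ v v∈* v∈ → h v (intersection i j ≡.refl v∈* v∈)))

    module _ (R R* : Ranking d) where
      open Ranking R
      open Ranking R* using () renaming (rank to rank*; rank≤d to rank*≤d)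

      module _ (i : ℕ) (i<d : i < d) where
        private
          -- i + k = d - 1 is the largest sum for which `intersection-trivial` applies. After
          -- reversal, ranks above `i` and above `k` are bounded by `k` and `i`, with the same sum.
          k : ℕ
          k = d ∸ suc i
          k+1+i≡d : suc (i ℕ.+ k) ≡ d
          k+1+i≡d = ℕ.m+[n∸m]≡n i<d
          d∸1+k≡i : d ∸ suc k ≡ i
          d∸1+k≡i = ≡.trans (≡.cong (_∸ suc k) (≡.trans (≡.sym k+1+i≡d) (≡.sym (ℕ.+-suc i k)))) (ℕ.m+n∸n≡m i (suc k))
          low? : ∀ j → Dec (rank j ≤ k)
          low? j = rank j ℕ.≤? k
          low*? : ∀ j → Dec (rank* j ≤ i)
          low*? j = rank* j ℕ.≤? i
          P Q T : End
          P = toEnd (E*.proj low*?) (E*.proj-linear low*?)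
          Q = toEnd (E₁.proj low?) (E₁.proj-linear low?)
          T = (E.1# E.- P) E.* Q E.+ P E.* (E.1# E.- Q)

          T-kernel : (∀ v → Lo* R R* i v → Lo R R* k v → v ≈ᴹ 0ᴹ) →
            (∀ v → Lo* (reversed R) (reversed R*) k v → Lo (reversed R) (reversed R*) i v → v ≈ᴹ 0ᴹ) →
            ∀ v → app T v ≈ᴹ 0ᴹ → v ≈ᴹ 0ᴹ
          T-kernel low-zero high-zero v Tv≈0 = ≈ᴹ-trans (difference≈0ᴹ v q y≈0) q≈0
            where
            open SetoidReasoning ≈ᴹ-setoid
            q y : Vec
            q = app Q v
            y = v +ᴹ -ᴹ q
            Pq-fixed : app P (app P q) ≈ᴹ app P q
            Pq-fixed = E*.proj-id low*? (E*.proj-Supp low*? q)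
            -- P(1 - P) = 0, so applying `P` to `T` isolates P(1 - Q). Then `y` lies in the kernels
            -- of both projections, which is the intersection for the reversed orderings.
            Py≈0 : app P y ≈ᴹ 0ᴹ
            Py≈0 = begin
              app P y                                        ≈⟨ E*.proj-id low*? (E*.proj-Supp low*? y) ⟨
              app P (app P y)                                ≈⟨ +ᴹ-identityˡ _ ⟨
              0ᴹ +ᴹ app P (app P y)                          ≈⟨ +ᴹ-congʳ (-ᴹ‿inverseʳ (app P q)) ⟨
              app P q +ᴹ -ᴹ app P q +ᴹ app P (app P y)
                ≈⟨ +ᴹ-congʳ (+ᴹ-congˡ (≈ᴹ-trans (app-neg P _) (-ᴹ‿cong Pq-fixed))) ⟨
              app P q +ᴹ app P (-ᴹ app P q) +ᴹ app P (app P y)  ≈⟨ +ᴹ-congʳ (End.+-hom P _ _) ⟨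
              app P (q +ᴹ -ᴹ app P q) +ᴹ app P (app P y)     ≈⟨ End.+-hom P _ _ ⟨
              app P (app T v)                                ≈⟨ End.cong P Tv≈0 ⟩
              app P 0ᴹ                                       ≈⟨ app-0 P ⟩
              0ᴹ                                             ∎
            Qy≈0 : app Q y ≈ᴹ 0ᴹ
            Qy≈0 = ≈ᴹ-trans (End.+-hom Q _ _) (≈ᴹ-trans (+ᴹ-congˡ (≈ᴹ-trans (app-neg Q q)
              (-ᴹ‿cong (E₁.proj-id low? (E₁.proj-Supp low? v))))) (-ᴹ‿inverseʳ _))
            y≈0 : y ≈ᴹ 0ᴹ
            y≈0 = high-zero y
              (E*.proj-kernel low*? (λ j j≰i → ℕ.∸-monoʳ-≤ d (ℕ.≰⇒> j≰i)) Py≈0)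
              (E₁.proj-kernel low? (λ j j≰k → ℕ.≤-trans (ℕ.∸-monoʳ-≤ d (ℕ.≰⇒> j≰k)) (ℕ.≤-reflexive d∸1+k≡i)) Qy≈0)
            q≈Pq : app P q ≈ᴹ q
            q≈Pq = ≈ᴹ-sym (difference≈0ᴹ q (app P q) (≈ᴹ-trans (≈ᴹ-sym (≈ᴹ-trans (+ᴹ-congˡ Py≈0) (+ᴹ-identityʳ _))) Tv≈0))
            q≈0 : q ≈ᴹ 0ᴹ
            q≈0 = low-zero q (E*.Supp-≈ q≈Pq (E*.proj-Supp low*? q)) (E₁.proj-Supp low? v)

        -- T maps Q V onto (1 − P) V and (1 − Q) V onto P V, so it is bijective exactly when P V and Q V
        -- as well as (1 − P) V and (1 − Q) V are complementary.
        complement : ∀ w → ∃ λ p → ∃ λ q → Lo* R R* i p × Lo R R* k q × w ≈ᴹ p +ᴹ q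
        complement w = decompose (injective⇒surjective finDim T (λ not-injective →
          intersection-trivial R R* (ℕ.≤-reflexive k+1+i≡d) (λ low-zero →
            intersection-trivial (reversed R) (reversed R*) (ℕ.≤-reflexive (≡.trans (≡.cong suc (ℕ.+-comm k i)) k+1+i≡d))
              (λ high-zero → not-injective (T-kernel low-zero high-zero)))) w)
          where
          decompose : (∃ λ z → app T z ≈ᴹ w) → ∃ λ p → ∃ λ q → Lo* R R* i p × Lo R R* k q × w ≈ᴹ p +ᴹ q
          decompose (z , Tz≈w) = -ᴹ app P q +ᴹ app P (z +ᴹ -ᴹ q) , q ,
            E*.Supp-+ (E*.Supp-neg (E*.proj-Supp low*? q)) (E*.proj-Supp low*? (z +ᴹ -ᴹ q)) ,
            E₁.proj-Supp low? z ,
            ≈ᴹ-trans (≈ᴹ-sym Tz≈w) (≈ᴹ-trans (+ᴹ-assoc _ _ _) (+ᴹ-comm _ _))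
            where q = app Q z

      -- The decomposition Vᵢ = (E*₀V + ⋯ + E*ᵢV) ∩ (E₀V + ⋯ + E_{d−i}V), relative to the two rankings.
      module _ (U : Fin (suc d) → Sub)
        (U-out : ∀ i v → U i v → Lo* R R* (toℕ i) v × Lo R R* (d ∸ toℕ i) v)
        (U-in : ∀ i v → Lo* R R* (toℕ i) v → Lo R R* (d ∸ toℕ i) v → U i v) where
        open Bands U
        private
          module L₁ = Lowering A θ ordering R
          module L* = Lowering A* θ* ordering* R*

          difference-left : ∀ {w p q} → w ≈ᴹ p +ᴹ q → w +ᴹ -ᴹ q ≈ᴹ p
          difference-left {w} {p} {q} w≈ = ≈ᴹ-trans (+ᴹ-congʳ w≈) (≈ᴹ-trans (+ᴹ-assoc p q (-ᴹ q))
            (≈ᴹ-trans (+ᴹ-congˡ (-ᴹ‿inverseʳ q)) (+ᴹ-identityʳ p)))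

          -- Modular law: in w = p + q from `complement`, p = w - q inherits the bound d - i from
          -- `w` and `q`, and q = w - p the starred bound i + 1 from `w` and `p`.
          split : ∀ i → i < d → ∀ w → Lo* R R* (suc i) w → Lo R R* (d ∸ i) w →
            ∃ λ p → ∃ λ q → (Lo* R R* i p × Lo R R* (d ∸ i) p) × (Lo* R R* (suc i) q × Lo R R* (d ∸ suc i) q) × w ≈ᴹ p +ᴹ q
          split i i<d w w∈* w∈ = let (p , q , p∈* , q∈ , w≈) = complement i i<d w in p , q ,
            (p∈* , E₁.Supp-≈ (difference-left w≈) (E₁.Supp-+ w∈ (E₁.Supp-neg (L₁.weaken (ℕ.∸-monoʳ-≤ d (ℕ.n≤1+n i)) q∈)))) ,
            (E*.Supp-≈ (difference-left (≈ᴹ-trans w≈ (+ᴹ-comm p q))) (E*.Supp-+ w∈* (E*.Supp-neg (L*.weaken (ℕ.n≤1+n i) p∈*))) , q∈) ,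
            w≈

        up : ∀ T → E*.Tridiagonal T → (∀ v → app A (app T v) ≈ᴹ app T (app A v)) →
          ∀ i → MapsInto (app T) (U i) (U i +ₛ Next U i)
        up T tri commutes i v v∈ = by-cases (toℕ i ℕ.<? d)
          where
          Tv∈* : Lo* R R* (suc (toℕ i)) (app T v)
          Tv∈* = L*.raise T tri (proj₁ (U-out i v v∈))
          Tv∈ : Lo R R* (d ∸ toℕ i) (app T v)
          Tv∈ = E₁.commuting-Supp T commutes (proj₂ (U-out i v v∈))
          by-cases : Dec (toℕ i < d) → (U i +ₛ Next U i) (app T v)
          -- Here i = d, and the starred rank bound is no restriction, so no second summand arises.
          by-cases (no i≮d) = app T v , 0ᴹ ,
            U-in i (app T v) (E*.Supp-⊆ {v = app T v} (λ l _ → ℕ.≤-trans (rank*≤d l) (ℕ.≮⇒≥ i≮d)) Tv∈*) Tv∈ ,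
            Next-zero i i≮d ≈ᴹ-refl , ≈ᴹ-sym (+ᴹ-identityʳ _)
          by-cases (yes i<d) = let (p , q , (p∈* , p∈) , (q∈* , q∈) , Tv≈) = split (toℕ i) i<d (app T v) Tv∈* Tv∈ in
            p , q , U-in i p p∈* p∈ ,
            Next-in i j j≡ (U-in j q (≡.subst (λ n → Lo* R R* n q) (≡.sym j≡) q∈*)
              (≡.subst (λ n → Lo R R* (d ∸ n) q) (≡.sym j≡) q∈)) , Tv≈
            where
            j = Fin.fromℕ< (s≤s i<d)
            j≡ : toℕ j ≡ suc (toℕ i)
            j≡ = Fin.toℕ-fromℕ< (s≤s i<d)

        down : ∀ T → E₁.Tridiagonal T → (∀ v → app A* (app T v) ≈ᴹ app T (app A* v)) →
          ∀ i → MapsInto (app T) (U i) (Prev U i +ₛ U i)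
        down T tri commutes zero v v∈ = 0ᴹ , app T v , Prev-zero zero ≡.refl ≈ᴹ-refl ,
          U-in zero (app T v) (E*.commuting-Supp T commutes (proj₁ (U-out zero v v∈)))
            (E₁.Supp-⊆ {v = app T v} (λ l _ → rank≤d l) (L₁.raise T tri (proj₂ (U-out zero v v∈)))) ,
          ≈ᴹ-sym (+ᴹ-identityˡ _)
        down T tri commutes (suc i) v v∈ =
          let (p , q , (p∈* , p∈) , (q∈* , q∈) , Tv≈) = split (toℕ i) (Fin.toℕ<n i) (app T v)
                (E*.commuting-Supp T commutes (proj₁ (U-out (suc i) v v∈)))
                (≡.subst (λ n → Lo R R* n (app T v)) (≡.sym (ℕ.+-∸-assoc 1 (Fin.toℕ<n i)))
                  (L₁.raise T tri (proj₂ (U-out (suc i) v v∈))))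
          in p , q ,
          Prev-in (suc i) j (≡.cong suc j≡) (U-in j p (≡.subst (λ n → Lo* R R* n p) (≡.sym j≡) p∈*)
            (≡.subst (λ n → Lo R R* (d ∸ n) p) (≡.sym j≡) p∈)) ,
          U-in (suc i) q q∈* q∈ , Tv≈
          where
          j = inject₁ i
          j≡ : toℕ j ≡ toℕ i
          j≡ = Fin.toℕ-inject₁ i

  -- Tridiagonal systems of q-Serre type

  module QSerreType (finDim : FinDimNonzero)
    (b : Carrier) (b≉0 : ¬ (b ≈ 0#)) (b-not-root : ∀ n → ¬ (pow b (suc n) ≈ 1#))
    (d : ℕ) (1≤d : 1 ≤ d) (Φ : TDSystem d) (serreType : SerreType b Φ) where
    open TDSystem Φ
    open Alternating b (app A) (app As)
    open LinearAlgebra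
    open EndomorphismRing
    open AlternatingOperators b b≉0 b-not-root A As
    open AbelianGroupProperties +ᴹ-abelianGroup using () renaming (x∙y⁻¹≈ε⇒x≈y to difference≈0ᴹ)
    module A-eigen  = Eigenspaces A θ ordA
    module As-eigen = Eigenspaces As θs ordAs
    module A-bands  = EigenBands A θ ordA
    module As-bands = EigenBands As θs ordAs

    σ : Carrier
    σ = 1# + b + bi

    module A-geometric = A-eigen.Geometric b bi b*bi≈1 b-not-root σ refl 1≤d (proj₁ serreType)
    module As-geometric = As-eigen.Geometric bi b (trans (*-comm _ _) b*bi≈1)
      (Powers.r′-not-root b bi b*bi≈1 b-not-root) σ
      (trans (+-assoc _ _ _) (trans (+-congˡ (+-comm _ _)) (sym (+-assoc _ _ _)))) 1≤d (proj₂ serreType)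

    As-tridiagonal : A-eigen.Tridiagonal As
    As-tridiagonal = A-bands.Tri⇒Tridiagonal As tridiagA

    A-tridiagonal : As-eigen.Tridiagonal A
    A-tridiagonal = As-bands.Tri⇒Tridiagonal A tridiagAs

    σ-scalar : ∀ v → σ *ₗ v ≈ᴹ v +ᴹ b *ₗ v +ᴹ bi *ₗ v
    σ-scalar v = ≈ᴹ-trans (scalar-+ (1# + b) bi v) (+ᴹ-congʳ (≈ᴹ-trans (scalar-+ 1# b v) (+ᴹ-congʳ (scalar-1 v))))

    serreσ-serre : ∀ S T v →
      app (((S E.* S E.* S E.* T E.- scalar σ E.* (S E.* S E.* T E.* S)) E.+ scalar σ E.* (S E.* T E.* S E.* S))
        E.- T E.* S E.* S E.* S) v ≈ᴹ app (serre S T) v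
    serreσ-serre S T v = +ᴹ-congʳ (+ᴹ-cong (+ᴹ-congˡ (-ᴹ‿cong (σ-scalar _))) (σ-scalar _))

    -- Both q-Serre relations come from the tridiagonal action of each of A, A* on the eigenspaces
    -- of the other.
    open Relations
      (λ v → ≈ᴹ-trans (≈ᴹ-sym (serreσ-serre A As v)) (A-geometric.tridiagonal⇒serre As As-tridiagonal v))
      (λ v → ≈ᴹ-trans (≈ᴹ-sym (serreσ-serre As A v)) (As-geometric.tridiagonal⇒serre A A-tridiagonal v))

    Wminus-commutes : ∀ k v → app A (Wminus k v) ≈ᴹ Wminus k (app A v)
    Wminus-commutes k v = difference≈0ᴹ _ _ ([x,X]≈0 k v)

    Wplus-commutes : ∀ k v → app As (Wplus k v) ≈ᴹ Wplus k (app As v)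
    Wplus-commutes k v = difference≈0ᴹ _ _ ([y,Y]≈0 k v)

    Wplus-tridiagonal : ∀ k → A-eigen.Tridiagonal (Y k)
    Wplus-tridiagonal k = A-geometric.serre-commutator⇒tridiagonal (Y k)
      (λ v → ≈ᴹ-trans (serreσ-serre A (A E.* Y k E.- Y k E.* A) v) (serre-x-[x,Y] k v))

    Wminus-tridiagonal : ∀ k → As-eigen.Tridiagonal (X k)
    Wminus-tridiagonal k = As-geometric.serre-commutator⇒tridiagonal (X k)
      (λ v → ≈ᴹ-trans (serreσ-serre As (As E.* X k E.- X k E.* As) v) (serre-y-[y,X] k v))

    commuting-eigen : ∀ (S T : End) c → (∀ v → app S (app T v) ≈ᴹ app T (app S v)) → MapsInto (app T) (Eig S c) (Eig S c)
    commuting-eigen S T c commutes v v∈ = ≈ᴹ-trans (commutes v) (≈ᴹ-trans (End.cong T v∈) (End.*-hom T c v))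

    module Split = SplitDecomposition A As θ θs ordA ordAs As-tridiagonal A-tridiagonal irreducible finDim

    PartC : (Fin (suc d) → Sub) → ℕ → Fin (suc d) → Set
    PartC S k i = MapsInto (Wminus k) (S i) (S i +ₛ Next S i) × MapsInto (Wplus k) (S i) (Prev S i +ₛ S i)

    module _ (R R* : Ranking d) (S : Fin (suc d) → Sub)
      (out : ∀ i v → S i v → Split.Lo* R R* (toℕ i) v × Split.Lo R R* (d ∸ toℕ i) v)
      (into : ∀ i v → Split.Lo* R R* (toℕ i) v → Split.Lo R R* (d ∸ toℕ i) v → S i v) where

      partC : ∀ k i → PartC S k i
      partC k i = Split.up R R* S out into (X k) (Wminus-tridiagonal k) (Wminus-commutes k) i ,
        Split.down R R* S out into (Y k) (Wplus-tridiagonal k) (Wplus-commutes k) i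

    up descending : Ranking d
    up = ascending d
    descending = reversed up

    Range : ℕ → ℕ → Fin (suc d) → Set
    Range lo hi j = lo ≤ toℕ j × toℕ j ≤ hi

    range⇒below : ∀ {n} j → Range 0 n j → toℕ j ≤ n
    range⇒below j = proj₂

    below⇒range : ∀ {n} j → toℕ j ≤ n → Range 0 n j
    below⇒range j j≤n = z≤n , j≤n

    range⇒above : ∀ {n} j → Range (d ∸ n) d j → d ∸ toℕ j ≤ n
    range⇒above {n} j (d∸n≤j , _) = ℕ.m≤n+o⇒m∸n≤o d (toℕ j) (ℕ.≤-trans (ℕ.m≤n+m∸n d n)
      (ℕ.≤-trans (ℕ.+-monoʳ-≤ n d∸n≤j) (ℕ.≤-reflexive (ℕ.+-comm n (toℕ j)))))

    above⇒range : ∀ {n} j → d ∸ toℕ j ≤ n → Range (d ∸ n) d j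
    above⇒range {n} j d∸j≤n = ℕ.m≤n+o⇒m∸n≤o d n (ℕ.≤-trans (ℕ.m≤n+m∸n d (toℕ j))
      (ℕ.≤-trans (ℕ.+-monoʳ-≤ (toℕ j) d∸j≤n) (ℕ.≤-reflexive (ℕ.+-comm (toℕ j) n)))) , ℕ.≤-pred (Fin.toℕ<n j)

    range⇒above′ : ∀ (i : Fin (suc d)) j → Range (toℕ i) d j → d ∸ toℕ j ≤ d ∸ toℕ i
    range⇒above′ i j (i≤j , _) = ℕ.∸-monoʳ-≤ d i≤j

    above⇒range′ : ∀ (i : Fin (suc d)) j → d ∸ toℕ j ≤ d ∸ toℕ i → Range (toℕ i) d j
    above⇒range′ i j h = ℕ.∸-cancelʳ-≤ (ℕ.≤-pred (Fin.toℕ<n i)) h , ℕ.≤-pred (Fin.toℕ<n j)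

    -- The four cases differ only in the rankings: `up` for the ends 0 and 0*, `descending` for D
    -- and D*, the first ranking being that of `A`.
    partC-0s0 : ∀ k i → PartC dec0s0 k i
    partC-0s0 = partC up up dec0s0
      (λ i v (v∈* , v∈) → As-eigen.Supp-⊆ range⇒below (As-eigen.RangeSum⇒Supp v∈*) ,
        A-eigen.Supp-⊆ range⇒below (A-eigen.RangeSum⇒Supp v∈))
      (λ i v v∈* v∈ → As-eigen.Supp⇒RangeSum (As-eigen.Supp-⊆ below⇒range v∈*) ,
        A-eigen.Supp⇒RangeSum (A-eigen.Supp-⊆ below⇒range v∈))

    partC-0sD : ∀ k i → PartC dec0sD k i
    partC-0sD = partC descending up dec0sD
      (λ i v (v∈* , v∈) → As-eigen.Supp-⊆ range⇒below (As-eigen.RangeSum⇒Supp v∈*) ,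
        A-eigen.Supp-⊆ (range⇒above′ i) (A-eigen.RangeSum⇒Supp v∈))
      (λ i v v∈* v∈ → As-eigen.Supp⇒RangeSum (As-eigen.Supp-⊆ below⇒range v∈*) ,
        A-eigen.Supp⇒RangeSum (A-eigen.Supp-⊆ (above⇒range′ i) v∈))

    partC-Ds0 : ∀ k i → PartC decDs0 k i
    partC-Ds0 = partC up descending decDs0
      (λ i v (v∈* , v∈) → As-eigen.Supp-⊆ range⇒above (As-eigen.RangeSum⇒Supp v∈*) ,
        A-eigen.Supp-⊆ range⇒below (A-eigen.RangeSum⇒Supp v∈))
      (λ i v v∈* v∈ → As-eigen.Supp⇒RangeSum (As-eigen.Supp-⊆ above⇒range v∈*) ,
        A-eigen.Supp⇒RangeSum (A-eigen.Supp-⊆ below⇒range v∈))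

    partC-DsD : ∀ k i → PartC decDsD k i
    partC-DsD = partC descending descending decDsD
      (λ i v (v∈* , v∈) → As-eigen.Supp-⊆ range⇒above (As-eigen.RangeSum⇒Supp v∈*) ,
        A-eigen.Supp-⊆ (range⇒above′ i) (A-eigen.RangeSum⇒Supp v∈))
      (λ i v v∈* v∈ → As-eigen.Supp⇒RangeSum (As-eigen.Supp-⊆ above⇒range v∈*) ,
        A-eigen.Supp⇒RangeSum (A-eigen.Supp-⊆ (above⇒range′ i) v∈))

theorem9p8 :
    (F : Field) (V : LeftModule (Field.ring F) 0ℓ 0ℓ) →
    let open Field F
        open Setup F V
    in FinDimNonzero →
       (b : Carrier) → ¬ (b ≈ 0#) → (∀ (n : ℕ) → ¬ (pow b (suc n) ≈ 1#)) →
       (d : ℕ) → 1 ≤ d → (Φ : TDSystem d) → SerreType b Φ →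
       let open TDSystem Φ
           open Alternating b (app A) (app As)
           Tri : (Fin (suc d) → Sub) → Fin (suc d) → Sub
           Tri S i = (Prev S i +ₛ S i) +ₛ Next S i
           Up : (Fin (suc d) → Sub) → Fin (suc d) → Sub
           Up S i = S i +ₛ Next S i
           Down : (Fin (suc d) → Sub) → Fin (suc d) → Sub
           Down S i = Prev S i +ₛ S i
           PartC : (Fin (suc d) → Sub) → ℕ → Fin (suc d) → Set
           PartC S k i = MapsInto (Wminus k) (S i) (Up S i) × MapsInto (Wplus k) (S i) (Down S i)
       in (k : ℕ) (i : Fin (suc d)) →
          -- (a) [0,D]
          (MapsInto (Wminus k) (dec0D i) (dec0D i) × MapsInto (Wplus k) (dec0D i) (Tri dec0D i)) ×
          -- (b) [0*,D*]
          (MapsInto (Wminus k) (dec0sDs i) (Tri dec0sDs i) × MapsInto (Wplus k) (dec0sDs i) (dec0sDs i)) ×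
          -- (c) [0*,0], [0*,D], [D*,0], [D*,D]
          PartC dec0s0 k i × PartC dec0sD k i × PartC decDs0 k i × PartC decDsD k i
theorem9p8 F V finDim b b≉0 b-not-root d 1≤d Φ serreType k i =
  (commuting-eigen A (X k) (θ i) (Wminus-commutes k) , A-bands.Tridiagonal⇒Tri {Y k} (Wplus-tridiagonal k) i) ,
  (As-bands.Tridiagonal⇒Tri {X k} (Wminus-tridiagonal k) i , commuting-eigen As (Y k) (θs i) (Wplus-commutes k)) ,
  partC-0s0 k i , partC-0sD k i , partC-Ds0 k i , partC-DsD k i
  where
  open Setup F V
  open TDSystem Φ
  open Representation F V
  open QSerreType finDim b b≉0 b-not-root d 1≤d Φ serreType
  open AlternatingOperators b b≉0 b-not-root A As using (X; Y)
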